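{- Let $n\ge r\ge 3$ be integers and let $\mathcal{H}$ be a connected $r$-uniform hypergraph on $n$ vertices. Then $$\sum_{e\in E(\mathcal{H})}\frac{1}{f_r(p_{\mathcal{H}}(e))}\le n.$$ Moreover, equality holds if and only if one of the following holds: (i) $n=r+1$ and $|E(\mathcal{H})|\in\{1,2,\ldots,r-1,r+1\}$; (ii) $n\neq r+1$ and $\mathcal{H}$ is the complete $r$-uniform hypergraph on $n$ vertices, i.e. $|E(\mathcal{H})|=\binom{n}{r}$.
   Context: Hypergraphs are simple (edges are distinct subsets of the vertex set); an $r$-uniform hypergraph has all edges of size $r$. A Berge path of length $k$ is an alternating sequence $v_0e_1v_1e_2\cdots v_{k-1}e_kv_k$ of distinct vertices $v_0,\dots,v_k$ and distinct edges $e_1,\dots,e_k$ with $v_{i-1},v_i\in e_i$ for all $i$; $e_1,\dots,e_k$ are its defining edges. A hypergraph is connected if every pair of distinct vertices are the two terminal vertices of some Berge path. For an edge $e$, $p_{\mathcal{H}}(e)$ is the maximum $k$ such that $e$ is a defining edge of some Berge path of length $k$ in $\mathcal{H}$. For $r\ge 3$ and real $x\ge1$, $f_r(x)=\frac1r$ if $x=1$, $f_r(x)=\frac{x}{r+1}$ if $1<x\le r-1$, and $f_r(x)=\frac1r\binom{x}{r-1}$ if $x\ge r$. -}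

module Defs where

open import Data.Nat as ℕ using (ℕ; zero; suc; _≤_; _<_; _≟_)
open import Data.Nat.Combinatorics using (_C_)
open import Data.Integer using (+_)
open import Data.Rational as ℚ using (ℚ; 0ℚ; _/_; 1/_; _+_; ≢-nonZero)
open import Data.Fin using (Fin; inject₁; fromℕ) renaming (zero to fzero; suc to fsuc)
open import Data.Fin.Subset using (Subset; _∈_; ∣_∣)
open import Data.Product using (Σ; ∃; ∃-syntax; _×_)
open import Function.Definitions using (Injective)
open import Relation.Binary.PropositionalEquality using (_≡_; _≢_)
open import Relation.Nullary using (yes; no)

record Hypergraph (n : ℕ) : Set where
  field
    m     : ℕ
    edge  : Fin m → Subset n
    distinct : Injective _≡_ _≡_ edge
open Hypergraph public

Uniform : ∀ {n} → ℕ → Hypergraph n → Set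
Uniform r H = ∀ j → ∣ edge H j ∣ ≡ r

record BergePath {n} (H : Hypergraph n) (k : ℕ) : Set where
  field
    vtx      : Fin (suc k) → Fin n
    vtx-inj  : Injective _≡_ _≡_ vtx
    edg      : Fin k → Fin (m H)
    edg-inj  : Injective _≡_ _≡_ edg
    left∈    : ∀ i → vtx (inject₁ i) ∈ edge H (edg i)
    right∈   : ∀ i → vtx (fsuc i) ∈ edge H (edg i)
open BergePath public

Connected : ∀ {n} → Hypergraph n → Set
Connected {n} H = ∀ (u w : Fin n) → u ≢ w →
  ∃[ k ] Σ (BergePath H k) λ P → (vtx P fzero ≡ u) × (vtx P (fromℕ k) ≡ w)

Defines : ∀ {n} {H : Hypergraph n} {k} → BergePath H k → Fin (m H) → Set
Defines {k = k} P j = ∃[ i ] edg P i ≡ j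

IsPH : ∀ {n} (H : Hypergraph n) → Fin (m H) → ℕ → Set
IsPH H j p =
  (Σ (BergePath H p) λ P → Defines P j) ×
  (∀ k (P : BergePath H k) → Defines P j → k ≤ p)

-- f_r(x) for r ≥ 1 and natural x (only x ≥ 1, r ≥ 3 are used):
--   x = 1         ↦ 1/r
--   1 < x ≤ r-1   ↦ x/(r+1)
--   x ≥ r         ↦ (1/r) * C(x, r-1)
-- (r = 0 and x = 0 are junk values, never used)
f : ℕ → ℕ → ℚ
f zero x = 0ℚ
f (suc r) x with x ≟ 1
... | yes _ = + 1 / suc r
... | no _ with x ℕ.≤? r
...   | yes _ = + x / suc (suc r)
...   | no _  = + (x C r) / suc r

-- reciprocal on ℚ (1/q for q ≠ 0; junk value 0 at 0, never used since f > 0 here)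
recip : ℚ → ℚ
recip q with q ℚ.≟ 0ℚ
... | yes _ = 0ℚ
... | no q≢0 = 1/_ q ⦃ ≢-nonZero q≢0 ⦄

Σℚ : (m : ℕ) → (Fin m → ℚ) → ℚ
Σℚ zero g = 0ℚ
Σℚ (suc m) g = g fzero + Σℚ m (λ i → g (fsuc i))

ℕ→ℚ : ℕ → ℚ
ℕ→ℚ n = + n / 1

{-# OPTIONS --safe #-}
module Submission where

{- A Berge path is a path in the incidence graph of vertices and edges.  Let L be the length of a longest path among
the edges inside a vertex set A.  There is a nonempty set S of end vertices of such paths met by at most f(L)|S| of
these edges; all of them have p ≥ L, so deleting S and inducting on A gives the bound.  If the hypergraph is connected
and A is a nonempty proper subset of the vertices, the inequality for A is strict, because when A = S an edge leaving A
lengthens a longest path.  Hence equality forces S to be the whole vertex set.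

To find S: a cycle with L + 1 edges fills a component, and S is its vertex set.  Otherwise, for L ≥ r + 1 the positions
of the neighbours of the two ends of a longest path exclude one another as in Dirac's theorem, and S consists of one
or both ends; for r = 3 the degree bound just fails when both ends have equally many neighbours, and a rotation of the
path settles this case.  For L ≤ r the edges are at least as large as the path is long: if there is a cycle with L edges,
S is the union of its edges, and otherwise S is either the part outside the path of its first and last edges, or the
part outside a cycle with L - 1 edges of one further edge. -}

-- Each formula for f_r is the ratio of edges to vertices in a tight component: one edge on r
-- vertices, x edges on r + 1 vertices, and C(x+1, r) edges on x + 1 vertices, since (1/r) C(x, r-1)
-- = C(x+1, r)/(x+1). As 1/f_r decreases, edges with p ≥ L weigh at most 1/f_r(L) each, so f_r(L)|S|
-- of them weigh at most |S| together.
--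
-- The obstacle is that p is a global quantity while the induction shrinks the hypergraph. So p is
-- never recomputed: L is measured inside A, and an edge at S only has to lie on some path of length
-- L. It does: a nondefining edge at an end of a longest path has all its vertices on the path, and
-- turning an initial segment around brings it onto another longest path.
--
-- Neither longest paths nor cycles are searched for. Their existence is used under double negation,
-- which disappears at the end because comparisons of rationals and the list of equality cases are
-- decidable.

open import Data.Nat
open import Data.Nat.Properties
open import Data.Nat.Combinatorics using (_C_; nCk+nC[k+1]≡[n+1]C[k+1]; nCn≡1; nC1≡n; k>n⇒nCk≡0; nCk≡nC[n∸k])
open import Data.Nat.Tactic.RingSolver using (solve)
open import Data.List using (List; []; _∷_)
open import Data.Product using (∃; ∃₂; Σ; _×_; _,_; proj₁; proj₂)
open import Data.Sum using (_⊎_; inj₁; inj₂; [_,_]′)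
open import Relation.Binary.PropositionalEquality hiding ([_]; J)

-- Binomial estimates

-- A linear inequality a ≤ b follows from an already known L ≤ R once b − a = (R − L) + c.
lin : ∀ {a b L R} c → L ≤ R → a + R + c ≡ b + L → a ≤ b
lin {a} {b} {L} {R} c L≤R eq = +-cancelʳ-≤ R a b (begin
  a + R      ≤⟨ m≤m+n (a + R) c ⟩
  a + R + c  ≡⟨ eq ⟩
  b + L      ≤⟨ +-monoʳ-≤ b L≤R ⟩
  b + R      ∎)
  where open ≤-Reasoning

infixr 6 _+≤_
_+≤_ : ∀ {a b c d} → a ≤ b → c ≤ d → a + c ≤ b + d
_+≤_ = +-mono-≤

C-mono : ∀ {m n} k → m ≤ n → m C k ≤ n C k
C-mono k m≤n = go (≤⇒≤′ m≤n)
  where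
  step : ∀ n k → n C k ≤ suc n C k
  step n zero = ≤-refl
  step n (suc k) = ≤-trans (m≤n+m _ _) (≤-reflexive (nCk+nC[k+1]≡[n+1]C[k+1] n k))
  go : ∀ {m n} → m ≤′ n → m C k ≤ n C k
  go ≤′-refl = ≤-refl
  go (≤′-step m≤n) = ≤-trans (go m≤n) (step _ k)

[1+n]Cn≡1+n : ∀ n → suc n C n ≡ suc n
[1+n]Cn≡1+n n = trans (nCk≡nC[n∸k] (n≤1+n n)) (trans (cong (suc n C_) (m+n∸n≡m 1 n)) (nC1≡n (suc n)))

1≤nCk : ∀ n k → k ≤ n → 1 ≤ n C k
1≤nCk n zero _ = ≤-refl
1≤nCk (suc n) (suc k) (s≤s k≤n) =
  ≤-trans (≤-trans (1≤nCk n k k≤n) (m≤m+n _ _)) (≤-reflexive (nCk+nC[k+1]≡[n+1]C[k+1] n k))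

n≤nCk : ∀ n k → 1 ≤ k → k < n → n ≤ n C k
n≤nCk (suc n) (suc k) _ (s≤s k<n) with m≤n⇒m<n∨m≡n k<n
... | inj₁ 1+k<n = subst (suc n ≤_) (nCk+nC[k+1]≡[n+1]C[k+1] n k) (1≤nCk n k (<⇒≤ k<n) +≤ n≤nCk n (suc k) (s≤s z≤n) 1+k<n)
... | inj₂ refl = ≤-reflexive (sym ([1+n]Cn≡1+n (suc k)))

-- Needed for an end of a longest path that has only defining edges: with L = r + t its degree will
-- be at most t + 1.
linear≤C : ∀ ρ t → 2 ≤ ρ → suc ρ * suc t ≤ (suc ρ + t) C ρ
linear≤C ρ zero 2≤ρ = subst₂ _≤_ (sym (*-identityʳ (suc ρ))) (cong (_C ρ) (sym (+-identityʳ (suc ρ)))) (n≤nCk (suc ρ) ρ (<⇒≤ 2≤ρ) ≤-refl)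
linear≤C (suc ρ) (suc t) 2≤ρ = begin
  suc (suc ρ) * suc (suc t)                                            ≡⟨ *-suc (suc (suc ρ)) (suc t) ⟩
  suc (suc ρ) + suc (suc ρ) * suc t                                    ≤⟨ +-mono-≤ (≤-trans (m≤m+n _ t) (n≤nCk _ ρ (s≤s⁻¹ 2≤ρ) (s≤s (m≤n⇒m≤1+n (m≤m+n ρ t))))) (linear≤C (suc ρ) t 2≤ρ) ⟩
  (suc (suc ρ) + t) C ρ + (suc (suc ρ) + t) C suc ρ                    ≡⟨ nCk+nC[k+1]≡[n+1]C[k+1] (suc (suc ρ) + t) ρ ⟩
  suc (suc (suc ρ) + t) C suc ρ                                        ≡⟨ cong (_C suc ρ) (+-suc (suc (suc ρ)) t) ⟨
  (suc (suc ρ) + suc t) C suc ρ                                        ∎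
  where open ≤-Reasoning

2*[2+n]Cn : ∀ n → 2 * ((2 + n) C n) ≡ (2 + n) * (1 + n)
2*[2+n]Cn zero = refl
2*[2+n]Cn (suc n) = begin
  2 * ((3 + n) C suc n)                              ≡⟨ cong (2 *_) (nCk+nC[k+1]≡[n+1]C[k+1] (2 + n) n) ⟨
  2 * ((2 + n) C n + (2 + n) C suc n)                ≡⟨ *-distribˡ-+ 2 ((2 + n) C n) _ ⟩
  2 * ((2 + n) C n) + 2 * ((2 + n) C suc n)          ≡⟨ cong₂ (λ x y → x + 2 * y) (2*[2+n]Cn n) ([1+n]Cn≡1+n (suc n)) ⟩
  (2 + n) * (1 + n) + 2 * (2 + n)                    ≡⟨ solve (n ∷ []) ⟩
  (3 + n) * (2 + n)                                  ∎
  where open ≡-Reasoning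

-- What deleting both ends of a path requires when only its L = r + 1 + t edges meet them. For t = 0
-- it is an equality, and for L = r it would fail.
half≤C : ∀ ρ t → 2 ≤ ρ → suc ρ * (suc (suc ρ) + t) ≤ 2 * ((suc (suc ρ) + t) C ρ)
half≤C ρ zero _ = ≤-reflexive (begin
  suc ρ * (suc (suc ρ) + 0)      ≡⟨ solve (ρ ∷ []) ⟩
  (2 + ρ) * (1 + ρ)              ≡⟨ 2*[2+n]Cn ρ ⟨
  2 * ((2 + ρ) C ρ)              ≡⟨ cong (λ n → 2 * (n C ρ)) (+-identityʳ (2 + ρ)) ⟨
  2 * ((2 + ρ + 0) C ρ)          ∎)
  where open ≡-Reasoning
half≤C (suc ρ) (suc t) 2≤ρ = begin
  suc (suc ρ) * (suc (suc (suc ρ)) + suc t)                            ≡⟨ solve (ρ ∷ t ∷ []) ⟩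
  1 * (2 + ρ) + suc (suc ρ) * (suc (suc (suc ρ)) + t)                  ≤⟨ +-mono-≤ (*-mono-≤ {1} {2} (s≤s z≤n) (≤-trans (m≤n⇒m≤1+n (m≤m+n _ t)) (n≤nCk _ ρ (s≤s⁻¹ 2≤ρ) (s≤s (m≤n⇒m≤1+n (m≤n⇒m≤1+n (m≤m+n ρ t))))))) (half≤C (suc ρ) t 2≤ρ) ⟩
  2 * ((3 + ρ + t) C ρ) + 2 * ((3 + ρ + t) C suc ρ)                    ≡⟨ *-distribˡ-+ 2 ((3 + ρ + t) C ρ) _ ⟨
  2 * ((3 + ρ + t) C ρ + (3 + ρ + t) C suc ρ)                          ≡⟨ cong (2 *_) (nCk+nC[k+1]≡[n+1]C[k+1] (3 + ρ + t) ρ) ⟩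
  2 * ((4 + ρ + t) C suc ρ)                                            ≡⟨ cong (λ n → 2 * (n C suc ρ)) (+-suc (3 + ρ) t) ⟨
  2 * ((3 + ρ + suc t) C suc ρ)                                        ∎
  where open ≤-Reasoning

private
  -- Among `2 + n` points, the left side counts the sets of size `suc s` that contain at most one of
  -- two chosen points.
  double-step : ∀ n s → n C suc s + 2 * (n C s) ≤ (2 + n) C suc s
  double-step n s = begin
    n C suc s + 2 * (n C s)              ≡⟨ rearrange (n C suc s) (n C s) ⟩
    n C s + (n C s + n C suc s)          ≤⟨ +-mono-≤ (C-mono s (n≤1+n n)) (≤-reflexive (nCk+nC[k+1]≡[n+1]C[k+1] n s)) ⟩
    suc n C s + suc n C suc s            ≡⟨ nCk+nC[k+1]≡[n+1]C[k+1] (suc n) s ⟩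
    (2 + n) C suc s                      ∎
    where
    open ≤-Reasoning
    rearrange : ∀ x y → x + 2 * y ≡ y + (y + x)
    rearrange x y = solve (x ∷ y ∷ [])

  double : ∀ n → 2 * suc n ≡ 2 + 2 * n
  double n = *-suc 2 n

-- In a set made of `a` pairs, each choice of `s` pairs has 2^s transversals.
2^s*C≤C : ∀ a s → 2 ^ s * (a C s) ≤ (2 * a) C s
2^s*C≤C a zero = ≤-refl
2^s*C≤C zero (suc s) = ≤-trans (≤-reflexive (*-zeroʳ (2 ^ suc s))) z≤n
2^s*C≤C (suc a) (suc s) = begin
  2 ^ suc s * (suc a C suc s)                          ≡⟨ cong (2 ^ suc s *_) (nCk+nC[k+1]≡[n+1]C[k+1] a s) ⟨
  2 ^ suc s * (a C s + a C suc s)                      ≡⟨ rearrange (2 ^ s) (a C s) (a C suc s) ⟩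
  2 ^ suc s * (a C suc s) + 2 * (2 ^ s * (a C s))      ≤⟨ +-mono-≤ (2^s*C≤C a (suc s)) (*-monoʳ-≤ 2 (2^s*C≤C a s)) ⟩
  (2 * a) C suc s + 2 * ((2 * a) C s)                  ≤⟨ double-step (2 * a) s ⟩
  (2 + 2 * a) C suc s                                  ≡⟨ cong (_C suc s) (double a) ⟨
  (2 * suc a) C suc s                                  ∎
  where
  open ≤-Reasoning
  rearrange : ∀ p x y → 2 * p * (x + y) ≡ 2 * p * y + 2 * (p * x)
  rearrange p x y = solve (p ∷ x ∷ y ∷ [])

private
  4+s≤2^[2+s] : ∀ s → 4 + s ≤ 2 ^ (2 + s)
  4+s≤2^[2+s] zero = ≤-refl
  4+s≤2^[2+s] (suc s) = begin
    5 + s                  ≡⟨ solve (s ∷ []) ⟩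
    1 + (4 + s)            ≤⟨ +-mono-≤ (≤-trans (s≤s z≤n) (4+s≤2^[2+s] s)) (4+s≤2^[2+s] s) ⟩
    x + x                  ≡⟨ cong (x +_) (+-identityʳ x) ⟨
    2 * x                  ∎
    where
    open ≤-Reasoning
    x = 2 ^ (2 + s)

  -- The start `a = 3 + s` of the induction in `half-star₀`. The right side at least doubles from
  -- one `s` to the next, and the square at most doubles.
  central : ∀ s → (4 + s) * (4 + s) ≤ (2 * (3 + s)) C (3 + s)
  central zero = m≤m+n 16 4
  central (suc s) = begin
    (5 + s) * (5 + s)                                          ≤⟨ lin (7 + 6 * s + s * s) (z≤n {0}) (square s) ⟩
    2 * ((4 + s) * (4 + s))                                    ≤⟨ *-monoʳ-≤ 2 (central s) ⟩
    2 * ((2 * (3 + s)) C (3 + s))                              ≤⟨ m≤n+m _ ((2 * (3 + s)) C (4 + s)) ⟩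
    (2 * (3 + s)) C (4 + s) + 2 * ((2 * (3 + s)) C (3 + s))    ≤⟨ double-step (2 * (3 + s)) (3 + s) ⟩
    (2 + 2 * (3 + s)) C (4 + s)                                ≡⟨ cong (_C (4 + s)) (double (3 + s)) ⟨
    (2 * (4 + s)) C (4 + s)                                    ∎
    where
    open ≤-Reasoning
    square : ∀ s → (5 + s) * (5 + s) + 0 + (7 + 6 * s + s * s) ≡ 2 * ((4 + s) * (4 + s)) + 0
    square s = solve (s ∷ [])

  half-star₀ : ∀ s a → 3 + s ≤′ a → (4 + s) * (a C (3 + s)) + (4 + s) * a ≤ (2 * a) C (3 + s)
  half-star₀ s _ ≤′-refl = begin
    (4 + s) * ((3 + s) C (3 + s)) + (4 + s) * (3 + s)    ≡⟨ cong (λ x → (4 + s) * x + (4 + s) * (3 + s)) (nCn≡1 (3 + s)) ⟩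
    (4 + s) * 1 + (4 + s) * (3 + s)                      ≡⟨ square s ⟩
    (4 + s) * (4 + s)                                    ≤⟨ central s ⟩
    (2 * (3 + s)) C (3 + s)                              ∎
    where
    open ≤-Reasoning
    square : ∀ s → (4 + s) * 1 + (4 + s) * (3 + s) ≡ (4 + s) * (4 + s)
    square s = solve (s ∷ [])
  half-star₀ s (suc a) (≤′-step 3+s≤a) = begin
    (4 + s) * (suc a C (3 + s)) + (4 + s) * suc a                      ≡⟨ cong (λ x → (4 + s) * x + (4 + s) * suc a) (nCk+nC[k+1]≡[n+1]C[k+1] a (2 + s)) ⟨
    (4 + s) * (a C (2 + s) + a C (3 + s)) + (4 + s) * suc a            ≤⟨ combine (4 + s) (a C (2 + s)) (a C (3 + s)) a ((2 * a) C (3 + s)) ((2 * a) C (2 + s)) (half-star₀ s a 3+s≤a) big (1≤nCk a (2 + s) (≤-trans (n≤1+n _) (≤′⇒≤ 3+s≤a))) ⟩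
    (2 * a) C (3 + s) + 2 * ((2 * a) C (2 + s))                        ≤⟨ double-step (2 * a) (2 + s) ⟩
    (2 + 2 * a) C (3 + s)                                              ≡⟨ cong (_C (3 + s)) (double a) ⟨
    (2 * suc a) C (3 + s)                                              ∎
    where
    open ≤-Reasoning
    -- The factor r = 4 + s is absorbed by the power 2^(r-2); for r = 3 this power would be too
    -- small.
    big : (4 + s) * (a C (2 + s)) ≤ (2 * a) C (2 + s)
    big = ≤-trans (*-monoˡ-≤ _ (4+s≤2^[2+s] s)) (2^s*C≤C a (2 + s))
    combine : ∀ r x y a p q → r * y + r * a ≤ p → r * x ≤ q → 1 ≤ x → r * (x + y) + r * suc a ≤ p + 2 * q
    combine r x y a p q h₁ h₂ h₃ = lin 0 (h₁ +≤ *-monoʳ-≤ 2 h₂ +≤ *-monoʳ-≤ r h₃) eq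
      where
      eq : r * (x + y) + r * suc a + (p + (2 * q + r * x)) + 0 ≡ p + 2 * q + (r * y + r * a + (2 * (r * x) + r * 1))
      eq = solve (r ∷ x ∷ y ∷ a ∷ p ∷ q ∷ [])

-- If the end with fewer outside neighbours has `a` of them and L = 2a + t, its degree is at most
-- C(a, r-1) + (L - a). With r = 4 + s, this is what the deletion of that end needs.
half-star : ∀ s a t → 3 + s ≤ a → (4 + s) * (a C (3 + s)) + (4 + s) * (a + t) ≤ (2 * a + t) C (3 + s)
half-star s a zero 3+s≤a = begin
  (4 + s) * (a C (3 + s)) + (4 + s) * (a + 0)    ≡⟨ cong (λ x → (4 + s) * (a C (3 + s)) + (4 + s) * x) (+-identityʳ a) ⟩
  (4 + s) * (a C (3 + s)) + (4 + s) * a          ≤⟨ half-star₀ s a (≤⇒≤′ 3+s≤a) ⟩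
  (2 * a) C (3 + s)                              ≡⟨ cong (_C (3 + s)) (+-identityʳ (2 * a)) ⟨
  (2 * a + 0) C (3 + s)                          ∎
  where open ≤-Reasoning
half-star s a (suc t) 3+s≤a = begin
  (4 + s) * (a C (3 + s)) + (4 + s) * (a + suc t)                    ≡⟨ rearrange (4 + s) (a C (3 + s)) a t ⟩
  (4 + s) + ((4 + s) * (a C (3 + s)) + (4 + s) * (a + t))            ≤⟨ +-mono-≤ (≤-trans 4+s≤ (n≤nCk (2 * a + t) (2 + s) (s≤s z≤n) (≤-trans (n≤1+n _) 4+s≤))) (half-star s a t 3+s≤a) ⟩
  (2 * a + t) C (2 + s) + (2 * a + t) C (3 + s)                      ≡⟨ nCk+nC[k+1]≡[n+1]C[k+1] (2 * a + t) (2 + s) ⟩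
  suc (2 * a + t) C (3 + s)                                          ≡⟨ cong (_C (3 + s)) (+-suc (2 * a) t) ⟨
  (2 * a + suc t) C (3 + s)                                          ∎
  where
  open ≤-Reasoning
  rearrange : ∀ r x a t → r * x + r * (a + suc t) ≡ r + (r * x + r * (a + t))
  rearrange r x a t = solve (r ∷ x ∷ a ∷ t ∷ [])
  4+s≤ : 4 + s ≤ 2 * a + t
  4+s≤ = lin (2 + s + t) (*-monoʳ-≤ 2 3+s≤a) eq
    where
    eq : 4 + s + 2 * a + (2 + s + t) ≡ 2 * a + t + 2 * (3 + s)
    eq = solve (s ∷ a ∷ t ∷ [])

2*nC2 : ∀ n → 2 * (suc n C 2) ≡ suc n * n
2*nC2 zero = refl
2*nC2 (suc n) = trans (cong (2 *_) (nCk≡nC[n∸k] {2} {2 + n} (s≤s (s≤s z≤n)))) (2*[2+n]Cn n)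

-- Here a = 2 + i, L = 2a + t, and the degree is taken to be C(a, 2) + (L - a) - 1. The saving of
-- one is essential: without it, a = 2 and t = 0 would read 9 ≤ 6.
half-star-3 : ∀ i t → 3 * ((2 + i) C 2) + 3 * (1 + i + t) ≤ (2 * (2 + i) + t) C 2
half-star-3 i t = *-cancelˡ-≤ 2 (begin
  2 * (3 * ((2 + i) C 2) + 3 * (1 + i + t))                    ≡⟨ rearrange ((2 + i) C 2) (1 + i + t) ⟩
  3 * (2 * ((2 + i) C 2)) + 6 * (1 + i + t)                    ≡⟨ cong (λ x → 3 * x + 6 * (1 + i + t)) (2*nC2 (suc i)) ⟩
  3 * ((2 + i) * (1 + i)) + 6 * (1 + i + t)                    ≤⟨ lin (t + 4 * (i * t) + t * t) (i≤i*i i) (solve (i ∷ t ∷ [])) ⟩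
  (4 + (2 * i + t)) * (3 + (2 * i + t))                        ≡⟨ 2*nC2 (3 + (2 * i + t)) ⟨
  2 * ((4 + (2 * i + t)) C 2)                                  ≡⟨ cong (λ n → 2 * (n C 2)) shape ⟩
  2 * ((2 * (2 + i) + t) C 2)                                  ∎)
  where
  open ≤-Reasoning
  rearrange : ∀ x y → 2 * (3 * x + 3 * y) ≡ 3 * (2 * x) + 6 * y
  rearrange x y = solve (x ∷ y ∷ [])
  i≤i*i : ∀ i → i ≤ i * i
  i≤i*i zero = z≤n
  i≤i*i (suc i) = m≤m+n (suc i) _
  shape : 4 + (2 * i + t) ≡ 2 * (2 + i) + t
  shape = solve (i ∷ t ∷ [])

shuffle : ∀ o α a → o + α + suc a ≡ suc o + (α + a)
shuffle o α a = solve (o ∷ α ∷ a ∷ [])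

-- The binomial coefficient is passed as a function c to keep it from being unfolded.
from-half-star : (c : ℕ → ℕ) → (∀ i t → 3 * c (2 + i) + 3 * (1 + i + t) ≤ c (2 * (2 + i) + t)) →
  ∀ a {L x} → 2 ≤ a → a + a ≤ L → x + suc a ≤ c a + L → 3 * x ≤ c L
from-half-star c half a {x = x} 2≤a 2a≤L d with m≤n⇒∃[o]m+o≡n 2≤a | m≤n⇒∃[o]m+o≡n 2a≤L
... | i , refl | t , refl = begin
  3 * x                                      ≤⟨ *-monoʳ-≤ 3 (lin {x} {c (2 + i) + (1 + i + t)} 0 d (eq (c (2 + i)))) ⟩
  3 * (c (2 + i) + (1 + i + t))              ≡⟨ *-distribˡ-+ 3 (c (2 + i)) _ ⟩
  3 * c (2 + i) + 3 * (1 + i + t)            ≤⟨ half i t ⟩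
  c (2 * (2 + i) + t)                        ≡⟨ cong c (eq' i t) ⟩
  c (2 + i + (2 + i) + t)                    ∎
  where
  open ≤-Reasoning
  eq : ∀ c → x + (c + (2 + i + (2 + i) + t)) + 0 ≡ c + (1 + i + t) + (x + (3 + i))
  eq c = solve (x ∷ c ∷ i ∷ t ∷ [])
  eq' : ∀ i t → 2 * (2 + i) + t ≡ 2 + i + (2 + i) + t
  eq' i t = solve (i ∷ t ∷ [])

-- For n = L and k = r - 1 this is f_r(L) (L + 1) = C(L + 1, r): the complete hypergraph on L + 1
-- vertices attains the bound.
absorb : ∀ n k → suc k * (suc n C suc k) ≡ suc n * (n C k)
absorb n zero = trans (*-identityˡ _) (trans (nC1≡n (suc n)) (sym (*-identityʳ (suc n))))
absorb zero (suc k) = trans (cong (suc (suc k) *_) (trans (sym (nCk+nC[k+1]≡[n+1]C[k+1] 0 (suc k))) (cong₂ _+_ (k>n⇒nCk≡0 {0} {suc k} (s≤s z≤n)) (k>n⇒nCk≡0 {0} {suc (suc k)} (s≤s z≤n)))))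
  (trans (*-zeroʳ (suc (suc k))) (sym (trans (*-identityˡ _) (k>n⇒nCk≡0 {0} {suc k} (s≤s z≤n)))))
absorb (suc n) (suc k) = begin
  (2 + k) * ((2 + n) C (2 + k))                                        ≡⟨ cong ((2 + k) *_) (nCk+nC[k+1]≡[n+1]C[k+1] (suc n) (suc k)) ⟨
  (2 + k) * (c + suc n C (2 + k))                                      ≡⟨ expand k c (suc n C (2 + k)) ⟩
  c + (suc k * c + (2 + k) * (suc n C (2 + k)))                        ≡⟨ cong₂ (λ x y → c + (x + y)) (absorb n k) (absorb n (suc k)) ⟩
  c + (suc n * (n C k) + suc n * (n C suc k))                          ≡⟨ cong (c +_) (*-distribˡ-+ (suc n) (n C k) _) ⟨
  c + suc n * (n C k + n C suc k)                                      ≡⟨ cong (λ x → c + suc n * x) (nCk+nC[k+1]≡[n+1]C[k+1] n k) ⟩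
  c + suc n * c                                                        ∎
  where
  open ≡-Reasoning
  c = suc n C suc k
  expand : ∀ k x y → (2 + k) * (x + y) ≡ x + (suc k * x + (2 + k) * y)
  expand k x y = solve (k ∷ x ∷ y ∷ [])

-- Here S is the number of vertices of an edge that lie outside a cycle with K = L - 1 edges, and κ of those inside.
off-cycle-few : ∀ {ρ K κ S} → 1 ≤ K → suc K ≤ ρ → κ ≤ K → S + κ ≡ suc ρ → suc (suc ρ) ≤ suc K * S
off-cycle-few {ρ} {suc i} {κ} {S} 1≤K K<ρ κ≤K S+κ with m≤n⇒∃[o]m+o≡n K<ρ
... | j , refl = begin
  suc (suc (suc (suc i) + j))    ≤⟨ lin (i * j + i + j) (z≤n {0}) (eq i j) ⟩
  suc (suc i) * (2 + j)          ≤⟨ *-monoʳ-≤ (suc (suc i)) (+-cancelʳ-≤ κ (2 + j) S (begin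
    2 + j + κ                      ≤⟨ +-monoʳ-≤ (2 + j) κ≤K ⟩
    2 + j + suc i                  ≡⟨ eq' i j ⟩
    suc (suc (suc i) + j)          ≡⟨ S+κ ⟨
    S + κ                          ∎)) ⟩
  suc (suc i) * S                ∎
  where
  open ≤-Reasoning
  eq : ∀ i j → suc (suc (suc (suc i) + j)) + 0 + (i * j + i + j) ≡ suc (suc i) * (2 + j) + 0
  eq i j = solve (i ∷ j ∷ [])
  eq' : ∀ i j → 2 + j + suc i ≡ suc (suc (suc i) + j)
  eq' i j = solve (i ∷ j ∷ [])

-- Writing `ρ = K + 1 + j` and `K = e + κ + i` turns the last hypothesis into `S = e + i + j + 2`;
-- the two sides then differ by a polynomial with nonnegative coefficients.
off-cycle-many : ∀ {ρ K κ S e} → suc K ≤ ρ → e + κ ≤ K → S + κ ≡ suc ρ → suc (suc ρ) * e ≤ suc K * S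
off-cycle-many {ρ} {K} {κ} {S} {e} K<ρ e+κ≤K S+κ with m≤n⇒∃[o]m+o≡n K<ρ | m≤n⇒∃[o]m+o≡n e+κ≤K
... | j , refl | i , refl with +-cancelʳ-≡ κ S (e + i + j + 2) (trans S+κ (shape e κ i j))
  where
  shape : ∀ e κ i j → suc (suc (e + κ + i) + j) ≡ e + i + j + 2 + κ
  shape e κ i j = solve (e ∷ κ ∷ i ∷ j ∷ [])
... | refl = lin (i * i + i * j + κ * i + e * i + 3 * i + κ * j + 2 * κ + j + 2) (z≤n {0}) (eq e κ i j)
  where
  eq : ∀ e κ i j → suc (suc (suc (e + κ + i) + j)) * e + 0 + (i * i + i * j + κ * i + e * i + 3 * i + κ * j + 2 * κ + j + 2)
    ≡ suc (e + κ + i) * (e + i + j + 2) + 0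
  eq e κ i j = solve (e ∷ κ ∷ i ∷ j ∷ [])

interchange : ∀ a b c d → (a + b) + (c + d) ≡ (a + c) + (b + d)
interchange a b c d = solve (a ∷ b ∷ c ∷ d ∷ [])

open import Data.Bool using (true; false; if_then_else_)
open import Data.Fin as Fin using (Fin; inject₁; fromℕ; fromℕ<)
open import Data.Fin.Properties using (any?; injective⇒≤) renaming (_≟_ to _≟F_)
open import Data.Fin.Subset hiding (_-_)
open import Data.Fin.Subset.Properties
open import Data.Vec using ([]; _∷_; tabulate; lookup; here; there)
open import Data.Vec.Properties using (lookup∘tabulate; []=⇒lookup; lookup⇒[]=)
open import Data.List using (length; filter; map; _++_; reverse; _∷ʳ_; allFin)
open import Data.List.Properties using (unfold-reverse; ∷-injectiveʳ; ++-assoc; ++-identityʳ; length-map)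
open import Data.List.Membership.Propositional using (find; lose) renaming (_∈_ to _∈ˡ_; _∉_ to _∉ˡ_)
open import Data.List.Membership.Propositional.Properties using (∈-++⁺ˡ; ∈-++⁺ʳ; ∈-∃++; ∈-filter⁺; ∈-filter⁻; ∈-allFin; ∈-map⁺; ∈-map⁻)
import Data.List.Membership.DecPropositional as DecMembership
open import Data.List.Relation.Unary.Any as Any using (here; there)
open import Data.List.Relation.Unary.All as All using ([]; _∷_)
open import Data.List.Relation.Unary.AllPairs using ([]; _∷_)
open import Data.List.Relation.Unary.Unique.Propositional using (Unique)
open import Data.List.Relation.Unary.Unique.Propositional.Properties using (Unique[x∷xs]⇒x∉xs; filter⁺; allFin⁺)
open import Data.List.Relation.Binary.Permutation.Propositional as Perm using (_↭_; ↭-sym; ↭-trans; ↭-refl; ↭-prep; ↭-reflexive; ↭⇒↭ₛ)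
open import Data.List.Relation.Binary.Permutation.Propositional.Properties using (∈-resp-↭; ↭-reverse; shift; shifts; ++-comm; ++⁺ˡ; ++⁺ʳ; ++⁺; ∷↭∷ʳ)
import Data.List.Relation.Binary.Permutation.Setoid.Properties as PermutationSetoid
open import Data.Empty using (⊥-elim) renaming (⊥ to Absurd)
open import Function using (_∘_; id; mk⇔)
open import Function.Bundles using (_⇔_)
open import Function.Definitions using (Injective)
open import Relation.Binary.Definitions using (Tri; tri<; tri≈; tri>)
open import Relation.Nullary using (¬_; Dec; yes; no; does)
open import Relation.Nullary.Decidable using (_×-dec_; _⊎-dec_; ¬?; map′; dec-true; decidable-stable)

-- Finite sets

module _ {n : ℕ} {P : Fin n → Set} (P? : ∀ i → Dec (P i)) where

  ⟪_⟫ : Subset n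
  ⟪_⟫ = tabulate (does ∘ P?)

  ∈⟪⟫⁺ : ∀ {i} → P i → i ∈ ⟪_⟫
  ∈⟪⟫⁺ {i} pi = lookup⇒[]= i ⟪_⟫ (trans (lookup∘tabulate (does ∘ P?) i) (dec-true (P? i) pi))

  ∈⟪⟫⁻ : ∀ {i} → i ∈ ⟪_⟫ → P i
  ∈⟪⟫⁻ {i} i∈ with P? i | trans (sym (lookup∘tabulate (does ∘ P?) i)) ([]=⇒lookup i∈)
  ... | yes p | _ = p
  ... | no _ | ()

x∉p─q : ∀ {n x} {p q : Subset n} → x ∈ p ─ q → x ∉ q
x∉p─q {p = _ ∷ _} {inside  ∷ _} () here
x∉p─q {p = _ ∷ _} {_ ∷ _} (there x∈) (there x∈q) = x∉p─q x∈ x∈q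

∣p∣≡∣p─q∣+∣p∩q∣ : ∀ {n} (p q : Subset n) → ∣ p ∣ ≡ ∣ p ─ q ∣ + ∣ p ∩ q ∣
∣p∣≡∣p─q∣+∣p∩q∣ [] [] = refl
∣p∣≡∣p─q∣+∣p∩q∣ (outside ∷ p) (outside ∷ q) = ∣p∣≡∣p─q∣+∣p∩q∣ p q
∣p∣≡∣p─q∣+∣p∩q∣ (outside ∷ p) (inside ∷ q) = ∣p∣≡∣p─q∣+∣p∩q∣ p q
∣p∣≡∣p─q∣+∣p∩q∣ (inside ∷ p) (outside ∷ q) = cong suc (∣p∣≡∣p─q∣+∣p∩q∣ p q)
∣p∣≡∣p─q∣+∣p∩q∣ (inside ∷ p) (inside ∷ q) = trans (cong suc (∣p∣≡∣p─q∣+∣p∩q∣ p q)) (sym (+-suc _ _))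

disjoint⇒∣p∣+∣q∣≤∣p∪q∣ : ∀ {n} (p q : Subset n) → (∀ {x} → x ∈ p → x ∉ q) → ∣ p ∣ + ∣ q ∣ ≤ ∣ p ∪ q ∣
disjoint⇒∣p∣+∣q∣≤∣p∪q∣ [] [] _ = z≤n
disjoint⇒∣p∣+∣q∣≤∣p∪q∣ (outside ∷ p) (outside ∷ q) d = disjoint⇒∣p∣+∣q∣≤∣p∪q∣ p q λ x∈p x∈q → d (there x∈p) (there x∈q)
disjoint⇒∣p∣+∣q∣≤∣p∪q∣ (outside ∷ p) (inside ∷ q) d rewrite +-suc ∣ p ∣ ∣ q ∣ =
  s≤s (disjoint⇒∣p∣+∣q∣≤∣p∪q∣ p q λ x∈p x∈q → d (there x∈p) (there x∈q))
disjoint⇒∣p∣+∣q∣≤∣p∪q∣ (inside ∷ p) (outside ∷ q) d = s≤s (disjoint⇒∣p∣+∣q∣≤∣p∪q∣ p q λ x∈p x∈q → d (there x∈p) (there x∈q))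
disjoint⇒∣p∣+∣q∣≤∣p∪q∣ (inside ∷ p) (inside ∷ q) d = ⊥-elim (d here here)

p⊆q∧∣q∣≤∣p∣⇒p≡q : ∀ {n} {p q : Subset n} → p ⊆ q → ∣ q ∣ ≤ ∣ p ∣ → p ≡ q
p⊆q∧∣q∣≤∣p∣⇒p≡q {p = p} {q} p⊆q ∣q∣≤∣p∣ = ⊆-antisym p⊆q λ {x} x∈q →
  decidable-stable (x ∈? p) λ x∉p → <⇒≱ (p⊂q⇒∣p∣<∣q∣ (p⊆q , x , x∈q , x∉p)) ∣q∣≤∣p∣

∣p∣≤length : ∀ {n} (p : Subset n) (xs : List (Fin n)) → (∀ {i} → i ∈ p → i ∈ˡ xs) → ∣ p ∣ ≤ length xs
∣p∣≤length {n} p [] p⊆ = subst (λ q → ∣ q ∣ ≤ 0) (sym (Empty-unique λ { (i , i∈p) → case (p⊆ i∈p) })) (≤-reflexive (∣⊥∣≡0 n))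
  where
  case : ∀ {i : Fin n} → i ∈ˡ [] → Absurd
  case ()
∣p∣≤length p (x ∷ xs) p⊆ = begin
  ∣ p ∣                          ≡⟨ ∣p∣≡∣p─q∣+∣p∩q∣ p ⁅ x ⁆ ⟩
  ∣ p ─ ⁅ x ⁆ ∣ + ∣ p ∩ ⁅ x ⁆ ∣  ≤⟨ +-mono-≤ (∣p∣≤length (p ─ ⁅ x ⁆) xs rest) (∣p∩q∣≤∣q∣ p ⁅ x ⁆) ⟩
  length xs + ∣ ⁅ x ⁆ ∣          ≡⟨ cong (length xs +_) (∣⁅x⁆∣≡1 x) ⟩
  length xs + 1                  ≡⟨ +-comm (length xs) 1 ⟩
  suc (length xs)                ∎
  where
  open ≤-Reasoning
  rest : ∀ {i} → i ∈ p ─ ⁅ x ⁆ → i ∈ˡ xs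
  rest {i} i∈ with p⊆ (p─q⊆p p ⁅ x ⁆ i∈)
  ... | here refl = ⊥-elim (x∉p─q {p = p} i∈ (x∈⁅x⁆ i))
  ... | there i∈xs = i∈xs

length≤∣p∣ : ∀ {n} (p : Subset n) {xs : List (Fin n)} → Unique xs → (∀ {i} → i ∈ˡ xs → i ∈ p) → length xs ≤ ∣ p ∣
length≤∣p∣ p [] _ = z≤n
length≤∣p∣ p {x ∷ xs} (x≢ ∷ uxs) xs⊆ = begin
  suc (length xs)                ≡⟨ +-comm 1 (length xs) ⟩
  length xs + 1                  ≤⟨ +-mono-≤ (length≤∣p∣ (p ─ ⁅ x ⁆) uxs rest) one ⟩
  ∣ p ─ ⁅ x ⁆ ∣ + ∣ p ∩ ⁅ x ⁆ ∣  ≡⟨ ∣p∣≡∣p─q∣+∣p∩q∣ p ⁅ x ⁆ ⟨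
  ∣ p ∣                          ∎
  where
  open ≤-Reasoning
  rest : ∀ {i} → i ∈ˡ xs → i ∈ p ─ ⁅ x ⁆
  rest {i} i∈ = x∈p∧x∉q⇒x∈p─q (xs⊆ (there i∈)) λ i∈x → All.lookup x≢ i∈ (sym (x∈⁅y⁆⇒x≡y x i∈x))
  one : 1 ≤ ∣ p ∩ ⁅ x ⁆ ∣
  one = subst (_≤ ∣ p ∩ ⁅ x ⁆ ∣) (∣⁅x⁆∣≡1 x)
    (p⊆q⇒∣p∣≤∣q∣ λ {i} i∈ → x∈p∩q⁺ (subst (_∈ p) (sym (x∈⁅y⁆⇒x≡y x i∈)) (xs⊆ (here refl)) , i∈))

x∈p⇒1≤∣p∣ : ∀ {n x} {p : Subset n} → x ∈ p → 1 ≤ ∣ p ∣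
x∈p⇒1≤∣p∣ {p = p} x∈p = length≤∣p∣ p ([] ∷ []) λ { (here refl) → x∈p }

1≤∣p∣⇒Nonempty : ∀ {n} (p : Subset n) → 1 ≤ ∣ p ∣ → Nonempty p
1≤∣p∣⇒Nonempty {n} p 1≤ = decidable-stable (nonempty? p) λ e → <⇒≱ 1≤
  (≤-reflexive (trans (cong ∣_∣ (Empty-unique e)) (∣⊥∣≡0 n)))

another : ∀ {n} (p : Subset n) → 2 ≤ ∣ p ∣ → ∀ x → ∃ λ y → y ∈ p × y ≢ x
another p 2≤ x = y , p─q⊆p p ⁅ x ⁆ y∈ , λ y≡x → x∉p─q {p = p} y∈ (subst (_∈ ⁅ x ⁆) (sym y≡x) (x∈⁅x⁆ x))
  where
  open ≤-Reasoning
  ne : Nonempty (p ─ ⁅ x ⁆)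
  ne = 1≤∣p∣⇒Nonempty _ (+-cancelʳ-≤ 1 1 _ (begin
    2                              ≤⟨ 2≤ ⟩
    ∣ p ∣                          ≡⟨ ∣p∣≡∣p─q∣+∣p∩q∣ p ⁅ x ⁆ ⟩
    ∣ p ─ ⁅ x ⁆ ∣ + ∣ p ∩ ⁅ x ⁆ ∣  ≤⟨ +-monoʳ-≤ _ (≤-trans (∣p∩q∣≤∣q∣ p ⁅ x ⁆) (≤-reflexive (∣⁅x⁆∣≡1 x))) ⟩
    ∣ p ─ ⁅ x ⁆ ∣ + 1              ∎))
  y = proj₁ ne
  y∈ = proj₂ ne

⊈⇒∃ : ∀ {n} {p q : Subset n} → ¬ (p ⊆ q) → ∃ λ x → x ∈ p × x ∉ q
⊈⇒∃ {p = p} {q} p⊈q with nonempty? (p ─ q)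
... | yes (x , x∈) = x , p─q⊆p p q x∈ , x∉p─q {p = p} x∈
... | no empty = ⊥-elim (p⊈q λ {x} x∈p → decidable-stable (x ∈? q) λ x∉q → empty (x , x∈p∧x∉q⇒x∈p─q x∈p x∉q))

module _ {A : Set} {P Q : A → Set} (P? : ∀ t → Dec (P t)) (Q? : ∀ t → Dec (Q t)) where

  exclusive⇒count : ∀ ts → (∀ {t} → t ∈ˡ ts → P t → ¬ Q t) → length (filter P? ts) + length (filter Q? ts) ≤ length ts
  exclusive⇒count [] _ = z≤n
  exclusive⇒count (t ∷ ts) ex with P? t | Q? t | exclusive⇒count ts (ex ∘ there)
  ... | yes p | yes q | _ = ⊥-elim (ex (here refl) p q)
  ... | yes p | no _ | ih = s≤s ih
  ... | no _ | yes q | ih rewrite +-suc (length (filter P? ts)) (length (filter Q? ts)) = s≤s ih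
  ... | no _ | no _ | ih = m≤n⇒m≤1+n ih

  -- The equality case of `exclusive⇒count`: an entry with neither property would leave the two
  -- counts one short.
  tight⇒cover : ∀ ts → (∀ {t} → t ∈ˡ ts → P t → ¬ Q t) → length ts ≤ length (filter P? ts) + length (filter Q? ts) →
    ∀ {t} → t ∈ˡ ts → P t ⊎ Q t
  tight⇒cover (t ∷ ts) ex le t∈ with P? t | Q? t | exclusive⇒count ts (ex ∘ there)
  ... | yes p | yes q | _ = ⊥-elim (ex (here refl) p q)
  ... | no _ | no _ | ih = ⊥-elim (<⇒≱ le ih)
  tight⇒cover (t ∷ ts) ex le (here refl) | yes p | no _ | ih = inj₁ p
  tight⇒cover (t ∷ ts) ex (s≤s le) (there t∈) | yes p | no _ | ih = tight⇒cover ts (ex ∘ there) le t∈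
  tight⇒cover (t ∷ ts) ex le (here refl) | no _ | yes q | ih = inj₂ q
  tight⇒cover (t ∷ ts) ex le (there t∈) | no _ | yes q | ih
    rewrite +-suc (length (filter P? ts)) (length (filter Q? ts)) = tight⇒cover ts (ex ∘ there) (s≤s⁻¹ le) t∈

private
  heads : ∀ {n} → Side → List (Subset (suc n)) → List (Subset n)
  heads s [] = []
  heads outside ((outside ∷ e) ∷ F) = e ∷ heads outside F
  heads outside ((inside ∷ e) ∷ F) = heads outside F
  heads inside ((outside ∷ e) ∷ F) = heads inside F
  heads inside ((inside ∷ e) ∷ F) = e ∷ heads inside F

  ∈-heads : ∀ {n} s (F : List (Subset (suc n))) {e} → e ∈ˡ heads s F → (s ∷ e) ∈ˡ F
  ∈-heads outside ((outside ∷ e) ∷ F) (here refl) = here refl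
  ∈-heads outside ((outside ∷ e) ∷ F) (there e∈) = there (∈-heads outside F e∈)
  ∈-heads outside ((inside ∷ e) ∷ F) e∈ = there (∈-heads outside F e∈)
  ∈-heads inside ((outside ∷ e) ∷ F) e∈ = there (∈-heads inside F e∈)
  ∈-heads inside ((inside ∷ e) ∷ F) (here refl) = here refl
  ∈-heads inside ((inside ∷ e) ∷ F) (there e∈) = there (∈-heads inside F e∈)

  heads-unique : ∀ {n} s {F : List (Subset (suc n))} → Unique F → Unique (heads s F)
  heads-unique s [] = []
  heads-unique outside {(outside ∷ e) ∷ F} (e≢ ∷ u) =
    All.tabulate (λ e∈ e≡ → All.lookup e≢ (∈-heads outside F e∈) (cong (outside ∷_) e≡)) ∷ heads-unique outside u
  heads-unique outside {(inside ∷ e) ∷ F} (_ ∷ u) = heads-unique outside u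
  heads-unique inside {(outside ∷ e) ∷ F} (_ ∷ u) = heads-unique inside u
  heads-unique inside {(inside ∷ e) ∷ F} (e≢ ∷ u) =
    All.tabulate (λ e∈ e≡ → All.lookup e≢ (∈-heads inside F e∈) (cong (inside ∷_) e≡)) ∷ heads-unique inside u

  length-heads : ∀ {n} (F : List (Subset (suc n))) → length F ≡ length (heads inside F) + length (heads outside F)
  length-heads [] = refl
  length-heads ((outside ∷ e) ∷ F) = trans (cong suc (length-heads F)) (sym (+-suc _ _))
  length-heads ((inside ∷ e) ∷ F) = cong suc (length-heads F)

  none : ∀ {A : Set} (xs : List A) → (∀ {x} → x ∈ˡ xs → Absurd) → length xs ≡ 0
  none [] _ = refl
  none (x ∷ xs) no∈ = ⊥-elim (no∈ (here refl))

  -- The size of `A` minus `B`, in a form that `between` can follow coordinate by coordinate.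
  free : ∀ {n} → Subset n → Subset n → ℕ
  free [] [] = 0
  free (outside ∷ B) (inside ∷ A) = suc (free B A)
  free (outside ∷ B) (outside ∷ A) = free B A
  free (inside ∷ B) (_ ∷ A) = free B A

  -- Pascal's rule, splitting the family by its first vertex. The lower bound `B` lets one induction
  -- serve both whole families (`B` empty) and stars (`B` a single vertex).
  between : ∀ {n} (B A : Subset n) s (F : List (Subset n)) → Unique F →
    (∀ {e} → e ∈ˡ F → B ⊆ e × e ⊆ A × ∣ e ∣ ≡ ∣ B ∣ + s) → length F ≤ free B A C s
  between [] [] s [] u h = z≤n
  between [] [] s ([] ∷ []) u h with h (here refl)
  ... | _ , _ , refl = ≤-refl
  between [] [] s ([] ∷ [] ∷ F) ((≢ ∷ _) ∷ _) h = ⊥-elim (≢ refl)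
  between (outside ∷ B) (outside ∷ A) s F u h = subst (_≤ free B A C s) (sym (trans (length-heads F) (cong (_+ length (heads outside F)) ins)))
    (between B A s (heads outside F) (heads-unique outside u)
      λ e∈ → let (b , a , c) = h (∈-heads outside F e∈) in drop-∷-⊆ b , drop-∷-⊆ a , c)
    where
    ins : length (heads inside F) ≡ 0
    ins = none _ λ e∈ → case (proj₁ (proj₂ (h (∈-heads inside F e∈))) here)
      where
      case : ∀ {A : Subset _} → Fin.zero ∈ (outside ∷ A) → Absurd
      case ()
  between (inside ∷ B) (a ∷ A) s F u h = subst (_≤ free B A C s) (sym (trans (length-heads F) (trans (cong (length (heads inside F) +_) outs) (+-identityʳ _))))
    (between B A s (heads inside F) (heads-unique inside u)
      λ e∈ → let (b , a , c) = h (∈-heads inside F e∈) in drop-∷-⊆ b , drop-∷-⊆ a , suc-injective c)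
    where
    outs : length (heads outside F) ≡ 0
    outs = none _ λ e∈ → case (proj₁ (h (∈-heads outside F e∈)) here)
      where
      case : ∀ {e : Subset _} → Fin.zero ∈ (outside ∷ e) → Absurd
      case ()
  between (outside ∷ B) (inside ∷ A) s F u h = subst (_≤ suc (free B A) C s) (sym (length-heads F)) (sum s h)
    where
    outs : ∀ s → (∀ {e} → e ∈ˡ F → (outside ∷ B) ⊆ e × e ⊆ (inside ∷ A) × ∣ e ∣ ≡ ∣ B ∣ + s) →
      length (heads outside F) ≤ free B A C s
    outs s h = between B A s (heads outside F) (heads-unique outside u)
      λ e∈ → let (b , a , c) = h (∈-heads outside F e∈) in drop-∷-⊆ b , drop-∷-⊆ a , c
    sum : ∀ s → (∀ {e} → e ∈ˡ F → (outside ∷ B) ⊆ e × e ⊆ (inside ∷ A) × ∣ e ∣ ≡ ∣ B ∣ + s) →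
      length (heads inside F) + length (heads outside F) ≤ suc (free B A) C s
    sum zero h = +-mono-≤ (≤-reflexive (none (heads inside F) λ e∈ →
      let (b , _ , c) = h (∈-heads inside F e∈) in
      <⇒≱ (s≤s (p⊆q⇒∣p∣≤∣q∣ (drop-∷-⊆ b))) (≤-reflexive (trans c (+-identityʳ _))))) (outs zero h)
    sum (suc s) h = ≤-trans (+-mono-≤ (between B A s (heads inside F) (heads-unique inside u)
        λ e∈ → let (b , a , c) = h (∈-heads inside F e∈) in drop-∷-⊆ b , drop-∷-⊆ a , suc-injective (trans c (+-suc _ _)))
      (outs (suc s) h)) (≤-reflexive (nCk+nC[k+1]≡[n+1]C[k+1] (free B A) s))

  free-⊥ : ∀ {n} (A : Subset n) → free ⊥ A ≡ ∣ A ∣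
  free-⊥ [] = refl
  free-⊥ (outside ∷ A) = free-⊥ A
  free-⊥ (inside ∷ A) = cong suc (free-⊥ A)

  free-⁅⁆ : ∀ {n v} {A : Subset n} → v ∈ A → suc (free ⁅ v ⁆ A) ≡ ∣ A ∣
  free-⁅⁆ {A = _ ∷ A} here = cong suc (free-⊥ A)
  free-⁅⁆ {A = outside ∷ _} (there v∈A) = free-⁅⁆ v∈A
  free-⁅⁆ {A = inside ∷ _} (there v∈A) = cong suc (free-⁅⁆ v∈A)

family≤C : ∀ {n} (A : Subset n) s (F : List (Subset n)) → Unique F →
  (∀ {e} → e ∈ˡ F → e ⊆ A × ∣ e ∣ ≡ s) → length F ≤ ∣ A ∣ C s
family≤C {n} A s F u h = subst (λ d → length F ≤ d C s) (free-⊥ A) (between ⊥ A s F u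
  λ e∈ → let (e⊆A , c) = h e∈ in ⊥⊆ , e⊆A , trans c (cong (_+ s) (sym (∣⊥∣≡0 n))))

star≤C : ∀ {n} v (A : Subset n) {d} s (F : List (Subset n)) → v ∈ A → ∣ A ∣ ≤ suc d → Unique F →
  (∀ {e} → e ∈ˡ F → v ∈ e × e ⊆ A × ∣ e ∣ ≡ suc s) → length F ≤ d C s
star≤C v A s F v∈A ∣A∣≤ u h = ≤-trans
  (between ⁅ v ⁆ A s F u
    λ e∈ → let (v∈e , e⊆A , c) = h e∈ in
      (λ x∈ → subst (_∈ _) (sym (x∈⁅y⁆⇒x≡y v x∈)) v∈e) , e⊆A , trans c (cong (_+ s) (sym (∣⁅x⁆∣≡1 v))))
  (C-mono s (s≤s⁻¹ (≤-trans (≤-reflexive (free-⁅⁆ v∈A)) ∣A∣≤)))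

-- Lists without repetition

module _ {A : Set} where

  unique-∷ : ∀ {x : A} {xs} → x ∉ˡ xs → Unique xs → Unique (x ∷ xs)
  unique-∷ x∉ u = All.tabulate (λ y∈ x≡y → x∉ (subst (_∈ˡ _) (sym x≡y) y∈)) ∷ u

  unique-tail : ∀ {x : A} {xs} → Unique (x ∷ xs) → Unique xs
  unique-tail (_ ∷ u) = u

  unique-↭ : ∀ {xs ys : List A} → xs ↭ ys → Unique xs → Unique ys
  unique-↭ p = PermutationSetoid.Unique-resp-↭ (setoid A) (↭⇒↭ₛ p)

  ∉-↭ : ∀ {x : A} {xs ys} → xs ↭ ys → x ∉ˡ xs → x ∉ˡ ys
  ∉-↭ p x∉ x∈ = x∉ (∈-resp-↭ (↭-sym p) x∈)

  reverse-mid-↭ : ∀ (ys : List A) z zs → reverse ys ++ z ∷ zs ↭ z ∷ ys ++ zs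
  reverse-mid-↭ ys z zs = ↭-trans (++⁺ʳ (z ∷ zs) (↭-reverse ys)) (shift z ys zs)

  filter-∷-≤ : ∀ {P : A → Set} (P? : ∀ x → Dec (P x)) x xs → length (filter P? (x ∷ xs)) ≤ suc (length (filter P? xs))
  filter-∷-≤ P? x xs with P? x
  ... | yes _ = ≤-refl
  ... | no _ = n≤1+n _

  swap-ends : ∀ (x y z : A) {xs} → x ∷ y ∷ z ∷ xs ↭ z ∷ y ∷ x ∷ xs
  swap-ends x y z = Perm.trans (Perm.swap x y Perm.refl) (Perm.trans (Perm.prep y (Perm.swap x z Perm.refl)) (Perm.swap y z Perm.refl))

  reverse-∷ʳ-↭ : ∀ (xs : List A) x → reverse xs ++ x ∷ [] ↭ x ∷ xs
  reverse-∷ʳ-↭ xs x = ↭-trans (reverse-mid-↭ xs x []) (↭-prep x (↭-reflexive (++-identityʳ xs)))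

module _ {A : Set} {ys : List A} {z : A} {zs : List A} where

  unique-drop : Unique (ys ++ z ∷ zs) → z ∉ˡ ys ++ zs × Unique (ys ++ zs)
  unique-drop u = let u' = unique-↭ (shift z ys zs) u in Unique[x∷xs]⇒x∉xs u' , unique-tail u'

  ∈-drop : ∀ {x} → x ∈ˡ ys ++ zs → x ∈ˡ ys ++ z ∷ zs
  ∈-drop x∈ = ∈-resp-↭ (↭-sym (shift z ys zs)) (there x∈)

module _ {A : Set} {Q : A → Set} where

  ascend : ∀ {t} ts → (∀ pre {t t' post} → ts ≡ pre ++ t ∷ t' ∷ post → Q t → Q t') → t ∈ˡ ts → Q t →
    ∃₂ λ pre t' → ts ≡ pre ∷ʳ t' × Q t'
  ascend (t ∷ []) _ (here refl) q = [] , t , refl , q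
  ascend (t ∷ t' ∷ ts) step (here refl) q =
    let (pre , s , eq , r) = ascend (t' ∷ ts) (λ pre eq → step (t ∷ pre) (cong (t ∷_) eq)) (here refl) (step [] refl q)
    in t ∷ pre , s , cong (t ∷_) eq , r
  ascend (t ∷ t' ∷ ts) step (there t∈) q =
    let (pre , s , eq , r) = ascend (t' ∷ ts) (λ pre eq → step (t ∷ pre) (cong (t ∷_) eq)) t∈ q
    in t ∷ pre , s , cong (t ∷_) eq , r

  descend : ∀ {t} s ts → (∀ pre {t t' post} → s ∷ ts ≡ pre ++ t ∷ t' ∷ post → Q t' → Q t) → t ∈ˡ s ∷ ts → Q t → Q s
  descend s ts step (here refl) q = q
  descend s (s' ∷ ts) step (there t∈) q =
    step [] refl (descend s' ts (λ pre eq → step (s ∷ pre) (cong (s ∷_) eq)) t∈ q)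

-- The incidence graph, in which Berge paths and Berge cycles are ordinary paths and cycles

data Node (n m : ℕ) : Set where
  vt : Fin n → Node n m
  ed : Fin m → Node n m

module _ {n m : ℕ} where

  infix 4 _≟N_
  _≟N_ : (x y : Node n m) → Dec (x ≡ y)
  vt u ≟N vt v = map′ (cong vt) (λ { refl → refl }) (u ≟F v)
  vt u ≟N ed f = no λ ()
  ed e ≟N vt v = no λ ()
  ed e ≟N ed f = map′ (cong ed) (λ { refl → refl }) (e ≟F f)

  vs : List (Node n m) → List (Fin n)
  vs [] = []
  vs (vt v ∷ xs) = v ∷ vs xs
  vs (ed e ∷ xs) = vs xs

  es : List (Node n m) → List (Fin m)
  es [] = []
  es (vt v ∷ xs) = es xs
  es (ed e ∷ xs) = e ∷ es xs

  ∈vs⁺ : ∀ {v xs} → vt v ∈ˡ xs → v ∈ˡ vs xs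
  ∈vs⁺ (here refl) = here refl
  ∈vs⁺ {xs = vt _ ∷ _} (there v∈) = there (∈vs⁺ v∈)
  ∈vs⁺ {xs = ed _ ∷ _} (there v∈) = ∈vs⁺ v∈

  ∈vs⁻ : ∀ {v xs} → v ∈ˡ vs xs → vt v ∈ˡ xs
  ∈vs⁻ {xs = vt _ ∷ _} (here refl) = here refl
  ∈vs⁻ {xs = vt _ ∷ _} (there v∈) = there (∈vs⁻ v∈)
  ∈vs⁻ {xs = ed _ ∷ _} v∈ = there (∈vs⁻ v∈)

  ∈es⁺ : ∀ {e xs} → ed e ∈ˡ xs → e ∈ˡ es xs
  ∈es⁺ (here refl) = here refl
  ∈es⁺ {xs = ed _ ∷ _} (there e∈) = there (∈es⁺ e∈)
  ∈es⁺ {xs = vt _ ∷ _} (there e∈) = ∈es⁺ e∈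

  ∈es⁻ : ∀ {e xs} → e ∈ˡ es xs → ed e ∈ˡ xs
  ∈es⁻ {xs = ed _ ∷ _} (here refl) = here refl
  ∈es⁻ {xs = ed _ ∷ _} (there e∈) = there (∈es⁻ e∈)
  ∈es⁻ {xs = vt _ ∷ _} e∈ = there (∈es⁻ e∈)

  vs-unique : ∀ {xs} → Unique xs → Unique (vs xs)
  vs-unique {[]} [] = []
  vs-unique {vt v ∷ xs} u = unique-∷ (Unique[x∷xs]⇒x∉xs u ∘ ∈vs⁻) (vs-unique (unique-tail u))
  vs-unique {ed e ∷ xs} u = vs-unique (unique-tail u)

  es-unique : ∀ {xs} → Unique xs → Unique (es xs)
  es-unique {[]} [] = []
  es-unique {vt v ∷ xs} u = es-unique (unique-tail u)
  es-unique {ed e ∷ xs} u = unique-∷ (Unique[x∷xs]⇒x∉xs u ∘ ∈es⁻) (es-unique (unique-tail u))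

  #es-↭ : ∀ {xs ys} → xs ↭ ys → length (es xs) ≡ length (es ys)
  #es-↭ Perm.refl = refl
  #es-↭ (Perm.prep (vt _) p) = #es-↭ p
  #es-↭ (Perm.prep (ed _) p) = cong suc (#es-↭ p)
  #es-↭ (Perm.swap (vt _) (vt _) p) = #es-↭ p
  #es-↭ (Perm.swap (vt _) (ed _) p) = cong suc (#es-↭ p)
  #es-↭ (Perm.swap (ed _) (vt _) p) = cong suc (#es-↭ p)
  #es-↭ (Perm.swap (ed _) (ed _) p) = cong (suc ∘ suc) (#es-↭ p)
  #es-↭ (Perm.trans p q) = trans (#es-↭ p) (#es-↭ q)

  -- The steps v e w of an alternating list.
  trip : List (Node n m) → List (Fin n × Fin m × Fin n)
  trip (vt a ∷ ed e ∷ vt x ∷ xs) = (a , e , x) ∷ trip (vt x ∷ xs)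
  trip (ed e ∷ xs) = trip xs
  trip _ = []

module Incidence {n m : ℕ} (N : Fin m → Subset n) where

  Adj : Node n m → Node n m → Set
  Adj (vt v) (ed e) = v ∈ N e
  Adj (ed e) (vt v) = v ∈ N e
  Adj (vt _) (vt _) = Absurd
  Adj (ed _) (ed _) = Absurd

  adj-sym : ∀ x y → Adj x y → Adj y x
  adj-sym (vt _) (ed _) v∈e = v∈e
  adj-sym (ed _) (vt _) v∈e = v∈e

  infixr 5 _∷_
  data Trail : Node n m → List (Node n m) → Node n m → Set where
    [-] : ∀ {x} → Trail x (x ∷ []) x
    _∷_ : ∀ {x y ys z} → Adj x y → Trail y ys z → Trail x (x ∷ ys) z

  join : ∀ {x xs y z zs w} → Trail x xs y → Adj y z → Trail z zs w → Trail x (xs ++ zs) w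
  join [-] a t = a ∷ t
  join (b ∷ s) a t = b ∷ join s a t

  rev : ∀ {x xs y} → Trail x xs y → Trail y (reverse xs) x
  rev [-] = [-]
  rev {x} {_ ∷ ys} {z} (_∷_ {y = y} a t) =
    subst (λ l → Trail z l x) (sym (unfold-reverse x ys)) (join (rev t) (adj-sym x y a) [-])

  start∈ : ∀ {x xs y} → Trail x xs y → x ∈ˡ xs
  start∈ [-] = here refl
  start∈ (_ ∷ _) = here refl

  end∈ : ∀ {x xs y} → Trail x xs y → y ∈ˡ xs
  end∈ [-] = here refl
  end∈ (_ ∷ t) = there (end∈ t)

  cut : ∀ {x w} ys {z zs} → Trail x (ys ++ z ∷ zs) w →
    (x ≡ z × ys ≡ []) ⊎ (∃ λ y → Trail x ys y × Adj y z)
  cut [] [-] = inj₁ (refl , refl)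
  cut [] (_ ∷ _) = inj₁ (refl , refl)
  cut (y ∷ []) (a ∷ t) with cut [] t
  ... | inj₁ (refl , refl) = inj₂ (y , [-] , a)
  cut (y ∷ ys@(_ ∷ _)) (a ∷ t) with cut ys t
  ... | inj₁ (_ , ())
  ... | inj₂ (y' , s , b) = inj₂ (y' , a ∷ s , b)

  from : ∀ {x w} ys {z zs} → Trail x (ys ++ z ∷ zs) w → Trail z (z ∷ zs) w
  from [] [-] = [-]
  from [] (a ∷ t) = a ∷ t
  from (y ∷ []) (a ∷ t) = from [] t
  from (y ∷ ys@(_ ∷ _)) (a ∷ t) = from ys t

  unsnoc : ∀ {x y ys z} → Adj x y → Trail y ys z → ∃₂ λ zs w → x ∷ ys ≡ zs ∷ʳ z × Trail x zs w × Adj w z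
  unsnoc {x} a [-] = x ∷ [] , x , refl , [-] , a
  unsnoc {x} a (b ∷ t) =
    let (zs , w , eq , s , c) = unsnoc b t in x ∷ zs , w , cong (x ∷_) eq , a ∷ s , c

  trip-split : ∀ {p xs q a e x} → Trail p xs q → (a , e , x) ∈ˡ trip xs →
    ∃₂ λ ys zs → xs ≡ ys ++ ed e ∷ zs × Trail p ys (vt a) × a ∈ N e × x ∈ N e × Trail (vt x) zs q
  trip-split {vt v} (_∷_ {y = ed f} v∈ (_∷_ {y = vt w} w∈ t)) t∈ = go t t∈
    where
    go : ∀ {ys q a e x} → Trail (vt w) ys q → (a , e , x) ∈ˡ trip (vt v ∷ ed f ∷ ys) →
      ∃₂ λ ys' zs → vt v ∷ ed f ∷ ys ≡ ys' ++ ed e ∷ zs × Trail (vt v) ys' (vt a) × a ∈ N e × x ∈ N e × Trail (vt x) zs q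
    go [-] (here refl) = vt v ∷ [] , _ , refl , [-] , v∈ , w∈ , [-]
    go (b ∷ t) (here refl) = vt v ∷ [] , _ , refl , [-] , v∈ , w∈ , b ∷ t
    go (b ∷ t) (there t∈) with trip-split (b ∷ t) t∈
    ... | ys' , zs , eq , s , a∈ , x∈ , s' =
      vt v ∷ ed f ∷ ys' , zs , cong (λ l → vt v ∷ ed f ∷ l) eq , v∈ ∷ w∈ ∷ s , a∈ , x∈ , s'
  trip-split {vt _} (_∷_ {y = ed e} a∈ [-]) ()
  trip-split {ed f} (_∷_ {y = vt v} v∈ t) t∈ with trip-split t t∈
  ... | ys' , zs , eq , s , a∈ , x∈ , s' = ed f ∷ ys' , zs , cong (ed f ∷_) eq , v∈ ∷ s , a∈ , x∈ , s'

  trip-split₂ : ∀ {u xs v a e x a' e' x'} pre {post} → Trail (vt u) xs (vt v) →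
    trip xs ≡ pre ++ (a , e , x) ∷ (a' , e' , x') ∷ post →
    a' ≡ x × ∃₂ λ ys zs → xs ≡ ys ++ ed e ∷ vt x ∷ ed e' ∷ zs ×
      Trail (vt u) ys (vt a) × a ∈ N e × x ∈ N e × x ∈ N e' × x' ∈ N e' × Trail (vt x') zs (vt v)
  trip-split₂ [] (_∷_ {x = vt u} {y = ed e} u∈ (_∷_ {y = vt w} w∈ (_∷_ {y = ed e'} w∈' (_∷_ {y = vt w'} w'∈ [-])))) refl =
    refl , vt u ∷ [] , _ , refl , [-] , u∈ , w∈ , w∈' , w'∈ , [-]
  trip-split₂ [] (_∷_ {x = vt u} {y = ed e} u∈ (_∷_ {y = vt w} w∈ (_∷_ {y = ed e'} w∈' (_∷_ {y = vt w'} w'∈ (b ∷ t))))) refl =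
    refl , vt u ∷ [] , _ , refl , [-] , u∈ , w∈ , w∈' , w'∈ , b ∷ t
  trip-split₂ [] (_∷_ {y = ed e} u∈ (_∷_ {y = vt w} w∈ [-])) ()
  trip-split₂ (_ ∷ []) (_∷_ {y = ed e} u∈ (_∷_ {y = vt w} w∈ [-])) ()
  trip-split₂ (_ ∷ _ ∷ _) (_∷_ {y = ed e} u∈ (_∷_ {y = vt w} w∈ [-])) ()
  trip-split₂ (_ ∷ pre) (_∷_ {x = vt u} {y = ed e} u∈ (_∷_ {y = vt w} w∈ (b ∷ t))) eq
    with trip-split₂ pre (b ∷ t) (∷-injectiveʳ eq)
  ... | a'≡ , ys , zs , eq' , s , r = a'≡ , vt u ∷ ed e ∷ ys , zs , cong (λ l → vt u ∷ ed e ∷ l) eq' , u∈ ∷ w∈ ∷ s , r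
  trip-split₂ [] [-] ()
  trip-split₂ (_ ∷ _) [-] ()

  #trip : ∀ {u xs v} → Trail (vt u) xs (vt v) → length (trip xs) ≡ length (es xs)
  #trip [-] = refl
  #trip (_∷_ {y = ed e} u∈ (_∷_ {y = vt w} w∈ [-])) = refl
  #trip (_∷_ {y = ed e} u∈ (_∷_ {y = vt w} w∈ (b ∷ t))) = cong suc (#trip (b ∷ t))

  edge∈trip : ∀ {u xs v e} → Trail (vt u) xs (vt v) → ed e ∈ˡ xs → ∃₂ λ a x → (a , e , x) ∈ˡ trip xs
  edge∈trip [-] (here ())
  edge∈trip (_∷_ {y = ed e} u∈ (_∷_ {y = vt w} w∈ [-])) (there (here refl)) = _ , _ , here refl
  edge∈trip (_∷_ {y = ed e} u∈ (_∷_ {y = vt w} w∈ (b ∷ t))) (there (here refl)) = _ , _ , here refl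
  edge∈trip (_∷_ {y = ed e} u∈ (_∷_ {y = vt w} w∈ (b ∷ t))) (there (there e∈)) =
    let (a , x , t∈) = edge∈trip (b ∷ t) e∈ in a , x , there t∈
  edge∈trip (_∷_ {y = ed e} u∈ (_∷_ {y = vt w} w∈ [-])) (there (there (here ())))

  third∈trip : ∀ {u xs v y} → Trail (vt u) xs (vt v) → vt y ∈ˡ xs → y ≢ u → ∃₂ λ a e → (a , e , y) ∈ˡ trip xs
  third∈trip [-] (here refl) y≢u = ⊥-elim (y≢u refl)
  third∈trip (_ ∷ _) (here refl) y≢u = ⊥-elim (y≢u refl)
  third∈trip (_∷_ {y = ed e} u∈ (_∷_ {y = vt w} w∈ [-])) (there (there (here refl))) _ = _ , _ , here refl
  third∈trip {y = y} (_∷_ {y = ed e} u∈ (_∷_ {y = vt w} w∈ (b ∷ t))) (there (there y∈)) _ with y ≟F w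
  ... | yes refl = _ , _ , here refl
  ... | no y≢w = let (a , e , t∈) = third∈trip (b ∷ t) y∈ y≢w in a , e , there t∈

  first∈trip : ∀ {u xs v y} → Trail (vt u) xs (vt v) → vt y ∈ˡ xs → y ≢ v → ∃₂ λ e x → (y , e , x) ∈ˡ trip xs
  first∈trip [-] (here refl) y≢v = ⊥-elim (y≢v refl)
  first∈trip (_∷_ {y = ed e} u∈ (_∷_ {y = vt w} w∈ [-])) (here refl) _ = _ , _ , here refl
  first∈trip (_∷_ {y = ed e} u∈ (_∷_ {y = vt w} w∈ (b ∷ t))) (here refl) _ = _ , _ , here refl
  first∈trip (_∷_ {y = ed e} u∈ (_∷_ {y = vt w} w∈ [-])) (there (there (here refl))) y≢v = ⊥-elim (y≢v refl)
  first∈trip (_∷_ {y = ed e} u∈ (_∷_ {y = vt w} w∈ (b ∷ t))) (there (there y∈)) y≢v =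
    let (e , x , t∈) = first∈trip (b ∷ t) y∈ y≢v in e , x , there t∈

  #vs : ∀ {u xs v} → Trail (vt u) xs (vt v) → length (vs xs) ≡ suc (length (es xs))
  #vs [-] = refl
  #vs (_∷_ {y = ed e} u∈ (_∷_ {y = vt w} w∈ t)) = cong suc (#vs t)

  last-trip : ∀ {u xs v a e x} pre → Trail (vt u) xs (vt v) → trip xs ≡ pre ∷ʳ (a , e , x) → x ≡ v
  last-trip [] (_∷_ {y = ed e} u∈ (_∷_ {y = vt w} w∈ [-])) refl = refl
  last-trip (_ ∷ []) (_∷_ {y = ed e} u∈ (_∷_ {y = vt w} w∈ [-])) ()
  last-trip (_ ∷ _ ∷ _) (_∷_ {y = ed e} u∈ (_∷_ {y = vt w} w∈ [-])) ()
  last-trip [] (_∷_ {y = ed e} u∈ (_∷_ {y = vt w} w∈ (_∷_ {y = ed f} _ (_∷_ {y = vt _} _ [-])))) ()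
  last-trip [] (_∷_ {y = ed e} u∈ (_∷_ {y = vt w} w∈ (_∷_ {y = ed f} _ (_∷_ {y = vt _} _ (_ ∷ _))))) ()
  last-trip (_ ∷ pre) (_∷_ {y = ed e} u∈ (_∷_ {y = vt w} w∈ (b ∷ t))) eq = last-trip pre (b ∷ t) (∷-injectiveʳ eq)
  last-trip [] [-] ()
  last-trip (_ ∷ _) [-] ()

  trip-∷ : ∀ u h {x xs q} → Trail (vt x) xs q → trip (vt u ∷ ed h ∷ xs) ≡ (u , h , x) ∷ trip xs
  trip-∷ u h [-] = refl
  trip-∷ u h (_ ∷ _) = refl

-- f (suc ρ) x = num ρ x / den ρ x; throughout, ρ is r - 1.
num den : ℕ → ℕ → ℕ
num ρ x with x ≟ 1
... | yes _ = 1
... | no _ with x ≤? ρ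
...   | yes _ = x
...   | no _ = x C ρ
den ρ x with x ≟ 1
... | yes _ = suc ρ
... | no _ with x ≤? ρ
...   | yes _ = suc (suc ρ)
...   | no _ = suc ρ

num-den-mid : ∀ {ρ x} → 2 ≤ x → x ≤ ρ → num ρ x ≡ x × den ρ x ≡ suc (suc ρ)
num-den-mid {ρ} {x} 2≤x x≤ρ with x ≟ 1
... | yes refl = ⊥-elim (<⇒≱ 2≤x ≤-refl)
... | no _ with x ≤? ρ
...   | yes _ = refl , refl
...   | no x≰ρ = ⊥-elim (x≰ρ x≤ρ)

num-den-big : ∀ {ρ x} → 2 ≤ ρ → ρ < x → num ρ x ≡ x C ρ × den ρ x ≡ suc ρ
num-den-big {ρ} {x} 2≤ρ ρ<x with x ≟ 1
... | yes refl = ⊥-elim (<⇒≱ 2≤ρ (<⇒≤ ρ<x))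
... | no _ with x ≤? ρ
...   | yes x≤ρ = ⊥-elim (<⇒≱ ρ<x x≤ρ)
...   | no _ = refl , refl

-- Longest paths, the neighbours of their ends, and cycles obtained by exchange

module Structure {n m : ℕ} (N : Fin m → Subset n) (ρ : ℕ) (2≤ρ : 2 ≤ ρ)
  (unif : ∀ {e v} → v ∈ N e → ∣ N e ∣ ≡ suc ρ)
  (dist : ∀ {e e' v} → v ∈ N e → N e ≡ N e' → e ≡ e') where

  open Incidence N public
  open DecMembership (_≟N_ {n} {m}) using () renaming (_∈?_ to _∈ˡ?_) public

  Meets : Subset n → Fin m → Set
  Meets S e = ∃ λ v → v ∈ S × v ∈ N e

  meets? : ∀ S e → Dec (Meets S e)
  meets? S e = any? λ v → (v ∈? S) ×-dec (v ∈? N e)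

  E : Subset n → Subset m
  E S = ⟪ meets? S ⟫

  edge⊆⇒≤ : ∀ {e v} {A : Subset n} → v ∈ N e → N e ⊆ A → suc ρ ≤ ∣ A ∣
  edge⊆⇒≤ v∈e e⊆A = subst (_≤ _) (unif v∈e) (p⊆q⇒∣p∣≤∣q∣ e⊆A)

  other-vertex : ∀ {e v} → v ∈ N e → ∀ u → ∃ λ w → w ∈ N e × w ≢ u
  other-vertex {e} v∈e = another (N e) (subst (2 ≤_) (sym (unif v∈e)) (m≤n⇒m≤1+n 2≤ρ))

  edge-sets-unique : ∀ {F} → Unique F → (∀ {e} → e ∈ˡ F → ∃ λ v → v ∈ N e) → Unique (map N F)
  edge-sets-unique {[]} _ _ = []
  edge-sets-unique {e ∷ F} uF h = unique-∷
    (λ e∈ → let (e' , e'∈ , eq) = ∈-map⁻ N e∈ in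
      Unique[x∷xs]⇒x∉xs uF (subst (_∈ˡ F) (sym (dist (proj₂ (h (here refl))) eq)) e'∈))
    (edge-sets-unique (unique-tail uF) (h ∘ there))

  -- For a path xs from u, the edges inside and outside xs are its defining and nondefining edges.
  Outside : List (Node n m) → Fin n → Fin m → Set
  Outside xs u e = ed e ∉ˡ xs × u ∈ N e

  outside? : ∀ xs u e → Dec (Outside xs u e)
  outside? xs u e = ¬? (ed e ∈ˡ? xs) ×-dec (u ∈? N e)

  Inside : List (Node n m) → Fin n → Fin m → Set
  Inside xs u e = ed e ∈ˡ xs × u ∈ N e

  inside? : ∀ xs u e → Dec (Inside xs u e)
  inside? xs u e = (ed e ∈ˡ? xs) ×-dec (u ∈? N e)

  -- The substitute for the neighbourhood in Dirac's theorem. Only nondefining edges count, since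
  -- these can be added to the path without repeating an edge.
  Nb : List (Node n m) → Fin n → Fin n → Set
  Nb xs u x = x ≢ u × ∃ λ e → Outside xs u e × x ∈ N e

  nb? : ∀ xs u x → Dec (Nb xs u x)
  nb? xs u x = ¬? (x ≟F u) ×-dec any? λ e → outside? xs u e ×-dec (x ∈? N e)

  #nb #in : List (Node n m) → Fin n → ℕ
  #nb xs u = ∣ ⟪ nb? xs u ⟫ ∣
  #in xs u = ∣ ⟪ inside? xs u ⟫ ∣

  #nb-resp : ∀ {xs ys} u → (∀ {e} → ed e ∈ˡ ys → ed e ∈ˡ xs) → #nb xs u ≤ #nb ys u
  #nb-resp {xs} {ys} u ys⊆xs = p⊆q⇒∣p∣≤∣q∣ λ x∈ →
    let (x≢u , e , (e∉ , u∈e) , x∈e) = ∈⟪⟫⁻ (nb? xs u) x∈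
    in ∈⟪⟫⁺ (nb? ys u) (x≢u , e , (e∉ ∘ ys⊆xs , u∈e) , x∈e)

  outside⇒ρ≤#nb : ∀ {xs u e} → Outside xs u e → ρ ≤ #nb xs u
  outside⇒ρ≤#nb {xs} {u} {e} (e∉ , u∈e) = +-cancelʳ-≤ 1 ρ _ (begin
    ρ + 1                                  ≡⟨ +-comm ρ 1 ⟩
    suc ρ                                  ≡⟨ unif u∈e ⟨
    ∣ N e ∣                                ≡⟨ ∣p∣≡∣p─q∣+∣p∩q∣ (N e) ⁅ u ⁆ ⟩
    ∣ N e ─ ⁅ u ⁆ ∣ + ∣ N e ∩ ⁅ u ⁆ ∣      ≤⟨ +-mono-≤ (p⊆q⇒∣p∣≤∣q∣ nb) (≤-trans (∣p∩q∣≤∣q∣ (N e) ⁅ u ⁆) (≤-reflexive (∣⁅x⁆∣≡1 u))) ⟩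
    #nb xs u + 1                           ∎)
    where
    open ≤-Reasoning
    nb : N e ─ ⁅ u ⁆ ⊆ ⟪ nb? xs u ⟫
    nb {x} x∈ = ∈⟪⟫⁺ (nb? xs u) ((λ x≡u → x∉p─q {p = N e} x∈ (subst (_∈ ⁅ u ⁆) (sym x≡u) (x∈⁅x⁆ u))) , e , (e∉ , u∈e) , p─q⊆p (N e) ⁅ u ⁆ x∈)

  -- The list `F` may also hold defining edges that lie within `u` and its outside neighbours; for r
  -- = 3 the missing unit is gained by adding one such edge.
  star-bound : ∀ xs u (F : List (Fin m)) → Unique F →
    (∀ {e} → e ∈ˡ F → u ∈ N e × (∀ {x} → x ∈ N e → x ≢ u → Nb xs u x)) → length F ≤ #nb xs u C ρ
  star-bound xs u F uF h = subst (_≤ #nb xs u C ρ) (length-map N F)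
    (star≤C u A ρ (map N F) (x∈p∪q⁺ (inj₁ (x∈⁅x⁆ u))) ∣A∣≤ (edge-sets-unique uF λ e∈ → u , proj₁ (h e∈)) λ e∈ → prop (∈-map⁻ N e∈))
    where
    A = ⁅ u ⁆ ∪ ⟪ nb? xs u ⟫
    ∣A∣≤ : ∣ A ∣ ≤ suc (#nb xs u)
    ∣A∣≤ = begin
      ∣ A ∣                         ≡⟨ ∣p∣≡∣p─q∣+∣p∩q∣ A ⁅ u ⁆ ⟩
      ∣ A ─ ⁅ u ⁆ ∣ + ∣ A ∩ ⁅ u ⁆ ∣ ≤⟨ +-mono-≤ (p⊆q⇒∣p∣≤∣q∣ λ x∈ → [ ⊥-elim ∘ x∉p─q {p = A} x∈ , id ]′ (x∈p∪q⁻ ⁅ u ⁆ ⟪ nb? xs u ⟫ (p─q⊆p A ⁅ u ⁆ x∈)))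
                                          (≤-trans (∣p∩q∣≤∣q∣ A ⁅ u ⁆) (≤-reflexive (∣⁅x⁆∣≡1 u))) ⟩
      #nb xs u + 1                  ≡⟨ +-comm _ 1 ⟩
      suc (#nb xs u)                ∎
      where open ≤-Reasoning
    prop : ∀ {p} → (∃ λ e → e ∈ˡ F × p ≡ N e) → u ∈ p × p ⊆ A × ∣ p ∣ ≡ suc ρ
    prop (e , e∈ , refl) = proj₁ (h e∈) , sub , unif (proj₁ (h e∈))
      where
      sub : N e ⊆ A
      sub {x} x∈ with x ≟F u
      ... | yes refl = x∈p∪q⁺ (inj₁ (x∈⁅x⁆ u))
      ... | no x≢u = x∈p∪q⁺ (inj₂ (∈⟪⟫⁺ (nb? xs u) (proj₂ (h e∈) x∈ x≢u)))

  outsides : List (Node n m) → Fin n → List (Fin m)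
  outsides xs u = filter (outside? xs u) (allFin m)

  outsides-star : ∀ xs u {e} → e ∈ˡ outsides xs u → u ∈ N e × (∀ {x} → x ∈ N e → x ≢ u → Nb xs u x)
  outsides-star xs u e∈ = let (_ , e∉ , u∈e) = ∈-filter⁻ (outside? xs u) {xs = allFin m} e∈ in u∈e , λ x∈e x≢u → x≢u , _ , (e∉ , u∈e) , x∈e

  outsides-unique : ∀ xs u → Unique (outsides xs u)
  outsides-unique xs u = filter⁺ (outside? xs u) {allFin m} (allFin⁺ m)

  #outsides : ∀ xs u → length (outsides xs u) ≤ #nb xs u C ρ
  #outsides xs u = star-bound xs u _ (outsides-unique xs u) (outsides-star xs u)

  degree : ∀ xs u → ∣ E ⁅ u ⁆ ∣ ≤ length (outsides xs u) + #in xs u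
  degree xs u = begin
    ∣ E ⁅ u ⁆ ∣                                    ≡⟨ ∣p∣≡∣p─q∣+∣p∩q∣ (E ⁅ u ⁆) ⟪ inside? xs u ⟫ ⟩
    ∣ E ⁅ u ⁆ ─ ⟪ inside? xs u ⟫ ∣ + ∣ E ⁅ u ⁆ ∩ ⟪ inside? xs u ⟫ ∣
      ≤⟨ +-mono-≤ (∣p∣≤length _ _ out) (∣p∩q∣≤∣q∣ (E ⁅ u ⁆) _) ⟩
    length (outsides xs u) + #in xs u              ∎
    where
    open ≤-Reasoning
    out : ∀ {e} → e ∈ E ⁅ u ⁆ ─ ⟪ inside? xs u ⟫ → e ∈ˡ outsides xs u
    out {e} e∈ with ∈⟪⟫⁻ (meets? ⁅ u ⁆) (p─q⊆p (E ⁅ u ⁆) _ e∈)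
    ... | v , v∈ , v∈e with x∈⁅y⁆⇒x≡y u v∈
    ...   | refl = ∈-filter⁺ (outside? xs u) (∈-allFin e) ((λ e∈xs → x∉p─q {p = E ⁅ u ⁆} e∈ (∈⟪⟫⁺ (inside? xs u) (e∈xs , v∈e))) , v∈e)

  -- A cycle cut open at an arbitrary node: the list may begin with a vertex or with an edge,
  -- whichever suits the construction.
  record Cyc (k : ℕ) : Set where
    constructor cyc
    field
      {first last} : Node n m
      {list} : List (Node n m)
      ctrail : Trail first list last
      close  : Adj last first
      cuniq  : Unique list
      csize  : length (es list) ≡ k
  open Cyc public

  -- The equality cases in terms of the number of edges. One edge on r + 1 vertices is absent
  -- because it leaves a vertex isolated; r + 1 edges on r + 1 vertices count as complete.
  Concl : ℕ → Set
  Concl k = (n ≡ suc (suc ρ) × 2 ≤ k × k ≤ ρ) ⊎ k ≡ n C suc ρ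

  module Longest (L : ℕ)
    (longest : ∀ {u xs v} → Trail (vt u) xs (vt v) → Unique xs → length (es xs) ≤ L) where

    record LP (u v : Fin n) : Set where
      constructor lp
      field
        {nodes} : List (Node n m)
        trail : Trail (vt u) nodes (vt v)
        uniq  : Unique nodes
        size  : length (es nodes) ≡ L
    open LP public

    -- The set S of the overview. `few` is |E S| ≤ f_r(L)|S| without division. `full` treats
    -- equality only for S the whole vertex set, since a smaller S leaves a part on which the bound
    -- is strict.
    record Good : Set where
      constructor good
      field
        S        : Subset n
        nonempty : Nonempty S
        ends     : ∀ {v} → v ∈ S → ∃ λ w → LP v w
        few      : den ρ L * ∣ E S ∣ ≤ num ρ L * ∣ S ∣
        full     : (∀ v → v ∈ S) → num ρ L * ∣ S ∣ ≤ den ρ L * ∣ E S ∣ → Concl ∣ E S ∣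

    revLP : ∀ {u v} → LP u v → LP v u
    revLP (lp {xs} t u s) = lp (rev t) (unique-↭ (↭-sym (↭-reverse xs)) u) (trans (#es-↭ (↭-reverse xs)) s)

    ∈-revLP : ∀ {u v x} (P : LP u v) → x ∈ˡ nodes P → x ∈ˡ nodes (revLP P)
    ∈-revLP P = ∈-resp-↭ (↭-sym (↭-reverse (nodes P)))

    revLP-∈ : ∀ {u v x} (P : LP u v) → x ∈ˡ nodes (revLP P) → x ∈ˡ nodes P
    revLP-∈ P = ∈-resp-↭ (↭-reverse (nodes P))

    -- Otherwise `x` and `e`, put in front of the path, would give length L + 1.
    extension : ∀ {u v e x} (P : LP u v) → Outside (nodes P) u e → x ∈ N e → vt x ∈ˡ nodes P
    extension {e = e} {x} P (e∉ , u∈e) x∈e = decidable-stable (vt x ∈ˡ? nodes P) λ x∉ →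
      <⇒≱ (s≤s (≤-reflexive (sym (size P))))
        (longest (x∈e ∷ u∈e ∷ trail P) (unique-∷ (λ { (here ()) ; (there x∈) → x∉ x∈ }) (unique-∷ e∉ (uniq P))))

    -- Replacing the edge that leads into x by e turns the initial segment of the path around.
    through : ∀ {u v e} → LP u v → u ∈ N e → ∃₂ λ u' v' → Σ (LP u' v') λ Q → ed e ∈ˡ nodes Q
    through {u} {v} {e} P u∈e with ed e ∈ˡ? nodes P
    ... | yes e∈ = u , v , P , e∈
    ... | no e∉ with other-vertex u∈e u
    ...   | x , x∈e , x≢u with third∈trip (trail P) (extension P (e∉ , u∈e) x∈e) x≢u
    ...     | _ , f , t∈ with trip-split (trail P) t∈
    ...       | ys , zs , eq , s , _ , _ , s' with nodes P | uniq P | size P | e∉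
    ...         | _ | u' | sz | e∉' rewrite eq = _ , _ , lp (join (rev s) u∈e (x∈e ∷ s'))
                    (unique-↭ (↭-sym perm) (unique-∷ (e∉' ∘ ∈-drop {ys = ys}) (proj₂ (unique-drop {ys = ys} u'))))
                    (trans (#es-↭ perm) (trans (sym (#es-↭ (shift (ed f) ys zs))) sz)) , ∈-resp-↭ (↭-sym perm) (here refl)
      where
      perm : reverse ys ++ ed e ∷ zs ↭ ed e ∷ ys ++ zs
      perm = reverse-mid-↭ ys (ed e) zs

    -- The reason why p is at least L on all edges counted in `few`.
    good-through : (G : Good) → ∀ {e} → Meets (Good.S G) e → ∃₂ λ u v → Σ (LP u v) λ Q → ed e ∈ˡ nodes Q
    good-through G (v , v∈S , v∈e) = through (proj₂ (Good.ends G v∈S)) v∈e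

    chord-cycle : ∀ {u v e} (P : LP u v) → Outside (nodes P) u e → v ∈ N e → Cyc (suc L)
    chord-cycle P (e∉ , u∈e) v∈e = cyc (u∈e ∷ trail P) v∈e (unique-∷ e∉ (uniq P)) (cong suc (size P))

    -- Dirac's exchange: drop `f` from u ... a f x ... v and close up as x ... v e' a ... u e x. The
    -- edges `e` and `e'` only have to avoid the path without `f`, so one of them may be `f` itself;
    -- `I∧B` and `A∧J` use this.
    crossing-cycle : ∀ {u v ys zs f a x e e'} (P : LP u v) → nodes P ≡ ys ++ ed f ∷ zs →
      Trail (vt u) ys (vt a) → Trail (vt x) zs (vt v) →
      u ∈ N e → x ∈ N e → a ∈ N e' → v ∈ N e' → e ≢ e' → ed e ∉ˡ ys ++ zs → ed e' ∉ˡ ys ++ zs → Cyc (suc L)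
    crossing-cycle {ys = ys} {zs} {f} {e = e} {e'} (lp _ uq sz) refl s s' u∈e x∈e a∈e' v∈e' e≢e' e∉ e'∉ =
      cyc (x∈e ∷ join s' v∈e' (a∈e' ∷ rev s)) u∈e
        (unique-↭ (↭-sym (↭-prep (ed e) perm)) (unique-∷ (λ { (here refl) → e≢e' refl ; (there e∈) → e∉ e∈ })
          (unique-∷ e'∉ (proj₂ (unique-drop {ys = ys} uq)))))
        (cong suc (trans (#es-↭ perm) (trans (sym (#es-↭ (shift (ed f) ys zs))) sz)))
      where
      perm : zs ++ ed e' ∷ reverse ys ↭ ed e' ∷ ys ++ zs
      perm = ↭-trans (++-comm zs (ed e' ∷ reverse ys)) (↭-prep (ed e') (++⁺ʳ zs (↭-reverse ys)))

    module Acyclic (acyclic : ¬ Cyc (suc L)) where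

      -- Properties of a step a e x of the path. `A` and `I` concern the end `u`, through
      -- nondefining and defining edges, and `B` and `J` concern `v`. Each of the pairs A and B, I
      -- and B, A and J would give a crossing cycle.
      A B I J : List (Node n m) → Fin n → Fin n × Fin m × Fin n → Set
      A xs u (a , e , x) = Nb xs u x
      B xs v (a , e , x) = Nb xs v a
      I xs u (a , e , x) = u ∈ N e
      J xs v (a , e , x) = v ∈ N e

      A∧B : ∀ {u v t} (P : LP u v) → t ∈ˡ trip (nodes P) → A (nodes P) u t → ¬ B (nodes P) v t
      A∧B P t∈ (_ , e , (e∉ , u∈e) , x∈e) (_ , e' , (e'∉ , v∈e') , a∈e') with trip-split (trail P) t∈ | e ≟F e'
      ... | _ | yes refl = acyclic (chord-cycle P (e∉ , u∈e) v∈e')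
      ... | ys , zs , eq , s , _ , _ , s' | no e≢e' =
        acyclic (crossing-cycle P eq s s' u∈e x∈e a∈e' v∈e' e≢e'
          (λ e∈ → e∉ (subst (_ ∈ˡ_) (sym eq) (∈-drop {ys = ys} e∈))) (λ e∈ → e'∉ (subst (_ ∈ˡ_) (sym eq) (∈-drop {ys = ys} e∈))))

      I∧B : ∀ {u v t} (P : LP u v) → t ∈ˡ trip (nodes P) → I (nodes P) u t → ¬ B (nodes P) v t
      I∧B {t = _ , f , _} P t∈ u∈f (_ , e' , (e'∉ , v∈e') , a∈e') with trip-split (trail P) t∈
      ... | ys , zs , eq , s , _ , x∈f , s' =
        acyclic (crossing-cycle P eq s s' u∈f x∈f a∈e' v∈e' (λ { refl → e'∉ (subst (_ ∈ˡ_) (sym eq) (∈-++⁺ʳ ys (here refl))) })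
          (proj₁ (unique-drop {ys = ys} (subst Unique eq (uniq P)))) (λ e∈ → e'∉ (subst (_ ∈ˡ_) (sym eq) (∈-drop {ys = ys} e∈))))

      A∧J : ∀ {u v t} (P : LP u v) → t ∈ˡ trip (nodes P) → A (nodes P) u t → ¬ J (nodes P) v t
      A∧J {t = _ , f , _} P t∈ (_ , e , (e∉ , u∈e) , x∈e) v∈f with trip-split (trail P) t∈
      ... | ys , zs , eq , s , a∈f , _ , s' =
        acyclic (crossing-cycle P eq s s' u∈e x∈e a∈f v∈f (λ { refl → e∉ (subst (_ ∈ˡ_) (sym eq) (∈-++⁺ʳ ys (here refl))) })
          (λ e∈ → e∉ (subst (_ ∈ˡ_) (sym eq) (∈-drop {ys = ys} e∈))) (proj₁ (unique-drop {ys = ys} (subst Unique eq (uniq P)))))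

      A? : ∀ xs u t → Dec (A xs u t)
      A? xs u (a , e , x) = nb? xs u x
      B? : ∀ xs v t → Dec (B xs v t)
      B? xs v (a , e , x) = nb? xs v a
      I? : ∀ xs u t → Dec (I xs u t)
      I? xs u (a , e , x) = u ∈? N e
      J? : ∀ xs v t → Dec (J xs v t)
      J? xs v (a , e , x) = v ∈? N e

      module _ {u v} (P : LP u v) where
        private
          xs = nodes P
          ts = trip xs

        #trips : length ts ≡ L
        #trips = trans (#trip (trail P)) (size P)

        private
          via : ∀ {k} {T : Fin n × Fin m × Fin n → Set} (T? : ∀ t → Dec (T t)) (f : Fin n × Fin m × Fin n → Fin k)
            {p : Subset k} → (∀ {i} → i ∈ p → ∃ λ t → t ∈ˡ ts × T t × i ≡ f t) → ∣ p ∣ ≤ length (filter T? ts)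
          via T? f {p} h = subst (∣ p ∣ ≤_) (length-map f (filter T? ts))
            (∣p∣≤length p (map f (filter T? ts)) λ i∈ → let (t , t∈ , Tt , i≡) = h i∈ in
              subst (_∈ˡ map f (filter T? ts)) (sym i≡) (∈-map⁺ f (∈-filter⁺ T? t∈ Tt)))

        #nb≤#A : #nb xs u ≤ length (filter (A? xs u) ts)
        #nb≤#A = via (A? xs u) (λ (a , e , x) → x) λ {x} x∈ →
          let nb@(x≢u , e , o , x∈e) = ∈⟪⟫⁻ (nb? xs u) x∈
              (a , f , t∈) = third∈trip (trail P) (extension P o x∈e) x≢u
          in (a , f , x) , t∈ , nb , refl

        #nb≤#B : #nb xs v ≤ length (filter (B? xs v) ts)
        #nb≤#B = via (B? xs v) (λ (a , e , x) → a) λ {x} x∈ →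
          let nb@(x≢v , e , (e∉ , v∈e) , x∈e) = ∈⟪⟫⁻ (nb? xs v) x∈
              (f , y , t∈) = first∈trip (trail P) (revLP-∈ P (extension (revLP P) (e∉ ∘ revLP-∈ P , v∈e) x∈e)) x≢v
          in (x , f , y) , t∈ , nb , refl

        #in≤#I : #in xs u ≤ length (filter (I? xs u) ts)
        #in≤#I = via (I? xs u) (λ (a , e , x) → e) λ {e} e∈ →
          let (e∈xs , u∈e) = ∈⟪⟫⁻ (inside? xs u) e∈
              (a , x , t∈) = edge∈trip (trail P) e∈xs
          in (a , e , x) , t∈ , u∈e , refl

        #in≤#J : #in xs v ≤ length (filter (J? xs v) ts)
        #in≤#J = via (J? xs v) (λ (a , e , x) → e) λ {e} e∈ →
          let (e∈xs , v∈e) = ∈⟪⟫⁻ (inside? xs v) e∈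
              (a , x , t∈) = edge∈trip (trail P) e∈xs
          in (a , e , x) , t∈ , v∈e , refl

        #nb+#nb≤L : #nb xs u + #nb xs v ≤ L
        #nb+#nb≤L = ≤-trans (+-mono-≤ #nb≤#A #nb≤#B) (≤-trans (exclusive⇒count (A? xs u) (B? xs v) ts (A∧B P)) (≤-reflexive #trips))

        #in+#nb≤L : #in xs u + #nb xs v ≤ L
        #in+#nb≤L = ≤-trans (+-mono-≤ #in≤#I #nb≤#B) (≤-trans (exclusive⇒count (I? xs u) (B? xs v) ts (I∧B P)) (≤-reflexive #trips))

        #nb+#in≤L : #nb xs u + #in xs v ≤ L
        #nb+#in≤L = ≤-trans (+-mono-≤ #nb≤#A #in≤#J) (≤-trans (exclusive⇒count (A? xs u) (J? xs v) ts (A∧J P)) (≤-reflexive #trips))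

-- Degree bounds at the ends, without a cycle of L + 1 edges

module LongPaths {n m : ℕ} (N : Fin m → Subset n) (ρ : ℕ) (2≤ρ : 2 ≤ ρ)
  (unif : ∀ {e v} → v ∈ N e → ∣ N e ∣ ≡ suc ρ)
  (dist : ∀ {e e' v} → v ∈ N e → N e ≡ N e' → e ≡ e')
  (L : ℕ) (1≤L : 1 ≤ L)
  (longest : ∀ {u xs v} → Incidence.Trail N (vt u) xs (vt v) → Unique xs → length (es xs) ≤ L)
  (acyclic : ¬ Structure.Cyc N ρ 2≤ρ unif dist (suc L)) where

  open Structure N ρ 2≤ρ unif dist
  open Longest L longest
  open Acyclic acyclic

  edge-at : ∀ {u v} (P : LP u v) → ∃ (Inside (nodes P) u)
  edge-at (lp [-] _ refl) = ⊥-elim (<⇒≱ 1≤L z≤n)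
  edge-at (lp (_∷_ {y = ed e} u∈e t) _ _) = e , there (start∈ t) , u∈e

  1≤#in : ∀ {u v} (P : LP u v) → 1 ≤ #in (nodes P) u
  1≤#in {u} P = x∈p⇒1≤∣p∣ (∈⟪⟫⁺ (inside? (nodes P) u) (proj₂ (edge-at P)))

  -- An edge exists and has r vertices, so a set of at most r - 1 vertices is never everything and
  -- the clause on equality is vacuous.
  small-good : ∀ S → ρ < L → Nonempty S → (∀ {v} → v ∈ S → ∃ λ w → LP v w) → ∣ S ∣ ≤ ρ →
    suc ρ * ∣ E S ∣ ≤ (L C ρ) * ∣ S ∣ → Good
  small-good S ρ<L ne ends ∣S∣≤ρ few = good S ne ends
    (subst₂ (λ d k → d * ∣ E S ∣ ≤ k * ∣ S ∣) (sym (proj₂ nd)) (sym (proj₁ nd)) few)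
    λ all _ → ⊥-elim (<⇒≱ (s≤s ∣S∣≤ρ)
      (let (e , _ , v∈e) = edge-at (proj₂ (ends (proj₂ ne))) in edge⊆⇒≤ v∈e (λ {x} _ → all x)))
    where nd = num-den-big 2≤ρ ρ<L

  vertex-good : ∀ {u v} → LP u v → ρ < L → suc ρ * ∣ E ⁅ u ⁆ ∣ ≤ L C ρ → Good
  vertex-good {u} {v} P ρ<L few = small-good ⁅ u ⁆ ρ<L (u , x∈⁅x⁆ u)
    (λ x∈ → v , subst (λ x → LP x v) (sym (x∈⁅y⁆⇒x≡y u x∈)) P)
    (≤-trans (≤-reflexive (∣⁅x⁆∣≡1 u)) (<⇒≤ 2≤ρ))
    (≤-trans few (≤-reflexive (trans (sym (*-identityʳ (L C ρ))) (cong ((L C ρ) *_) (sym (∣⁅x⁆∣≡1 u))))))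

  some-outside? : ∀ xs u → Dec (∃ (Outside xs u))
  some-outside? xs u = any? (outside? xs u)

  no-outside⇒degree : ∀ xs u → ¬ ∃ (Outside xs u) → ∣ E ⁅ u ⁆ ∣ ≤ #in xs u
  no-outside⇒degree xs u none = p⊆q⇒∣p∣≤∣q∣ λ {e} e∈ → ∈⟪⟫⁺ (inside? xs u) (inn (∈⟪⟫⁻ (meets? ⁅ u ⁆) e∈))
    where
    inn : ∀ {e} → Meets ⁅ u ⁆ e → Inside xs u e
    inn {e} (x , x∈ , x∈e) with x∈⁅y⁆⇒x≡y u x∈
    ... | refl = decidable-stable (ed e ∈ˡ? xs) (λ e∉ → none (e , e∉ , x∈e)) , x∈e

  -- All edges at `u` are defining, and the r - 1 or more outside neighbours of `v` each exclude a
  -- step, so the degree of `u` is at most L - (r - 1). That `u` has at least one defining edge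
  -- gives L ≥ r.
  one-sided : ∀ {u v} (P : LP u v) → ¬ ∃ (Outside (nodes P) u) → ∃ (Outside (nodes P) v) → Good
  one-sided {u} {v} P none (e , o) with m≤n⇒∃[o]m+o≡n (≤-trans (+-mono-≤ (1≤#in P) (outside⇒ρ≤#nb o)) (#in+#nb≤L P))
  ... | t , refl = vertex-good P (s≤s (m≤m+n ρ t)) (begin
    suc ρ * ∣ E ⁅ u ⁆ ∣       ≤⟨ *-monoʳ-≤ (suc ρ) (no-outside⇒degree (nodes P) u none) ⟩
    suc ρ * #in (nodes P) u   ≤⟨ *-monoʳ-≤ (suc ρ) (+-cancelˡ-≤ ρ _ _ bound) ⟩
    suc ρ * suc t             ≤⟨ linear≤C ρ t 2≤ρ ⟩
    (suc ρ + t) C ρ           ∎)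
    where
    open ≤-Reasoning
    bound : ρ + #in (nodes P) u ≤ ρ + suc t
    bound = begin
      ρ + #in (nodes P) u                  ≡⟨ +-comm ρ _ ⟩
      #in (nodes P) u + ρ                  ≤⟨ +-monoʳ-≤ _ (outside⇒ρ≤#nb o) ⟩
      #in (nodes P) u + #nb (nodes P) v    ≤⟨ #in+#nb≤L P ⟩
      suc (ρ + t)                          ≡⟨ +-suc ρ t ⟨
      ρ + suc t                            ∎

  start≢end : ∀ {u v} → LP u v → u ≢ v
  start≢end (lp [-] _ refl) refl = <⇒≱ 1≤L z≤n
  start≢end (lp (_ ∷ t) uq _) refl = Unique[x∷xs]⇒x∉xs uq (end∈ t)

  outside-rev : ∀ {u v w} (P : LP u v) → ∃ (Outside (nodes P) w) → ∃ (Outside (nodes (revLP P)) w)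
  outside-rev P (e , e∉ , w∈e) = e , e∉ ∘ revLP-∈ P , w∈e

  rev-outside : ∀ {u v w} (P : LP u v) → ∃ (Outside (nodes (revLP P)) w) → ∃ (Outside (nodes P) w)
  rev-outside P (e , e∉ , w∈e) = e , e∉ ∘ ∈-revLP P , w∈e

  no-outside-good : ∀ {u v} (P : LP u v) → suc ρ < L → ¬ ∃ (Outside (nodes P) u) → ¬ ∃ (Outside (nodes P) v) → Good
  no-outside-good {u} {v} P ρ<L noneᵘ noneᵛ = small-good S (<⇒≤ ρ<L) (u , x∈p∪q⁺ (inj₁ (x∈⁅x⁆ u)))
    ends ∣S∣≤ρ few
    where
    open ≤-Reasoning
    S = ⁅ u ⁆ ∪ ⁅ v ⁆
    cases : ∀ {x} → x ∈ S → x ≡ u ⊎ x ≡ v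
    cases x∈ with x∈p∪q⁻ ⁅ u ⁆ ⁅ v ⁆ x∈
    ... | inj₁ x∈u = inj₁ (x∈⁅y⁆⇒x≡y u x∈u)
    ... | inj₂ x∈v = inj₂ (x∈⁅y⁆⇒x≡y v x∈v)
    ends : ∀ {x} → x ∈ S → ∃ λ w → LP x w
    ends x∈ with cases x∈
    ... | inj₁ refl = v , P
    ... | inj₂ refl = u , revLP P
    ∣S∣≤ρ : ∣ S ∣ ≤ ρ
    ∣S∣≤ρ = ≤-trans (∣p∣≤length S (u ∷ v ∷ []) λ x∈ → [ (λ x≡u → here x≡u) , (λ x≡v → there (here x≡v)) ]′ (cases x∈)) 2≤ρ
    2≤∣S∣ : 2 ≤ ∣ S ∣
    2≤∣S∣ = begin
      2                        ≡⟨ cong₂ _+_ (∣⁅x⁆∣≡1 u) (∣⁅x⁆∣≡1 v) ⟨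
      ∣ ⁅ u ⁆ ∣ + ∣ ⁅ v ⁆ ∣    ≤⟨ disjoint⇒∣p∣+∣q∣≤∣p∪q∣ ⁅ u ⁆ ⁅ v ⁆ (λ x∈u x∈v → start≢end P (trans (sym (x∈⁅y⁆⇒x≡y u x∈u)) (x∈⁅y⁆⇒x≡y v x∈v))) ⟩
      ∣ S ∣                    ∎
    ∣E∣≤L : ∣ E S ∣ ≤ L
    ∣E∣≤L = ≤-trans (∣p∣≤length (E S) (es (nodes P)) λ e∈ → ∈es⁺ (inn (∈⟪⟫⁻ (meets? S) e∈))) (≤-reflexive (size P))
      where
      inn : ∀ {e} → Meets S e → ed e ∈ˡ nodes P
      inn {e} (x , x∈ , x∈e) = decidable-stable (ed e ∈ˡ? nodes P) λ e∉ → out (cases x∈) e∉ x∈e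
        where
        out : ∀ {x} → x ≡ u ⊎ x ≡ v → ed e ∉ˡ nodes P → x ∉ N e
        out (inj₁ refl) e∉ x∈e = noneᵘ (e , e∉ , x∈e)
        out (inj₂ refl) e∉ x∈e = noneᵛ (e , e∉ , x∈e)
    half : suc ρ * L ≤ 2 * (L C ρ)
    half with m≤n⇒∃[o]m+o≡n ρ<L
    ... | t , refl = half≤C ρ t 2≤ρ
    few : suc ρ * ∣ E S ∣ ≤ (L C ρ) * ∣ S ∣
    few = begin
      suc ρ * ∣ E S ∣     ≤⟨ *-monoʳ-≤ (suc ρ) ∣E∣≤L ⟩
      suc ρ * L           ≤⟨ half ⟩
      2 * (L C ρ)         ≡⟨ *-comm 2 (L C ρ) ⟩
      (L C ρ) * 2         ≤⟨ *-monoʳ-≤ (L C ρ) 2≤∣S∣ ⟩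
      (L C ρ) * ∣ S ∣     ∎

  degree≤ : ∀ xs u → ∣ E ⁅ u ⁆ ∣ ≤ #nb xs u C ρ + #in xs u
  degree≤ xs u = ≤-trans (degree xs u) (+-monoˡ-≤ _ (#outsides xs u))

  -- For r ≥ 4 the bound C(a, r-1) + L - a on the degree of an endpoint suffices.
  balanced-good : ∀ {u v} (P : LP u v) → suc ρ < L → 3 ≤ ρ → ρ ≤ #nb (nodes P) u → #nb (nodes P) u ≤ #nb (nodes P) v → Good
  balanced-good {u} {v} P ρ<L 3≤ρ ρ≤a a≤b = vertex-good P (<⇒≤ ρ<L) (bound 3≤ρ ρ≤a (degree≤ (nodes P) u))
    where
    open ≤-Reasoning
    a = #nb (nodes P) u
    b = #nb (nodes P) v
    α = #in (nodes P) u
    bound : 3 ≤ ρ → ρ ≤ a → ∣ E ⁅ u ⁆ ∣ ≤ a C ρ + α → suc ρ * ∣ E ⁅ u ⁆ ∣ ≤ L C ρ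
    bound 3≤ρ ρ≤a d with m≤n⇒∃[o]m+o≡n 3≤ρ | m≤n⇒∃[o]m+o≡n (≤-trans (+-monoʳ-≤ a a≤b) (#nb+#nb≤L P))
    ... | s , refl | t , L≡ = begin
      suc ρ * ∣ E ⁅ u ⁆ ∣                       ≤⟨ *-monoʳ-≤ (suc ρ) (≤-trans d (+-monoʳ-≤ (a C ρ) α≤)) ⟩
      suc ρ * (a C ρ + (a + t))                 ≡⟨ *-distribˡ-+ (suc ρ) (a C ρ) _ ⟩
      suc ρ * (a C ρ) + suc ρ * (a + t)         ≤⟨ half-star s a t ρ≤a ⟩
      (2 * a + t) C ρ                           ≡⟨ cong (λ k → (a + k + t) C ρ) (+-identityʳ a) ⟩
      (a + a + t) C ρ                           ≡⟨ cong (_C ρ) L≡ ⟩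
      L C ρ                                     ∎
      where
      α≤ : α ≤ a + t
      α≤ = +-cancelʳ-≤ a α (a + t) (begin
        α + a          ≤⟨ +-monoʳ-≤ α a≤b ⟩
        α + b          ≤⟨ #in+#nb≤L P ⟩
        L              ≡⟨ L≡ ⟨
        a + a + t      ≡⟨ +-assoc a a t ⟩
        a + (a + t)    ≡⟨ +-comm a (a + t) ⟩
        a + t + a      ∎)

  long-cases : ∀ {u v} (P : LP u v) → suc ρ < L → Good ⊎ (ρ ≤ #nb (nodes P) u × ρ ≤ #nb (nodes P) v)
  long-cases {u} {v} P ρ<L with some-outside? (nodes P) u | some-outside? (nodes P) v
  ... | no noneᵘ | no noneᵛ = inj₁ (no-outside-good P ρ<L noneᵘ noneᵛ)
  ... | no noneᵘ | yes o = inj₁ (one-sided P noneᵘ o)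
  ... | yes o | no noneᵛ = inj₁ (one-sided (revLP P) (noneᵛ ∘ rev-outside P) (outside-rev P o))
  ... | yes (_ , oᵘ) | yes (_ , oᵛ) = inj₂ (outside⇒ρ≤#nb oᵘ , outside⇒ρ≤#nb oᵛ)

  long-good : ∀ {u v} → LP u v → suc ρ < L → 3 ≤ ρ → Good
  long-good {u} {v} P ρ<L 3≤ρ with long-cases P ρ<L
  ... | inj₁ g = g
  ... | inj₂ (ρ≤a , ρ≤b) with ≤-total (#nb (nodes P) u) (#nb (nodes P) v)
  ...   | inj₁ a≤b = balanced-good P ρ<L 3≤ρ ρ≤a a≤b
  ...   | inj₂ b≤a = balanced-good (revLP P) ρ<L 3≤ρ (≤-trans ρ≤b (#nb-resp v (revLP-∈ P)))
    (≤-trans (#nb-resp v (∈-revLP P)) (≤-trans b≤a (#nb-resp u (revLP-∈ P))))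

-- The case r = 3.
module TripleSystems {n m : ℕ} (N : Fin m → Subset n) (2≤2 : 2 ≤ 2)
  (unif : ∀ {e v} → v ∈ N e → ∣ N e ∣ ≡ 3)
  (dist : ∀ {e e' v} → v ∈ N e → N e ≡ N e' → e ≡ e')
  (L : ℕ) (1≤L : 1 ≤ L)
  (longest : ∀ {u xs v} → Incidence.Trail N (vt u) xs (vt v) → Unique xs → length (es xs) ≤ L)
  (acyclic : ¬ Structure.Cyc N 2 2≤2 unif dist (suc L)) (3<L : 3 < L) where

  open Structure N 2 2≤2 unif dist
  open Longest L longest
  open Acyclic acyclic
  open LongPaths N 2 2≤2 unif dist L 1≤L longest acyclic

  degree-good : ∀ {u v} → LP u v → ∀ a → 2 ≤ a → a + a ≤ L → ∣ E ⁅ u ⁆ ∣ + suc a ≤ a C 2 + L → Good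
  degree-good P a 2≤a 2a≤L d = vertex-good P (<⇒≤ 3<L) (from-half-star (_C 2) half-star-3 a 2≤a 2a≤L d)

  -- What remains when counting alone saves nothing at either end: equality in the exclusions of I
  -- and B and of A and J. Then every step has I or B, and every step has A or J.
  record Tight {u v} (P : LP u v) : Set where
    constructor tight
    field
      2≤a : 2 ≤ #nb (nodes P) u
      a≡b : #nb (nodes P) u ≡ #nb (nodes P) v
      L≤α+b : L ≤ #in (nodes P) u + #nb (nodes P) v
      L≤a+β : L ≤ #nb (nodes P) u + #in (nodes P) v

  good-or-tight : ∀ {u v} (P : LP u v) → 2 ≤ #nb (nodes P) u → 2 ≤ #nb (nodes P) v → Good ⊎ Tight P
  good-or-tight {u} {v} P 2≤a 2≤b = go (<-cmp a b)
    where
    open ≤-Reasoning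
    a = #nb (nodes P) u
    b = #nb (nodes P) v
    α = #in (nodes P) u
    β = #in (nodes P) v
    goodᵘ : a ≤ b → α + suc a ≤ L → Good
    goodᵘ a≤b h = degree-good P a 2≤a (≤-trans (+-monoʳ-≤ a a≤b) (#nb+#nb≤L P)) (begin
      ∣ E ⁅ u ⁆ ∣ + suc a      ≤⟨ +-monoˡ-≤ (suc a) (degree≤ (nodes P) u) ⟩
      a C 2 + α + suc a        ≡⟨ +-assoc (a C 2) α (suc a) ⟩
      a C 2 + (α + suc a)      ≤⟨ +-monoʳ-≤ (a C 2) h ⟩
      a C 2 + L                ∎)
    goodᵛ : b ≤ a → suc b + β ≤ L → Good
    goodᵛ b≤a h = degree-good (revLP P) b 2≤b (≤-trans (+-monoˡ-≤ b b≤a) (#nb+#nb≤L P)) (begin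
      ∣ E ⁅ v ⁆ ∣ + suc b      ≤⟨ +-monoˡ-≤ (suc b) (degree≤ (nodes P) v) ⟩
      b C 2 + β + suc b        ≡⟨ +-assoc (b C 2) β (suc b) ⟩
      b C 2 + (β + suc b)      ≤⟨ +-monoʳ-≤ (b C 2) (≤-trans (≤-reflexive (+-comm β (suc b))) h) ⟩
      b C 2 + L                ∎)
    go : Tri (a < b) (a ≡ b) (b < a) → Good ⊎ Tight P
    -- The strict inequality supplies the missing unit: `u` has at most L - b ≤ L - a - 1 defining
    -- edges.
    go (tri< a<b _ _) = inj₁ (goodᵘ (<⇒≤ a<b) (≤-trans (+-monoʳ-≤ α a<b) (#in+#nb≤L P)))
    go (tri> _ _ b<a) = inj₁ (goodᵛ (<⇒≤ b<a) (≤-trans (+-monoˡ-≤ β b<a) (#nb+#in≤L P)))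
    go (tri≈ _ a≡b _) with α + suc a ≤? L | suc b + β ≤? L
    ... | yes h | _ = inj₁ (goodᵘ (≤-reflexive a≡b) h)
    ... | no _ | yes h = inj₁ (goodᵛ (≤-reflexive (sym a≡b)) h)
    ... | no h | no k = inj₂ (tight 2≤a a≡b
      (≤-trans (s≤s⁻¹ (≤-trans (≰⇒> h) (≤-reflexive (+-suc α a)))) (≤-reflexive (cong (α +_) a≡b)))
      (≤-trans (s≤s⁻¹ (≰⇒> k)) (≤-reflexive (cong (_+ β) (sym a≡b)))))

  module _ {u v : Fin n} {d e : Fin m} {zs xs : List (Node n m)} (uq : Unique xs) (sz : length (es xs) ≡ L) (v∈d : v ∈ N d) (e∉ : ed e ∉ˡ xs) (u∈e : u ∈ N e) where

    -- The path is u d ... y f z ... v, and the cycle is f u e z ... v d ... y. In the first clause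
    -- f = d and y = u, and the cycle is d u e z ... v.
    inside-cycle : ∀ {f y z ys pz} → xs ≡ vt u ∷ ed d ∷ zs → xs ≡ ys ++ ed f ∷ pz →
      Trail (vt u) ys (vt y) → y ∈ N f → Trail (vt z) pz (vt v) → z ∈ N e → u ∈ N f → Cyc (suc L)
    inside-cycle {pz = pz} refl refl [-] y∈f s z∈e u∈f = cyc (u∈f ∷ u∈e ∷ z∈e ∷ s) v∈d
      (unique-↭ (↭-sym perm) (unique-∷ e∉ uq)) (trans (#es-↭ perm) (cong suc sz))
      where
      perm : ed d ∷ vt u ∷ ed e ∷ pz ↭ ed e ∷ vt u ∷ ed d ∷ pz
      perm = swap-ends (ed d) (vt u) (ed e)
    inside-cycle {f = f} {pz = pz} refl refl (_∷_ {ys = ys} _ r@(_ ∷ _)) y∈f s z∈e u∈f = cyc (u∈f ∷ u∈e ∷ join (z∈e ∷ s) v∈d r) y∈f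
      (unique-↭ (↭-sym perm) (unique-∷ e∉ uq)) (trans (#es-↭ perm) (cong suc sz))
      where
      perm : ed f ∷ vt u ∷ ed e ∷ pz ++ ys ↭ ed e ∷ vt u ∷ ys ++ ed f ∷ pz
      perm = ↭-trans (swap-ends (ed f) (vt u) (ed e)) (↭-prep _ (↭-prep _ (++-comm (ed f ∷ pz) ys)))

    -- The path is u d ... y f z g w ... v, and the cycle is u e z f y ... d v ... w g, with both
    -- segments run backwards. In the first clause f = d.
    inside-next-cycle : ∀ {f g y z w ys pz} → xs ≡ vt u ∷ ed d ∷ zs → xs ≡ ys ++ ed f ∷ vt z ∷ ed g ∷ pz →
      Trail (vt u) ys (vt y) → y ∈ N f → z ∈ N f → w ∈ N g → Trail (vt w) pz (vt v) → z ∈ N e → u ∈ N g → Cyc (suc L)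
    inside-next-cycle {g = g} {z = z} {pz = pz} refl refl [-] y∈f z∈f w∈g s z∈e u∈g = cyc (u∈e ∷ z∈e ∷ z∈f ∷ join (v∈d ∷ rev s) w∈g [-]) u∈g
      (unique-↭ (↭-sym perm) (unique-∷ e∉ uq)) (trans (#es-↭ perm) (cong suc sz))
      where
      perm : vt u ∷ ed e ∷ vt z ∷ ed d ∷ reverse pz ++ ed g ∷ [] ↭ ed e ∷ vt u ∷ ed d ∷ vt z ∷ ed g ∷ pz
      perm = Perm.swap _ _ (Perm.swap _ _ (reverse-∷ʳ-↭ pz (ed g)))
    inside-next-cycle {f = f} {g} {z = z} {pz = pz} refl refl (_∷_ {ys = ys} _ r@(_ ∷ _)) y∈f z∈f w∈g s z∈e u∈g =
      cyc (u∈e ∷ z∈e ∷ z∈f ∷ y∈f ∷ join (rev r) v∈d (join (rev s) w∈g [-])) u∈g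
      (unique-↭ (↭-sym perm) (unique-∷ e∉ uq)) (trans (#es-↭ perm) (cong suc sz))
      where
      perm : vt u ∷ ed e ∷ vt z ∷ ed f ∷ reverse ys ++ reverse pz ++ ed g ∷ [] ↭ ed e ∷ vt u ∷ ys ++ ed f ∷ vt z ∷ ed g ∷ pz
      perm = Perm.swap _ _ (↭-trans (Perm.swap _ _ (++⁺ (↭-reverse ys) (reverse-∷ʳ-↭ pz (ed g))))
        (shifts (ed f ∷ vt z ∷ []) ys))

  module _ {u v} (P : LP u v) (T : Tight P) where
    open Tight T

    private
      xs = nodes P
      ts = trip xs

    some-A : ∃ λ t → t ∈ˡ ts × A xs u t
    some-A with filter (A? xs u) ts in eq
    ... | [] = ⊥-elim (<⇒≱ 2≤a (≤-trans (#nb≤#A P) (≤-trans (≤-reflexive (cong length eq)) z≤n)))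
    ... | t ∷ _ = t , ∈-filter⁻ (A? xs u) (subst (t ∈ˡ_) (sym eq) (here refl))

    I⊎B : ∀ {t} → t ∈ˡ ts → I xs u t ⊎ B xs v t
    I⊎B = tight⇒cover (I? xs u) (B? xs v) ts (I∧B P)
      (≤-trans (≤-reflexive (#trips P)) (≤-trans L≤α+b (+-mono-≤ (#in≤#I P) (#nb≤#B P))))

    A⊎J : ∀ {t} → t ∈ˡ ts → A xs u t ⊎ J xs v t
    A⊎J = tight⇒cover (A? xs u) (J? xs v) ts (A∧J P)
      (≤-trans (≤-reflexive (#trips P)) (≤-trans L≤a+β (+-mono-≤ (#nb≤#A P) (#in≤#J P))))

    -- If the first edge also contains the last vertex, the path minus its start is a cycle, and along the path
    -- the outside neighbours of u would be closed under taking the next vertex.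
    first-edge-contradiction : ∀ {d zs} → xs ≡ vt u ∷ ed d ∷ zs → v ∉ N d
    first-edge-contradiction eq v∈d =
      let (t , t∈ , At) = some-A
          (pre , (y , f , z) , eqᵗ , z≢u , e , o , z∈e) = ascend ts step t∈ At
      in acyclic (chord-cycle P o (subst (_∈ N e) (last-trip pre (trail P) eqᵗ) z∈e))
      where
      A∧I : ∀ {t} → t ∈ˡ ts → A xs u t → ¬ I xs u t
      A∧I t∈ (_ , e , (e∉ , u∈e) , z∈e) u∈f =
        let (_ , _ , eq' , s , y∈f , _ , s') = trip-split (trail P) t∈
        in acyclic (inside-cycle (uniq P) (size P) v∈d e∉ u∈e eq eq' s y∈f s' z∈e u∈f)
      -- Since a = b, tightness of the count for I and B also makes the count for I and A tight.
      cover : ∀ {t} → t ∈ˡ ts → I xs u t ⊎ A xs u t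
      cover = tight⇒cover (I? xs u) (A? xs u) ts (λ t∈ It At → A∧I t∈ At It)
        (≤-trans (≤-reflexive (#trips P)) (≤-trans L≤α+b (+-mono-≤ (#in≤#I P) (≤-trans (≤-reflexive (sym a≡b)) (#nb≤#A P)))))
      step : ∀ pre {t t' post} → ts ≡ pre ++ t ∷ t' ∷ post → A xs u t → A xs u t'
      step pre {t} {t'} eqᵗ (_ , e , (e∉ , u∈e) , z∈e) with cover {t'} (subst (t' ∈ˡ_) (sym eqᵗ) (∈-++⁺ʳ pre (there (here refl))))
      ... | inj₂ At' = At'
      ... | inj₁ u∈g =
        let (_ , _ , _ , eq' , s , y∈f , z∈f , _ , w∈g , s') = trip-split₂ pre (trail P) eqᵗ
        in ⊥-elim (acyclic (inside-next-cycle (uniq P) (size P) v∈d e∉ u∈e eq eq' s y∈f z∈f w∈g s' z∈e u∈g))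

    -- Without consecutive t, t' such that v ∈ e and u ∈ e', the outside neighbours of u form an initial segment of
    -- the path; then the second edge consists of u and two outside neighbours, although it is not an outside edge.
    initial-good : (∀ pre {t t' post} → ts ≡ pre ++ t ∷ t' ∷ post → J xs v t → ¬ I xs u t') → Good
    initial-good separated = go ts refl (#nb≤#A P)
      where
      step : ∀ pre {t t' post} → ts ≡ pre ++ t ∷ t' ∷ post → A xs u t' → A xs u t
      step pre {t} {t'} eq At' with I⊎B {t'} (subst (t' ∈ˡ_) (sym eq) (∈-++⁺ʳ pre (there (here refl))))
                                 | A⊎J {t} (subst (t ∈ˡ_) (sym eq) (∈-++⁺ʳ pre (here refl)))
      ... | inj₂ Bt' | _ = ⊥-elim (A∧B P (subst (t' ∈ˡ_) (sym eq) (∈-++⁺ʳ pre (there (here refl)))) At' Bt')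
      ... | inj₁ _ | inj₁ At = At
      ... | inj₁ It' | inj₂ Jt = ⊥-elim (separated pre eq Jt It')
      some : ∀ l → 1 ≤ length (filter (A? xs u) l) → ∃ λ t → t ∈ˡ l × A xs u t
      some l le with filter (A? xs u) l in eqᶠ
      ... | t ∷ _ = t , ∈-filter⁻ (A? xs u) (subst (t ∈ˡ_) (sym eqᶠ) (here refl))
      ... | [] = ⊥-elim (<⇒≱ le z≤n)
      go : ∀ l → ts ≡ l → #nb xs u ≤ length (filter (A? xs u) l) → Good
      go [] _ le = ⊥-elim (<⇒≱ 2≤a (≤-trans le z≤n))
      go (t₁ ∷ []) _ le = ⊥-elim (<⇒≱ 2≤a (≤-trans le (filter-∷-≤ (A? xs u) t₁ [])))
      -- As a ≥ 2, some outside neighbour comes after the first step; `descend` then carries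
      -- property A back to the second step.
      go (t₁@(y , e₁ , x₁) ∷ (w , e₂ , x₂) ∷ ts'') eqᵗ le
        with trip-split₂ [] (trail P) eqᵗ | some ((w , e₂ , x₂) ∷ ts'') (s≤s⁻¹ (≤-trans 2≤a (≤-trans le (filter-∷-≤ (A? xs u) t₁ _))))
      ... | refl , ys , zs , eqˣ , s , y∈e₁ , _ , x₁∈e₂ , x₂∈e₂ , s' | t , t∈ , At =
        degree-good P a 2≤a (≤-trans (≤-reflexive (cong (a +_) a≡b)) (#nb+#nb≤L P)) (begin
          ∣ E ⁅ u ⁆ ∣ + suc a          ≤⟨ +-monoˡ-≤ (suc a) (degree xs u) ⟩
          o + α + suc a                ≡⟨ shuffle o α a ⟩
          suc o + (α + a)              ≤⟨ +-mono-≤ one-less (≤-trans (≤-reflexive (cong (α +_) a≡b)) (#in+#nb≤L P)) ⟩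
          a C 2 + L                    ∎)
        where
        open ≤-Reasoning
        a = #nb xs u
        α = #in xs u
        o = length (outsides xs u)
        A₂ : A xs u (x₁ , e₂ , x₂)
        A₂ = descend _ ts'' (λ pre eq → step (t₁ ∷ pre) (trans eqᵗ (cong (t₁ ∷_) eq))) t∈ At
        A₁ : A xs u t₁
        A₁ = step [] eqᵗ A₂
        ∈ts : (x₁ , e₂ , x₂) ∈ˡ ts
        ∈ts = subst (_ ∈ˡ_) (sym eqᵗ) (there (here refl))
        u∈e₂ : u ∈ N e₂
        u∈e₂ with I⊎B ∈ts
        ... | inj₁ h = h
        ... | inj₂ h = ⊥-elim (A∧B P ∈ts A₂ h)
        x₁≢x₂ : x₁ ≢ x₂
        x₁≢x₂ refl = proj₁ (unique-drop {ys = ys ++ ed e₁ ∷ []} (subst Unique (trans eqˣ (sym (++-assoc ys (ed e₁ ∷ []) _))) (uniq P)))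
          (∈-++⁺ʳ (ys ++ ed e₁ ∷ []) (there (start∈ s')))
        e₂∈xs : ed e₂ ∈ˡ xs
        e₂∈xs = subst (ed e₂ ∈ˡ_) (sym eqˣ) (∈-++⁺ʳ ys (there (there (here refl))))
        star : ∀ {x} → x ∈ N e₂ → x ≢ u → Nb xs u x
        star {x} x∈ x≢u with x ≟F x₁ | x ≟F x₂
        ... | yes refl | _ = A₁
        ... | no _ | yes refl = A₂
        ... | no x≢x₁ | no x≢x₂ = ⊥-elim (<⇒≱ ≤-refl (subst (4 ≤_) (unif u∈e₂) (length≤∣p∣ (N e₂) {x ∷ u ∷ x₁ ∷ x₂ ∷ []}
          ((x≢u ∷ x≢x₁ ∷ x≢x₂ ∷ []) ∷ ((proj₁ A₁ ∘ sym) ∷ (proj₁ A₂ ∘ sym) ∷ []) ∷ (x₁≢x₂ ∷ []) ∷ [] ∷ [])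
          λ { (here refl) → x∈ ; (there (here refl)) → u∈e₂ ; (there (there (here refl))) → x₁∈e₂ ; (there (there (there (here refl)))) → x₂∈e₂ })))
        one-less : suc o ≤ a C 2
        one-less = star-bound xs u (e₂ ∷ outsides xs u)
          (unique-∷ (λ e∈ → proj₁ (proj₂ (∈-filter⁻ (outside? xs u) {xs = allFin m} e∈)) e₂∈xs) (outsides-unique xs u))
          λ { (here refl) → u∈e₂ , star ; (there e∈) → outsides-star xs u e∈ }

  -- A path u … a e x e' x' … v with v ∈ e and u ∈ e' can be rearranged to start x e a … u e' x'.
  rotated : ∀ {u v} (P : LP u v) pre {t t' post} → trip (nodes P) ≡ pre ++ t ∷ t' ∷ post →
    J (nodes P) v t → I (nodes P) u t' → ∃ λ x → Σ (LP x v) λ Q → ∃₂ λ d zs → nodes Q ≡ vt x ∷ ed d ∷ zs × v ∈ N d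
  rotated {u} {v} P pre {_ , e , x} {_ , e' , x'} eqᵗ v∈e u∈e' with trip-split₂ pre (trail P) eqᵗ
  ... | _ , ys , zs , eq , s , a∈e , x∈e , x∈e' , x'∈e' , s' =
    x , lp (x∈e ∷ a∈e ∷ join (rev s) u∈e' (x'∈e' ∷ s')) (unique-↭ (↭-sym perm) (subst Unique eq (uniq P)))
      (trans (#es-↭ perm) (trans (cong (length ∘ es) (sym eq)) (size P))) , e , _ , refl , v∈e
    where
    perm : vt x ∷ ed e ∷ reverse ys ++ ed e' ∷ zs ↭ ys ++ ed e ∷ vt x ∷ ed e' ∷ zs
    perm = ↭-trans (Perm.swap _ _ (++⁺ʳ (ed e' ∷ zs) (↭-reverse ys))) (shifts (ed e ∷ vt x ∷ []) ys)

  -- Without a good set every longest path is tight, in particular the rotated one, whose first edge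
  -- contains the last vertex.
  triple-good : ∀ {u v} → LP u v → ¬ ¬ Good
  triple-good P ¬good = ¬good (initial-good P (is-tight P) λ pre eq Jt It' →
    let (_ , Q , _ , _ , eq' , v∈d) = rotated P pre eq Jt It' in first-edge-contradiction Q (is-tight Q) eq' v∈d)
    where
    is-tight : ∀ {u v} (P : LP u v) → Tight P
    is-tight P with long-cases P 3<L
    ... | inj₁ g = ⊥-elim (¬good g)
    ... | inj₂ (2≤a , 2≤b) with good-or-tight P 2≤a 2≤b
    ...   | inj₁ g = ⊥-elim (¬good g)
    ...   | inj₂ T = T

-- Opening cycles at a vertex, and the component filled by a cycle of L + 1 edges

module Cycles {n m : ℕ} (N : Fin m → Subset n) (ρ : ℕ) (2≤ρ : 2 ≤ ρ)
  (unif : ∀ {e v} → v ∈ N e → ∣ N e ∣ ≡ suc ρ)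
  (dist : ∀ {e e' v} → v ∈ N e → N e ≡ N e' → e ≡ e') where

  open Structure N ρ 2≤ρ unif dist

  turn : ∀ {k z} (c : Cyc k) → z ∈ˡ list c → ∃₂ λ xs y → Trail z xs y × Adj y z × xs ↭ list c
  turn (cyc t a _ _) z∈ with ∈-∃++ z∈
  ... | ys , zs , refl with cut ys t | from ys t
  ...   | inj₁ (refl , refl) | _ = zs' , _ , t , a , ↭-refl
    where zs' = _ ∷ zs
  ...   | inj₂ (y , s , b) | t' = _ , y , join t' a s , b , ++-comm (_ ∷ zs) ys

  -- The cycle without one of its two edges at `v`: a path from `v` through all its vertices, which
  -- the removed edge `f` closes up again.
  record Opening {k} (c : Cyc k) (v : Fin n) : Set where
    constructor opening
    field
      {w}    : Fin n
      {f}    : Fin m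
      {path} : List (Node n m)
      ptrail : Trail (vt v) path (vt w)
      v∈f    : v ∈ N f
      w∈f    : w ∈ N f
      perm   : ed f ∷ path ↭ list c

    punique : Unique (ed f ∷ path)
    punique = unique-↭ (↭-sym perm) (cuniq c)

    psize : suc (length (es path)) ≡ k
    psize = trans (#es-↭ perm) (csize c)

    path⇒list : ∀ {x} → x ∈ˡ path → x ∈ˡ list c
    path⇒list x∈ = ∈-resp-↭ perm (there x∈)

    list⇒path : ∀ {x} → vt x ∈ˡ list c → vt x ∈ˡ path
    list⇒path x∈ with ∈-resp-↭ (↭-sym perm) x∈
    ... | there x∈' = x∈'

    f∈list : ed f ∈ˡ list c
    f∈list = ∈-resp-↭ perm (here refl)

  open-at : ∀ {k v} (c : Cyc k) → vt v ∈ˡ list c → Opening c v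
  open-at c v∈ with turn c v∈
  ... | _ , ed f , a ∷ t , v∈f , p with unsnoc a t
  ...   | zs , vt w , eq , s , w∈f = opening s v∈f w∈f (↭-trans (∷↭∷ʳ (ed f) zs) (↭-trans (↭-reflexive (sym eq)) p))

  -- Going around the cycle in the other direction.
  reopen : ∀ {k v} (c : Cyc k) → 2 ≤ k → (o : Opening c v) → ∃ λ (o' : Opening c v) → Opening.f o ≢ Opening.f o'
  reopen c 2≤k (opening [-] v∈f w∈f p) = ⊥-elim (<⇒≱ 2≤k (≤-reflexive (trans (sym (csize c)) (sym (#es-↭ p)))))
  reopen {v = v} c 2≤k o@(opening {f = f} (_∷_ {y = ed g} v∈g (_∷_ {y = vt x} {ys} x∈g t)) v∈f w∈f p) =
    opening (v∈f ∷ w∈f ∷ rev t) v∈g x∈g (↭-trans perm p) ,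
    λ { refl → Unique[x∷xs]⇒x∉xs (Opening.punique o) (there (here refl)) }
    where
    perm : ed g ∷ vt v ∷ ed f ∷ reverse ys ↭ ed f ∷ vt v ∷ ed g ∷ ys
    perm = ↭-trans (swap-ends (ed g) (vt v) (ed f)) (↭-prep _ (↭-prep _ (↭-prep _ (↭-reverse ys))))

  some-vertex : ∀ {k} (c : Cyc k) → ∃ λ v → vt v ∈ˡ list c
  some-vertex (cyc {first = vt v} t a _ _) = v , start∈ t
  some-vertex (cyc {first = ed e} {last = vt v} t a _ _) = v , end∈ t

  vertices : ∀ {k} → Cyc k → Subset n
  vertices c = ⟪ (λ v → vt v ∈ˡ? list c) ⟫

  module _ {k} (c : Cyc k) where

    ∈-vertices⁺ : ∀ {v} → vt v ∈ˡ list c → v ∈ vertices c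
    ∈-vertices⁺ = ∈⟪⟫⁺ (λ v → vt v ∈ˡ? list c)

    ∈-vertices⁻ : ∀ {v} → v ∈ vertices c → vt v ∈ˡ list c
    ∈-vertices⁻ = ∈⟪⟫⁻ (λ v → vt v ∈ˡ? list c)

    ∣vertices∣ : ∣ vertices c ∣ ≡ k
    ∣vertices∣ = ≤-antisym
      (≤-trans (∣p∣≤length (vertices c) (vs path) (∈vs⁺ ∘ list⇒path ∘ ∈-vertices⁻)) (≤-reflexive #))
      (≤-trans (≤-reflexive (sym #)) (length≤∣p∣ (vertices c) (vs-unique (unique-tail punique)) (∈-vertices⁺ ∘ path⇒list ∘ ∈vs⁻)))
      where
      open Opening (open-at c (proj₂ (some-vertex c)))
      # : length (vs path) ≡ k
      # = trans (#vs ptrail) psize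

  module _ (L : ℕ) (1≤L : 1 ≤ L)
    (longest : ∀ {u xs v} → Trail (vt u) xs (vt v) → Unique xs → length (es xs) ≤ L) where

    open Longest L longest

    module _ (c : Cyc (suc L)) where

      opening-LP : ∀ {v} → v ∈ vertices c → ∃ λ w → LP v w
      opening-LP v∈ = Opening.w o , lp (Opening.ptrail o) (unique-tail (Opening.punique o)) (suc-injective (Opening.psize o))
        where o = open-at c (∈-vertices⁻ c v∈)

      -- An edge leaving the cycle at `x` would allow a path to start at `x`, enter through `e` and
      -- run around with L + 1 edges in all, whether `e` is on the cycle or not.
      closed : ∀ {e} → Meets (vertices c) e → N e ⊆ vertices c
      closed {e} (v , v∈ , v∈e) {x} x∈e = ∈-vertices⁺ c (decidable-stable (vt x ∈ˡ? list c) absurd)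
        where
        absurd : ¬ (vt x ∉ˡ list c)
        absurd x∉ with ed e ∈ˡ? list c
        ... | yes e∈ with turn c e∈
        ...   | xs , vt y , t , _ , p = <⇒≱ (≤-reflexive (trans (sym (csize c)) (sym (#es-↭ p))))
                (longest (x∈e ∷ t) (unique-∷ (λ x∈ → x∉ (∈-resp-↭ p x∈)) (unique-↭ (↭-sym p) (cuniq c))))
        absurd x∉ | no e∉ = <⇒≱ (≤-reflexive (sym psize))
            (longest (x∈e ∷ v∈e ∷ ptrail)
              (unique-∷ (λ { (here ()) ; (there x∈) → x∉ (path⇒list x∈) }) (unique-∷ (e∉ ∘ path⇒list) (unique-tail punique))))
          where open Opening (open-at c (∈-vertices⁻ c v∈))

      many : suc L ≤ ∣ E (vertices c) ∣
      many = ≤-trans (≤-reflexive (sym (csize c)))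
        (length≤∣p∣ (E (vertices c)) (es-unique (cuniq c)) λ e∈ → ∈⟪⟫⁺ (meets? (vertices c)) (meet (turn c (∈es⁻ e∈))))
        where
        meet : ∀ {e} → (∃₂ λ xs y → Trail (ed e) xs y × Adj y (ed e) × xs ↭ list c) → Meets (vertices c) e
        meet (xs , vt y , t , y∈e , p) = y , ∈-vertices⁺ c (∈-resp-↭ p (end∈ t)) , y∈e

      few-edges : ∣ E (vertices c) ∣ ≤ suc L C suc ρ
      few-edges = begin
        ∣ E (vertices c) ∣             ≤⟨ ∣p∣≤length (E (vertices c)) F (λ {e} e∈ → ∈-filter⁺ (meets? (vertices c)) (∈-allFin e) (∈⟪⟫⁻ (meets? (vertices c)) e∈)) ⟩
        length F                       ≡⟨ length-map N F ⟨
        length (map N F)               ≤⟨ family≤C (vertices c) (suc ρ) (map N F) (edge-sets-unique (filter⁺ (meets? (vertices c)) {allFin m} (allFin⁺ m)) λ e∈ → let (v , _ , v∈e) = meet e∈ in v , v∈e) prop ⟩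
        ∣ vertices c ∣ C suc ρ         ≡⟨ cong (_C suc ρ) (∣vertices∣ c) ⟩
        suc L C suc ρ                  ∎
        where
        open ≤-Reasoning
        F = filter (meets? (vertices c)) (allFin m)
        meet : ∀ {e} → e ∈ˡ F → Meets (vertices c) e
        meet e∈ = proj₂ (∈-filter⁻ (meets? (vertices c)) {xs = allFin m} e∈)
        prop : ∀ {p} → p ∈ˡ map N F → p ⊆ vertices c × ∣ p ∣ ≡ suc ρ
        prop p∈ with ∈-map⁻ N p∈
        ... | e , e∈ , refl = closed (meet e∈) , unif (proj₂ (proj₂ (meet e∈)))

      -- The cycle has L + 1 ≥ 2 distinct edges inside its L + 1 vertices; with L < r there would be
      -- room for at most one edge.
      big-L : ρ < L
      big-L = ≰⇒> λ L≤ρ → <⇒≱ (s≤s 1≤L) (≤-trans many (≤-trans few-edges (small L≤ρ)))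
        where
        small : L ≤ ρ → suc L C suc ρ ≤ 1
        small L≤ρ = ≤-trans (C-mono (suc ρ) (s≤s L≤ρ)) (≤-reflexive (nCn≡1 (suc ρ)))

      cycle-good : Good
      cycle-good = good (vertices c) (proj₁ (some-vertex c) , ∈-vertices⁺ c (proj₂ (some-vertex c))) opening-LP
        (subst₂ (λ d k → d * ∣ E S ∣ ≤ k * ∣ S ∣) (sym den≡) (sym num≡) (begin
          suc ρ * ∣ E S ∣             ≤⟨ *-monoʳ-≤ (suc ρ) few-edges ⟩
          suc ρ * (suc L C suc ρ)     ≡⟨ exact ⟩
          (L C ρ) * ∣ S ∣             ∎))
        λ all h → inj₂ (trans
          (≤-antisym few-edges (*-cancelˡ-≤ (suc ρ) (≤-trans (≤-reflexive exact) (subst₂ (λ d k → k * ∣ S ∣ ≤ d * ∣ E S ∣) den≡ num≡ h))))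
          (cong (_C suc ρ) (trans (sym (∣vertices∣ c)) (trans (cong ∣_∣ (⊆-antisym ⊆⊤ (λ {x} _ → all x))) (∣⊤∣≡n n)))))
        where
        open ≤-Reasoning
        S = vertices c
        num≡ = proj₁ (num-den-big 2≤ρ big-L)
        den≡ = proj₂ (num-den-big 2≤ρ big-L)
        exact : suc ρ * (suc L C suc ρ) ≡ (L C ρ) * ∣ S ∣
        exact = trans (absorb L ρ) (trans (*-comm (suc L) (L C ρ)) (cong ((L C ρ) *_) (sym (∣vertices∣ c))))

-- Longest paths of length 2 to r: a cycle with L edges

module ShortPaths {n m : ℕ} (N : Fin m → Subset n) (ρ : ℕ) (2≤ρ : 2 ≤ ρ)
  (unif : ∀ {e v} → v ∈ N e → ∣ N e ∣ ≡ suc ρ)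
  (dist : ∀ {e e' v} → v ∈ N e → N e ≡ N e' → e ≡ e')
  (L : ℕ) (2≤L : 2 ≤ L) (L≤1+ρ : L ≤ suc ρ)
  (longest : ∀ {u xs v} → Incidence.Trail N (vt u) xs (vt v) → Unique xs → length (es xs) ≤ L)
  (acyclic : ¬ Structure.Cyc N ρ 2≤ρ unif dist (suc L)) where

  open Structure N ρ 2≤ρ unif dist
  open Cycles N ρ 2≤ρ unif dist

  1≤L : 1 ≤ L
  1≤L = <⇒≤ 2≤L

  open Longest L longest

  -- The bound on the number of edges to be proved, in the two cases L ≤ r - 1 and L = r.
  Sparse : Subset n → Set
  Sparse S = (L ≤ ρ → suc (suc ρ) * ∣ E S ∣ ≤ L * ∣ S ∣) × (L ≡ suc ρ → ∣ E S ∣ ≤ ∣ S ∣)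

  -- The second half of `Sparse` has no factor because f_r(r) = (1/r) C(r, r-1) = 1.
  sparse⇒few : ∀ {S} → Sparse S → den ρ L * ∣ E S ∣ ≤ num ρ L * ∣ S ∣
  sparse⇒few {S} (short , long) with m≤n⇒m<n∨m≡n L≤1+ρ
  ... | inj₁ (s≤s L≤ρ) = subst₂ (λ d k → d * ∣ E S ∣ ≤ k * ∣ S ∣)
    (sym (proj₂ (num-den-mid 2≤L L≤ρ))) (sym (proj₁ (num-den-mid 2≤L L≤ρ))) (short L≤ρ)
  ... | inj₂ L≡ = subst₂ (λ d k → d * ∣ E S ∣ ≤ k * ∣ S ∣)
    (sym (proj₂ nd)) (sym (trans (proj₁ nd) (trans (cong (_C ρ) L≡) ([1+n]Cn≡1+n ρ)))) (*-monoʳ-≤ (suc ρ) (long L≡))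
    where nd = num-den-big 2≤ρ (≤-reflexive (sym L≡))

  sparse-good : ∀ S {x} → Nonempty S → (∀ {v} → v ∈ S → ∃ λ w → LP v w) → Sparse S → x ∉ S → Good
  sparse-good S ne ends sparse x∉ = good S ne ends (sparse⇒few sparse) λ all _ → ⊥-elim (x∉ (all _))

  module LCycle (c : Cyc L) where

    W = vertices c

    -- Otherwise the path x, e, w, … along the cycle, of length L, could be extended or closed up by the last cycle edge f.
    inside-W : ∀ {w e x} → w ∈ N e → ed e ∉ˡ list c → x ∈ N e → x ∉ W → (o : Opening c w) → N (Opening.f o) ⊆ W
    inside-W {w} {e} {x} w∈e e∉ x∈e x∉ o {y} y∈f = in-path y∈f (revLP-∈ P (extension (revLP P) (f∉ ∘ revLP-∈ P , w∈f) y∈f))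
      where
      open Opening o renaming (w to w')
      P : LP x w'
      P = lp (x∈e ∷ w∈e ∷ ptrail) (unique-∷ (λ { (here ()) ; (there x∈) → x∉ (∈-vertices⁺ c (path⇒list x∈)) })
        (unique-∷ (e∉ ∘ path⇒list) (unique-tail punique))) psize
      f∉ : ed f ∉ˡ vt x ∷ ed e ∷ path
      f∉ (there (here refl)) = e∉ f∈list
      f∉ (there (there f∈)) = Unique[x∷xs]⇒x∉xs punique f∈
      in-path : ∀ {z} → z ∈ N f → vt z ∈ˡ vt x ∷ ed e ∷ path → z ∈ W
      in-path _ (there (there z∈)) = ∈-vertices⁺ c (path⇒list z∈)
      in-path x∈f (here refl) = ⊥-elim (acyclic (chord-cycle P (f∉ , x∈f) w∈f))

    -- W has only L ≤ r vertices. Edges being distinct, at most one of them can then lie inside W,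
    -- and `not-both` exploits this.
    fills-W : ∀ {e v} → v ∈ N e → N e ⊆ W → N e ≡ W
    fills-W v∈e e⊆W = p⊆q∧∣q∣≤∣p∣⇒p≡q e⊆W (≤-trans (≤-reflexive (∣vertices∣ c)) (≤-trans L≤1+ρ (≤-reflexive (sym (unif v∈e)))))

    not-both : ∀ {w} (o : Opening c w) → N (Opening.f o) ⊆ W → N (Opening.f (proj₁ (reopen c 2≤L o))) ⊆ W → Absurd
    not-both o f⊆ g⊆ = proj₂ (reopen c 2≤L o)
      (dist (Opening.v∈f o) (trans (fills-W (Opening.v∈f o) f⊆) (sym (fills-W (Opening.v∈f (proj₁ (reopen c 2≤L o))) g⊆))))

    -- If `e` left W, `inside-W` would force both cycle edges at `w` into W.
    chord : ∀ {e} → Meets W e → ed e ∉ˡ list c → N e ⊆ W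
    chord (w , w∈ , w∈e) e∉ {x} x∈e = decidable-stable (x ∈? W) λ x∉ →
      let o = open-at c (∈-vertices⁻ c w∈)
      in not-both o (inside-W w∈e e∉ x∈e x∉ o) (inside-W w∈e e∉ x∈e x∉ (proj₁ (reopen c 2≤L o)))

    -- Run around the cycle from `w` and leave through its last edge `f`. By `not-both` this works
    -- at every vertex of the cycle in at least one direction.
    leave : ∀ {w} (o : Opening c w) → ¬ (N (Opening.f o) ⊆ W) → ∃ λ x → LP w x
    leave o f⊈ with ⊈⇒∃ f⊈
    ... | x , x∈f , x∉ = x , lp (join ptrail w∈f (x∈f ∷ [-]))
      (unique-↭ (↭-sym perm') (unique-∷ (λ x∈ → x∉ (∈-vertices⁺ c (∈-resp-↭ perm x∈))) punique))
      (trans (#es-↭ perm') psize)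
      where
      open Opening o
      perm' : path ++ ed f ∷ vt x ∷ [] ↭ vt x ∷ ed f ∷ path
      perm' = ↭-trans (++-comm path (ed f ∷ vt x ∷ [])) (Perm.swap _ _ ↭-refl)

    S = ⟪ (λ v → any? λ e → (ed e ∈ˡ? list c) ×-dec (v ∈? N e)) ⟫

    ∈S⁺ : ∀ {v e} → ed e ∈ˡ list c → v ∈ N e → v ∈ S
    ∈S⁺ e∈ v∈e = ∈⟪⟫⁺ (λ v → any? λ e → (ed e ∈ˡ? list c) ×-dec (v ∈? N e)) (_ , e∈ , v∈e)

    ∈S⁻ : ∀ {v} → v ∈ S → ∃ λ e → ed e ∈ˡ list c × v ∈ N e
    ∈S⁻ = ∈⟪⟫⁻ (λ v → any? λ e → (ed e ∈ˡ? list c) ×-dec (v ∈? N e))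

    enter : ∀ {v} → v ∈ S → v ∉ W → ∃ λ w → Σ (LP v w) λ P → ∃ λ xs → nodes P ≡ vt v ∷ xs × xs ↭ list c
    enter v∈ v∉ with ∈S⁻ v∈
    ... | e , e∈ , v∈e with turn c e∈
    ...   | xs , vt y , t , _ , p = y , lp (v∈e ∷ t)
        (unique-∷ (λ x∈ → v∉ (∈-vertices⁺ c (∈-resp-↭ p x∈))) (unique-↭ (↭-sym p) (cuniq c))) (trans (#es-↭ p) (csize c)) ,
        xs , refl , p

    ends : ∀ {v} → v ∈ S → ∃ λ w → LP v w
    ends {v} v∈ with v ∈? W
    ... | no v∉ = let (w , P , _) = enter v∈ v∉ in w , P
    ... | yes v∈W with N (Opening.f o) ⊆? W
      where o = open-at c (∈-vertices⁻ c v∈W)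
    ...   | no f⊈ = leave (open-at c (∈-vertices⁻ c v∈W)) f⊈
    ...   | yes f⊆ = leave (proj₁ (reopen c 2≤L o)) (λ g⊆ → not-both o f⊆ g⊆)
      where o = open-at c (∈-vertices⁻ c v∈W)

    -- Suppose `e` is off the cycle and meets S at `v` outside W. The longest path that enters the
    -- cycle from `v` contains all of `e`, so `e` has another vertex in W, and `chord` puts `e` and
    -- with it `v` into W.
    edges-at-S : ∀ {e} → Meets S e → ed e ∈ˡ list c ⊎ (ed e ∉ˡ list c × N e ≡ W)
    edges-at-S {e} (v , v∈ , v∈e) with ed e ∈ˡ? list c
    ... | yes e∈ = inj₁ e∈
    ... | no e∉ with v ∈? W
    ...   | yes v∈W = inj₂ (e∉ , fills-W v∈e (chord (v , v∈W , v∈e) e∉))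
    ...   | no v∉ with enter v∈ v∉ | other-vertex v∈e v
    ...     | w , P , xs , eq , p | x , x∈e , x≢v = ⊥-elim (v∉ (chord (x , x∈W , x∈e) e∉ v∈e))
      where
      e∉P : ed e ∉ˡ nodes P
      e∉P e∈ with subst (ed e ∈ˡ_) eq e∈
      ... | there e∈xs = e∉ (∈-resp-↭ p e∈xs)
      x∈W : x ∈ W
      x∈W with subst (vt x ∈ˡ_) eq (extension P (e∉P , v∈e) x∈e)
      ... | here refl = ⊥-elim (x≢v refl)
      ... | there x∈xs = ∈-vertices⁺ c (∈-resp-↭ p x∈xs)

    -- S contains two distinct r-sets, namely two edges of the cycle. This is the r + 1 in the
    -- denominator of f_r.
    2+ρ≤∣S∣ : suc (suc ρ) ≤ ∣ S ∣
    2+ρ≤∣S∣ = ≰⇒> λ small → o≢ (dist v∈f (trans (whole v∈f f∈list small) (sym (whole (Opening.v∈f o') (Opening.f∈list o') small))))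
      where
      o = open-at c (proj₂ (some-vertex c))
      o' = proj₁ (reopen c 2≤L o)
      o≢ = proj₂ (reopen c 2≤L o)
      open Opening o
      whole : ∀ {v e} → v ∈ N e → ed e ∈ˡ list c → ∣ S ∣ ≤ suc ρ → N e ≡ S
      whole v∈e e∈ small = p⊆q∧∣q∣≤∣p∣⇒p≡q (∈S⁺ e∈) (≤-trans small (≤-reflexive (sym (unif v∈e))))

    meets : ∀ {e} → e ∈ E S → Meets S e
    meets = ∈⟪⟫⁻ (meets? S)

    short-bound : L ≤ ρ → ∣ E S ∣ ≤ L
    short-bound L≤ρ = ≤-trans (∣p∣≤length (E S) (es (list c)) λ e∈ → on-cycle (edges-at-S (meets e∈)) (proj₂ (proj₂ (meets e∈))))
      (≤-reflexive (csize c))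
      where
      on-cycle : ∀ {e v} → ed e ∈ˡ list c ⊎ (ed e ∉ˡ list c × N e ≡ W) → v ∈ N e → e ∈ˡ es (list c)
      on-cycle (inj₁ e∈) _ = ∈es⁺ e∈
      on-cycle (inj₂ (_ , e≡W)) v∈e = ⊥-elim (<⇒≱ (s≤s L≤ρ)
        (≤-reflexive (trans (sym (unif v∈e)) (trans (cong ∣_∣ e≡W) (∣vertices∣ c)))))

    long-bound : ∣ E S ∣ ≤ suc L
    long-bound with any? (λ e → meets? W e ×-dec ¬? (ed e ∈ˡ? list c))
    ... | no none = ≤-trans (∣p∣≤length (E S) (es (list c)) λ e∈ → on-cycle (edges-at-S (meets e∈)) (proj₂ (proj₂ (meets e∈))))
      (≤-trans (≤-reflexive (csize c)) (n≤1+n L))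
      where
      on-cycle : ∀ {e v} → ed e ∈ˡ list c ⊎ (ed e ∉ˡ list c × N e ≡ W) → v ∈ N e → e ∈ˡ es (list c)
      on-cycle (inj₁ e∈) _ = ∈es⁺ e∈
      on-cycle (inj₂ (e∉ , e≡W)) v∈e = ⊥-elim (none (_ , (_ , subst (_ ∈_) e≡W v∈e , v∈e) , e∉))
    ... | yes (g , mg@(w , w∈ , w∈g) , g∉) = ≤-trans (∣p∣≤length (E S) (g ∷ es (list c)) λ e∈ → on-cycle (edges-at-S (meets e∈)) (proj₂ (proj₂ (meets e∈))))
      (≤-reflexive (cong suc (csize c)))
      where
      on-cycle : ∀ {e v} → ed e ∈ˡ list c ⊎ (ed e ∉ˡ list c × N e ≡ W) → v ∈ N e → e ∈ˡ g ∷ es (list c)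
      on-cycle (inj₁ e∈) _ = there (∈es⁺ e∈)
      on-cycle (inj₂ (e∉ , e≡W)) v∈e = here (dist v∈e (trans e≡W (sym (fills-W w∈g (chord mg g∉)))))

    sparse : Sparse S
    sparse = (λ L≤ρ → begin
        suc (suc ρ) * ∣ E S ∣    ≤⟨ *-mono-≤ 2+ρ≤∣S∣ (short-bound L≤ρ) ⟩
        ∣ S ∣ * L                ≡⟨ *-comm ∣ S ∣ L ⟩
        L * ∣ S ∣                ∎) ,
      λ L≡ → ≤-trans long-bound (≤-trans (s≤s (≤-reflexive L≡)) 2+ρ≤∣S∣)
      where open ≤-Reasoning

    L-cycle-good : Good
    L-cycle-good = good S (_ , ∈S⁺ f∈list v∈f) ends (sparse⇒few sparse) concl
      where
      open Opening (open-at c (proj₂ (some-vertex c)))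
      open ≤-Reasoning
      concl : (∀ v → v ∈ S) → num ρ L * ∣ S ∣ ≤ den ρ L * ∣ E S ∣ → Concl ∣ E S ∣
      concl all h with m≤n⇒m<n∨m≡n L≤1+ρ
      -- Equality makes both factors of the bound tight: |S| = r + 1 and |E S| = L.
      ... | inj₁ (s≤s L≤ρ) = inj₁ (trans n≡∣S∣ ∣S∣≡ , subst (λ k → 2 ≤ k × k ≤ ρ) (sym ∣E∣≡L) (2≤L , L≤ρ))
        where
        n≡∣S∣ : n ≡ ∣ S ∣
        n≡∣S∣ = trans (sym (∣⊤∣≡n n)) (cong ∣_∣ (⊆-antisym (λ {x} _ → all x) ⊆⊤))
        h' : L * ∣ S ∣ ≤ suc (suc ρ) * ∣ E S ∣
        h' = subst₂ (λ d k → k * ∣ S ∣ ≤ d * ∣ E S ∣) (proj₂ (num-den-mid 2≤L L≤ρ)) (proj₁ (num-den-mid 2≤L L≤ρ)) h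
        ∣S∣≡ : ∣ S ∣ ≡ suc (suc ρ)
        ∣S∣≡ = ≤-antisym (*-cancelʳ-≤ _ _ L ⦃ >-nonZero 1≤L ⦄ (begin
          ∣ S ∣ * L               ≡⟨ *-comm ∣ S ∣ L ⟩
          L * ∣ S ∣               ≤⟨ h' ⟩
          suc (suc ρ) * ∣ E S ∣   ≤⟨ *-monoʳ-≤ (suc (suc ρ)) (short-bound L≤ρ) ⟩
          suc (suc ρ) * L         ∎)) 2+ρ≤∣S∣
        ∣E∣≡L : ∣ E S ∣ ≡ L
        ∣E∣≡L = ≤-antisym (short-bound L≤ρ) (*-cancelˡ-≤ (suc (suc ρ)) (begin
          suc (suc ρ) * L         ≡⟨ *-comm (suc (suc ρ)) L ⟩
          L * suc (suc ρ)         ≡⟨ cong (L *_) ∣S∣≡ ⟨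
          L * ∣ S ∣               ≤⟨ h' ⟩
          suc (suc ρ) * ∣ E S ∣   ∎))
      ... | inj₂ L≡ = inj₂ (trans ∣E∣≡ (sym (trans (cong (_C suc ρ) n≡) ([1+n]Cn≡1+n (suc ρ)))))
        where
        nd = num-den-big 2≤ρ (≤-reflexive (sym L≡))
        n≡∣S∣ : n ≡ ∣ S ∣
        n≡∣S∣ = trans (sym (∣⊤∣≡n n)) (cong ∣_∣ (⊆-antisym (λ {x} _ → all x) ⊆⊤))
        ∣S∣≤∣E∣ : ∣ S ∣ ≤ ∣ E S ∣
        ∣S∣≤∣E∣ = *-cancelˡ-≤ (suc ρ) (subst₂ (λ d k → k * ∣ S ∣ ≤ d * ∣ E S ∣)
          (proj₂ nd) (trans (proj₁ nd) (trans (cong (_C ρ) L≡) ([1+n]Cn≡1+n ρ))) h)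
        ∣E∣≤2+ρ : ∣ E S ∣ ≤ suc (suc ρ)
        ∣E∣≤2+ρ = ≤-trans long-bound (s≤s L≤1+ρ)
        ∣E∣≡ : ∣ E S ∣ ≡ suc (suc ρ)
        ∣E∣≡ = ≤-antisym ∣E∣≤2+ρ (≤-trans 2+ρ≤∣S∣ ∣S∣≤∣E∣)
        n≡ : n ≡ suc (suc ρ)
        n≡ = trans n≡∣S∣ (≤-antisym (≤-trans ∣S∣≤∣E∣ ∣E∣≤2+ρ) 2+ρ≤∣S∣)

-- Longest paths of length 2 to r: no cycle with L edges

module DualPaths {n m : ℕ} (N : Fin m → Subset n) (ρ : ℕ) (2≤ρ : 2 ≤ ρ)
  (unif : ∀ {e v} → v ∈ N e → ∣ N e ∣ ≡ suc ρ)
  (dist : ∀ {e e' v} → v ∈ N e → N e ≡ N e' → e ≡ e')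
  (L : ℕ) (2≤L : 2 ≤ L) (L≤1+ρ : L ≤ suc ρ)
  (longest : ∀ {u xs v} → Incidence.Trail N (vt u) xs (vt v) → Unique xs → length (es xs) ≤ L)
  (acyclic : ¬ Structure.Cyc N ρ 2≤ρ unif dist (suc L))
  (no-L-cycle : ¬ Structure.Cyc N ρ 2≤ρ unif dist L) where

  open Structure N ρ 2≤ρ unif dist
  open Cycles N ρ 2≤ρ unif dist
  open ShortPaths N ρ 2≤ρ unif dist L 2≤L L≤1+ρ longest acyclic
  open Longest L longest
  module Long = LongPaths N ρ 2≤ρ unif dist L 1≤L longest acyclic
  open Acyclic acyclic using (#nb+#nb≤L)

  -- Nondefining edges at both ends would require 2(r - 1) ≤ L ≤ r, impossible for r ≥ 3; with none
  -- at `v`, `one-sided` applies to the reversed path.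
  outside-good : ∀ {u v} (P : LP u v) → ∃ (Outside (nodes P) u) → Good
  outside-good {u} {v} P o with Long.some-outside? (nodes P) v
  ... | no none = Long.one-sided (revLP P) (none ∘ Long.rev-outside P) (Long.outside-rev P o)
  ... | yes o' = ⊥-elim (<⇒≱ 2≤ρ (+-cancelʳ-≤ ρ ρ 1 (≤-trans
    (+-mono-≤ (outside⇒ρ≤#nb (proj₂ o)) (outside⇒ρ≤#nb (proj₂ o'))) (≤-trans (#nb+#nb≤L P) L≤1+ρ))))

  -- A longest path without its two end vertices.
  record DP (e e' : Fin m) : Set where
    constructor dp
    field
      {w w'} : Fin n
      {inner} : List (Node n m)
      itrail : Trail (vt w) inner (vt w')
      w∈e    : w ∈ N e
      w'∈e'  : w' ∈ N e'
      duniq  : Unique (ed e ∷ ed e' ∷ inner)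
      dsize  : 2 + length (es inner) ≡ L

  dual : ∀ {u v} → LP u v → ∃₂ λ e e' → DP e e'
  dual (lp [-] _ sz) = ⊥-elim (<⇒≱ 1≤L (≤-trans (≤-reflexive (sym sz)) z≤n))
  dual (lp (_∷_ {y = ed e} _ (_∷_ {y = vt w} _ [-])) _ sz) = ⊥-elim (<⇒≱ 2≤L (≤-reflexive (sym sz)))
  dual {u} {v} (lp (_∷_ {y = ed e} _ (_∷_ {y = vt w} w∈e (c ∷ t))) uq sz) with unsnoc c t
  ... | _ , ed e' , eq , d ∷ t' , _ with unsnoc d t'
  ...   | inner , vt w' , eq' , s , w'∈e' = e , e' , dp s w∈e w'∈e' (unique-tail (unique-tail (unique-↭ p uq)))
          (trans (sym (#es-↭ p)) sz)
    where
    perm : ∀ {l v} → l ≡ (inner ∷ʳ ed e') ∷ʳ vt v → vt u ∷ ed e ∷ l ↭ vt u ∷ vt v ∷ ed e ∷ ed e' ∷ inner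
    perm {v = v} refl = ↭-prep _ (↭-trans (↭-prep _ (↭-sym (↭-trans (↭-prep (vt v) (∷↭∷ʳ (ed e') inner)) (∷↭∷ʳ (vt v) (inner ∷ʳ ed e')))))
      (Perm.swap _ _ ↭-refl))
    p = perm (trans eq (cong (_∷ʳ vt v) eq'))

  revDP : ∀ {e e'} → DP e e' → DP e' e
  revDP {e} {e'} (dp {inner = ys} t w∈e w'∈e' uq sz) = dp (rev t) w'∈e' w∈e
    (unique-↭ (Perm.swap _ _ (↭-sym (↭-reverse ys))) uq) (trans (cong (2 +_) (#es-↭ (↭-reverse ys))) sz)

  -- By `outside-good` the assumption holds as long as there is no good set. It means that all edges
  -- at an end of a longest path are defining edges of that path.
  module Ends (closed-ends : ∀ {u v} (P : LP u v) → ¬ ∃ (Outside (nodes P) u)) where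

    module _ {e e'} (D : DP e e') where
      open DP D

      I : Subset n
      I = ⟪ (λ v → vt v ∈ˡ? inner) ⟫

      ∈I⁺ : ∀ {v} → vt v ∈ˡ inner → v ∈ I
      ∈I⁺ = ∈⟪⟫⁺ (λ v → vt v ∈ˡ? inner)

      ∈I⁻ : ∀ {v} → v ∈ I → vt v ∈ˡ inner
      ∈I⁻ = ∈⟪⟫⁻ (λ v → vt v ∈ˡ? inner)

      ∣I∣<L : ∣ I ∣ < L
      ∣I∣<L = ≤-trans (s≤s (≤-trans (∣p∣≤length I (vs inner) (∈vs⁺ ∘ ∈I⁻)) (≤-reflexive (#vs itrail)))) (≤-reflexive dsize)

      -- A common vertex `x` off the inner path would close it to the cycle x e w ... w' e' with L
      -- edges.
      disjoint : ∀ {x} → x ∈ N e → x ∈ N e' → x ∈ I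
      disjoint {x} x∈e x∈e' = decidable-stable (x ∈? I) λ x∉ → no-L-cycle
        (cyc (x∈e ∷ w∈e ∷ join itrail w'∈e' [-]) x∈e' (unique-↭ (↭-sym perm) (unique-∷ (out x∉) duniq)) (trans (#es-↭ perm) dsize))
        where
        perm : vt x ∷ ed e ∷ inner ++ ed e' ∷ [] ↭ vt x ∷ ed e ∷ ed e' ∷ inner
        perm = ↭-prep _ (↭-prep _ (++-comm inner (ed e' ∷ [])))
        out : x ∉ I → vt x ∉ˡ ed e ∷ ed e' ∷ inner
        out x∉ (there (there x∈)) = x∉ (∈I⁺ x∈)

      end-vertex : ∃ λ y → y ∈ N e' × y ∉ I
      end-vertex = ⊈⇒∃ λ e'⊆I → <⇒≱ (≤-trans ∣I∣<L L≤1+ρ) (edge⊆⇒≤ w'∈e' e'⊆I)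

      full-path : ∀ {x} → x ∈ N e → x ∉ I → ∃ λ y → Σ (LP x y) λ P → ∀ {f} → ed f ∈ˡ nodes P → f ∈ˡ e ∷ e' ∷ es inner
      full-path {x} x∈e x∉ = y , lp (x∈e ∷ w∈e ∷ join itrail w'∈e' (y∈e' ∷ [-]))
        (unique-↭ (↭-sym perm) (unique-∷ x-out (unique-∷ y-out duniq))) (trans (#es-↭ perm) dsize) ,
        λ f∈ → edges (∈-resp-↭ perm f∈)
        where
        y = proj₁ end-vertex
        y∈e' = proj₁ (proj₂ end-vertex)
        y∉ = proj₂ (proj₂ end-vertex)
        perm : vt x ∷ ed e ∷ inner ++ ed e' ∷ vt y ∷ [] ↭ vt x ∷ vt y ∷ ed e ∷ ed e' ∷ inner
        perm = ↭-prep _ (↭-trans (↭-prep _ (++-comm inner (ed e' ∷ vt y ∷ [])))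
          (↭-trans (↭-prep _ (Perm.swap _ _ ↭-refl)) (Perm.swap _ _ ↭-refl)))
        y-out : vt y ∉ˡ ed e ∷ ed e' ∷ inner
        y-out (there (there y∈)) = y∉ (∈I⁺ y∈)
        x-out : vt x ∉ˡ vt y ∷ ed e ∷ ed e' ∷ inner
        x-out (here refl) = x∉ (disjoint x∈e y∈e')
        x-out (there (there (there x∈))) = x∉ (∈I⁺ x∈)
        edges : ∀ {f} → ed f ∈ˡ vt x ∷ vt y ∷ ed e ∷ ed e' ∷ inner → f ∈ˡ e ∷ e' ∷ es inner
        edges (there (there f∈)) = ∈es⁺ f∈

      end-edges : ∀ {x f} → x ∈ N e → x ∉ I → x ∈ N f → f ∈ˡ e ∷ e' ∷ es inner
      end-edges {f = f} x∈e x∉ x∈f =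
        let (_ , P , edges) = full-path x∈e x∉
        in edges (decidable-stable (ed f ∈ˡ? nodes P) λ f∉ → closed-ends P (f , f∉ , x∈f))

    module _ {e e'} (D : DP e e') where
      open DP D

      -- Every vertex of `e` or `e'` off the inner path is an end of a longest path with the same L
      -- edges. There are at least 2r - L of these vertices, hence at least r + 1 if L < r and at
      -- least r if L = r.
      spread-good : ∣ N e ∩ I D ∣ + ∣ N e' ∩ I D ∣ ≤ L → Good
      spread-good b+b'≤L = sparse-good S (x , x∈p∪q⁺ (inj₁ (x∈p∧x∉q⇒x∈p─q x∈e x∉I)))
        (λ v∈ → ends (cases v∈))
        ((λ L≤ρ → ≤-trans (*-mono-≤ (+-cancelˡ-≤ ρ _ _ (≤-trans (≤-reflexive (sym (rotate-sucs ρ))) (≤-trans total (≤-trans (+-monoʳ-≤ ∣ S ∣ L≤ρ) (≤-reflexive (+-comm ∣ S ∣ ρ)))))) ∣E∣≤L) (≤-reflexive (*-comm ∣ S ∣ L))) ,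
         λ L≡ → ≤-trans ∣E∣≤L (≤-trans (≤-reflexive L≡) (+-cancelʳ-≤ (suc ρ) _ _ (≤-trans total (+-monoʳ-≤ ∣ S ∣ (≤-reflexive L≡))))))
        w∉S
        where
        S = (N e ─ I D) ∪ (N e' ─ I D)
        rotate-sucs : ∀ ρ → suc ρ + suc ρ ≡ ρ + suc (suc ρ)
        rotate-sucs ρ = sym (+-suc ρ (suc ρ))
        D' = revDP D
        I⊆I' : ∀ {v} → v ∈ I D → v ∈ I D'
        I⊆I' v∈ = ∈I⁺ D' (∈-resp-↭ (↭-sym (↭-reverse inner)) (∈I⁻ D v∈))
        I'⊆I : ∀ {v} → v ∈ I D' → v ∈ I D
        I'⊆I v∈ = ∈I⁺ D (∈-resp-↭ (↭-reverse inner) (∈I⁻ D' v∈))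
        x = proj₁ (end-vertex D')
        x∈e = proj₁ (proj₂ (end-vertex D'))
        x∉I : x ∉ I D
        x∉I = proj₂ (proj₂ (end-vertex D')) ∘ I⊆I'
        cases : ∀ {v} → v ∈ S → (v ∈ N e ⊎ v ∈ N e') × v ∉ I D
        cases v∈ with x∈p∪q⁻ (N e ─ I D) (N e' ─ I D) v∈
        ... | inj₁ v∈' = inj₁ (p─q⊆p (N e) (I D) v∈') , x∉p─q {p = N e} v∈'
        ... | inj₂ v∈' = inj₂ (p─q⊆p (N e') (I D) v∈') , x∉p─q {p = N e'} v∈'
        ends : ∀ {v} → (v ∈ N e ⊎ v ∈ N e') × v ∉ I D → ∃ λ w → LP v w
        ends (inj₁ v∈e , v∉) = let (y , P , _) = full-path D v∈e v∉ in y , P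
        ends (inj₂ v∈e' , v∉) = let (y , P , _) = full-path D' v∈e' (v∉ ∘ I'⊆I) in y , P
        edges : ∀ {v f} → (v ∈ N e ⊎ v ∈ N e') × v ∉ I D → v ∈ N f → f ∈ˡ e ∷ e' ∷ es inner
        edges (inj₁ v∈e , v∉) v∈f = end-edges D v∈e v∉ v∈f
        edges (inj₂ v∈e' , v∉) v∈f = ∈es-rev (end-edges D' v∈e' (v∉ ∘ I'⊆I) v∈f)
          where
          ∈es-rev : ∀ {f} → f ∈ˡ e' ∷ e ∷ es (reverse inner) → f ∈ˡ e ∷ e' ∷ es inner
          ∈es-rev f∈ = ∈es⁺ (∈-resp-↭ (Perm.swap (ed e') (ed e) (↭-reverse inner)) (∈es⁻ {xs = ed e' ∷ ed e ∷ reverse inner} f∈))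
        ∣E∣≤L : ∣ E S ∣ ≤ L
        ∣E∣≤L = ≤-trans (∣p∣≤length (E S) (e ∷ e' ∷ es inner)
          λ f∈ → let (v , v∈ , v∈f) = ∈⟪⟫⁻ (meets? S) f∈ in edges (cases v∈) v∈f) (≤-reflexive dsize)
        w∉S : w ∉ S
        w∉S w∈ = proj₂ (cases w∈) (∈I⁺ D (start∈ itrail))
        total : suc ρ + suc ρ ≤ ∣ S ∣ + L
        total = begin
          suc ρ + suc ρ      ≡⟨ cong₂ _+_ (unif w∈e) (unif w'∈e') ⟨
          ∣ N e ∣ + ∣ N e' ∣ ≡⟨ cong₂ _+_ (∣p∣≡∣p─q∣+∣p∩q∣ (N e) (I D)) (∣p∣≡∣p─q∣+∣p∩q∣ (N e') (I D)) ⟩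
          (∣ N e ─ I D ∣ + ∣ N e ∩ I D ∣) + (∣ N e' ─ I D ∣ + ∣ N e' ∩ I D ∣)   ≡⟨ interchange ∣ N e ─ I D ∣ _ _ _ ⟩
          (∣ N e ─ I D ∣ + ∣ N e' ─ I D ∣) + (∣ N e ∩ I D ∣ + ∣ N e' ∩ I D ∣)   ≤⟨ +-mono-≤ (disjoint⇒∣p∣+∣q∣≤∣p∪q∣ _ _ disj) b+b'≤L ⟩
          ∣ S ∣ + L          ∎
          where
          open ≤-Reasoning
          disj : ∀ {v} → v ∈ N e ─ I D → v ∉ N e' ─ I D
          disj v∈ v∈' = x∉p─q {p = N e} v∈ (disjoint D (p─q⊆p (N e) (I D) v∈) (p─q⊆p (N e') (I D) v∈'))

      -- The inner path has L - 2 steps. Apart from `w`, the vertices of `e` on it are right ends of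
      -- steps; apart from `w'`, those of `e'` are left ends. More than L in total force a step with
      -- both.
      crossing-triple : ¬ (∣ N e ∩ I D ∣ + ∣ N e' ∩ I D ∣ ≤ L) →
        ∃ λ (t : Fin n × Fin m × Fin n) → let (a , f , x) = t in t ∈ˡ trip inner × x ∈ N e × a ∈ N e'
      crossing-triple b+b'≰L with Any.any? (λ t → (proj₂ (proj₂ t) ∈? N e) ×-dec (proj₁ t ∈? N e')) (trip inner)
      ... | yes h = find h
      ... | no none = ⊥-elim (b+b'≰L (begin
        ∣ N e ∩ I D ∣ + ∣ N e' ∩ I D ∣        ≤⟨ +-mono-≤ b≤ b'≤ ⟩
        suc #A + suc #B                      ≡⟨ cong suc (+-suc #A #B) ⟩
        2 + (#A + #B)                        ≤⟨ s≤s (s≤s (exclusive⇒count A? B? (trip inner) λ t∈ At Bt → none (lose t∈ (At , Bt)))) ⟩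
        2 + length (trip inner)              ≡⟨ cong (2 +_) (#trip itrail) ⟩
        2 + length (es inner)                ≡⟨ dsize ⟩
        L                                    ∎))
        where
        open ≤-Reasoning
        A? : ∀ (t : Fin n × Fin m × Fin n) → Dec (proj₂ (proj₂ t) ∈ N e)
        A? t = proj₂ (proj₂ t) ∈? N e
        B? : ∀ (t : Fin n × Fin m × Fin n) → Dec (proj₁ t ∈ N e')
        B? t = proj₁ t ∈? N e'
        #A = length (filter A? (trip inner))
        #B = length (filter B? (trip inner))
        b≤ : ∣ N e ∩ I D ∣ ≤ suc #A
        b≤ = ≤-trans (∣p∣≤length _ (w ∷ map (proj₂ ∘ proj₂) (filter A? (trip inner))) listed) (≤-reflexive (cong suc (length-map _ (filter A? (trip inner)))))
          where
          listed : ∀ {v} → v ∈ N e ∩ I D → v ∈ˡ w ∷ map (proj₂ ∘ proj₂) (filter A? (trip inner))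
          listed {v} v∈ with x∈p∩q⁻ (N e) (I D) v∈ | v ≟F w
          ... | _ | yes refl = here refl
          ... | v∈e , v∈I | no v≢w = let (_ , _ , t∈) = third∈trip itrail (∈I⁻ D v∈I) v≢w in
            there (∈-map⁺ (proj₂ ∘ proj₂) (∈-filter⁺ A? t∈ v∈e))
        b'≤ : ∣ N e' ∩ I D ∣ ≤ suc #B
        b'≤ = ≤-trans (∣p∣≤length _ (w' ∷ map proj₁ (filter B? (trip inner))) listed) (≤-reflexive (cong suc (length-map _ (filter B? (trip inner)))))
          where
          listed : ∀ {v} → v ∈ N e' ∩ I D → v ∈ˡ w' ∷ map proj₁ (filter B? (trip inner))
          listed {v} v∈ with x∈p∩q⁻ (N e') (I D) v∈ | v ≟F w'
          ... | _ | yes refl = here refl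
          ... | v∈e' , v∈I | no v≢w' = let (_ , _ , t∈) = first∈trip itrail (∈I⁻ D v∈I) v≢w' in
            there (∈-map⁺ proj₁ (∈-filter⁺ B? t∈ v∈e'))

    module OffCycle {K} (c : Cyc K) (1+K≡L : suc K ≡ L) {f} (f∉ : ed f ∉ˡ list c) {w₀} (w₀∈f : w₀ ∈ N f) (w₀∈c : vt w₀ ∈ˡ list c) where

      W S : Subset n
      W = vertices c
      S = N f ─ W

      -- From every vertex of `f` on the cycle, `f` and the opened cycle form a path with L edges
      -- again, so all facts about such paths apply at each of these vertices and in both
      -- directions.
      opening-DP : ∀ {a} → a ∈ N f → (o : Opening c a) → DP f (Opening.f o)
      opening-DP a∈f o = dp ptrail a∈f w∈f (unique-∷ (f∉ ∘ ∈-resp-↭ perm) punique) (trans (cong suc psize) 1+K≡L)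
        where open Opening o

      outer : ∀ {a x} (a∈f : a ∈ N f) (o : Opening c a) → x ∉ W → x ∉ I (opening-DP a∈f o)
      outer a∈f o x∉ x∈ = x∉ (∈-vertices⁺ c (Opening.path⇒list o (∈I⁻ (opening-DP a∈f o) x∈)))

      -- A vertex of S on a cycle edge next to `a` would close a cycle with L edges through `f`.
      apart : ∀ {a x} → a ∈ N f → (o : Opening c a) → x ∈ S → x ∉ N (Opening.f o)
      apart a∈f o x∈S x∈g = outer a∈f o (x∉p─q {p = N f} x∈S) (disjoint (opening-DP a∈f o) (p─q⊆p (N f) W x∈S) x∈g)

      o₀ : Opening c w₀
      o₀ = open-at c w₀∈c

      D₀ = opening-DP w₀∈f o₀

      open Opening o₀ renaming (f to g₀; w to w'; v∈f to w₀∈g₀; w∈f to w'∈g₀)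

      ends : ∀ {x} → x ∈ S → ∃ λ y → LP x y
      ends x∈S = let (y , P , _) = full-path D₀ (p─q⊆p (N f) W x∈S) (outer w₀∈f o₀ (x∉p─q {p = N f} x∈S)) in y , P

      open-before : ∀ {a h y} → (a , h , y) ∈ˡ trip path → ∃ λ (o : Opening c a) → Opening.f o ≡ h
      open-before {a} {h} t∈ with trip-split ptrail t∈
      ... | p , q , eq , tp , a∈h , y∈h , tq = opening (join (rev tp) w₀∈g₀ (w'∈g₀ ∷ rev tq)) a∈h y∈h (↭-trans perm' perm) , refl
        where
        perm' : ed h ∷ reverse p ++ ed g₀ ∷ reverse q ↭ ed g₀ ∷ path
        perm' = ↭-trans (↭-prep _ (↭-trans (reverse-mid-↭ p _ _) (↭-prep _ (++⁺ˡ p (↭-reverse q)))))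
          (↭-trans (Perm.swap _ _ ↭-refl) (↭-prep _ (↭-trans (↭-sym (shift (ed h) p q)) (↭-reflexive (sym eq)))))

      open-after : ∀ {a h y} → (a , h , y) ∈ˡ trip path → ∃ λ (o : Opening c y) → Opening.f o ≡ h
      open-after {a} {h} t∈ with trip-split ptrail t∈
      ... | p , q , eq , tp , a∈h , y∈h , tq = opening (join tq w'∈g₀ (w₀∈g₀ ∷ tp)) y∈h a∈h (↭-trans perm' perm) , refl
        where
        perm' : ed h ∷ q ++ ed g₀ ∷ p ↭ ed g₀ ∷ path
        perm' = ↭-trans (++-comm (ed h ∷ q) (ed g₀ ∷ p)) (↭-prep _ (↭-reflexive (sym eq)))

      Apart : Fin n × Fin m × Fin n → Set
      Apart (a , h , y) = a ∉ N f × y ∉ N f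

      apart? : ∀ t → Dec (Apart t)
      apart? (a , h , y) = ¬? (a ∈? N f) ×-dec ¬? (y ∈? N f)

      off? : ∀ v → Dec (v ∉ N f)
      off? v = ¬? (v ∈? N f)

      #apart #off : List (Node n m) → ℕ
      #apart xs = length (filter apart? (trip xs))
      #off xs = length (filter off? (vs xs))

      -- Edges at S lie on the path of L edges that begins with `f`; by `apart`, a cycle edge among
      -- them has neither of its two neighbours on the cycle in `f`.
      edges : ∀ {h} → Meets S h → h ∈ˡ f ∷ map (proj₁ ∘ proj₂) (filter apart? (trip path))
      edges {h} (x , x∈S , x∈h) with end-edges D₀ (p─q⊆p (N f) W x∈S) (outer w₀∈f o₀ (x∉p─q {p = N f} x∈S)) x∈h
      ... | here refl = here refl
      ... | there (here refl) = ⊥-elim (apart w₀∈f o₀ x∈S x∈h)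
      ... | there (there h∈) with edge∈trip ptrail (∈es⁻ h∈)
      ...   | a , y , t∈ = there (∈-map⁺ (proj₁ ∘ proj₂) (∈-filter⁺ apart? t∈
        ((λ a∈f → let (o , eq) = open-before t∈ in apart a∈f o x∈S (subst (λ g → x ∈ N g) (sym eq) x∈h)) ,
         (λ y∈f → let (o , eq) = open-after t∈ in apart y∈f o x∈S (subst (λ g → x ∈ N g) (sym eq) x∈h)))))

      -- Each maximal run of vertices outside N f contributes one more vertex than edges.
      runs : ∀ {u xs v} → Trail (vt u) xs (vt v) →
        (u ∉ N f → suc (#apart xs) ≤ #off xs) × (u ∈ N f → #apart xs ≡ 0 ⊎ suc (#apart xs) ≤ #off xs)
      runs {u} [-] with u ∈? N f
      ... | yes u∈ = (λ u∉ → ⊥-elim (u∉ u∈)) , λ _ → inj₁ refl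
      ... | no u∉ = (λ _ → ≤-refl) , λ u∈ → ⊥-elim (u∉ u∈)
      runs {u} (_∷_ {y = ed h} _ (_∷_ {y = vt x} _ t)) rewrite trip-∷ u h t with u ∈? N f | x ∈? N f | runs t
      ... | yes u∈ | yes x∈ | _ , ih = (λ u∉ → ⊥-elim (u∉ u∈)) , λ _ → ih x∈
      ... | yes u∈ | no x∉ | ih , _ = (λ u∉ → ⊥-elim (u∉ u∈)) , λ _ → inj₂ (ih x∉)
      ... | no u∉ | no x∉ | ih , _ = (λ _ → s≤s (ih x∉)) , λ u∈ → ⊥-elim (u∉ u∈)
      ... | no u∉ | yes x∈ | _ , ih = (λ _ → bound (ih x∈)) , λ u∈ → ⊥-elim (u∉ u∈)
        where
        bound : ∀ {a b} → a ≡ 0 ⊎ suc a ≤ b → suc a ≤ suc b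
        bound (inj₁ refl) = s≤s z≤n
        bound (inj₂ a<b) = s≤s (<⇒≤ a<b)

      κ = ∣ N f ∩ W ∣

      ∣S∣+κ : ∣ S ∣ + κ ≡ suc ρ
      ∣S∣+κ = trans (sym (∣p∣≡∣p─q∣+∣p∩q∣ (N f) W)) (unif w₀∈f)

      κ≤K : κ ≤ K
      κ≤K = ≤-trans (∣p∩q∣≤∣q∣ (N f) W) (≤-reflexive (∣vertices∣ c))

      K≤ρ : K ≤ ρ
      K≤ρ = s≤s⁻¹ (≤-trans (≤-reflexive 1+K≡L) L≤1+ρ)

      #off+κ≤K : #off path + κ ≤ K
      #off+κ≤K = begin
        #off path + κ                  ≤⟨ +-mono-≤ (length≤∣p∣ (W ─ N f) (filter⁺ off? (vs-unique (unique-tail punique))) off) (p⊆q⇒∣p∣≤∣q∣ flip) ⟩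
        ∣ W ─ N f ∣ + ∣ W ∩ N f ∣      ≡⟨ ∣p∣≡∣p─q∣+∣p∩q∣ W (N f) ⟨
        ∣ W ∣                          ≡⟨ ∣vertices∣ c ⟩
        K                              ∎
        where
        open ≤-Reasoning
        off : ∀ {v} → v ∈ˡ filter off? (vs path) → v ∈ W ─ N f
        off v∈ = let (v∈path , v∉f) = ∈-filter⁻ off? {xs = vs path} v∈ in x∈p∧x∉q⇒x∈p─q (∈-vertices⁺ c (path⇒list (∈vs⁻ v∈path))) v∉f
        flip : N f ∩ W ⊆ W ∩ N f
        flip v∈ = let (v∈f , v∈W) = x∈p∩q⁻ (N f) W v∈ in x∈p∩q⁺ (v∈W , v∈f)

      ∣E∣≤ : ∣ E S ∣ ≤ suc (#apart path)
      ∣E∣≤ = ≤-trans (∣p∣≤length (E S) _ (λ h∈ → edges (∈⟪⟫⁻ (meets? S) h∈)))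
        (≤-reflexive (cong suc (length-map (proj₁ ∘ proj₂) (filter apart? (trip path)))))

      -- At most K - κ vertices of the cycle are off `f`. If any cycle edge meets S, the spare
      -- vertex of a run pays for `f` itself.
      one-or-many : ∣ E S ∣ ≤ 1 ⊎ ∣ E S ∣ + κ ≤ K
      one-or-many with proj₂ (runs ptrail) w₀∈f
      ... | inj₁ none = inj₁ (≤-trans ∣E∣≤ (≤-reflexive (cong suc none)))
      ... | inj₂ le = inj₂ (≤-trans (+-monoˡ-≤ κ (≤-trans ∣E∣≤ le)) #off+κ≤K)

      1≤∣S∣ : 1 ≤ ∣ S ∣
      1≤∣S∣ = +-cancelʳ-≤ ρ 1 ∣ S ∣ (≤-trans (≤-reflexive (sym ∣S∣+κ)) (+-monoʳ-≤ ∣ S ∣ (≤-trans κ≤K K≤ρ)))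

      sparse : Sparse S
      sparse with one-or-many
      ... | inj₁ one = (λ L≤ρ → ≤-trans (*-monoʳ-≤ (suc (suc ρ)) one) (≤-trans (≤-reflexive (*-identityʳ (suc (suc ρ))))
            (subst (λ l → suc (suc ρ) ≤ l * ∣ S ∣) 1+K≡L
              (off-cycle-few (s≤s⁻¹ (≤-trans 2≤L (≤-reflexive (sym 1+K≡L)))) (≤-trans (≤-reflexive 1+K≡L) L≤ρ) κ≤K ∣S∣+κ)))) ,
          λ _ → ≤-trans one 1≤∣S∣
      ... | inj₂ many = (λ L≤ρ → subst (λ l → suc (suc ρ) * ∣ E S ∣ ≤ l * ∣ S ∣) 1+K≡L
              (off-cycle-many (≤-trans (≤-reflexive 1+K≡L) L≤ρ) many ∣S∣+κ)) ,
          λ _ → +-cancelʳ-≤ κ _ _ (≤-trans many (≤-trans K≤ρ (≤-trans (n≤1+n ρ) (≤-reflexive (sym ∣S∣+κ)))))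

      off-cycle-good : Good
      off-cycle-good = sparse-good S (1≤∣p∣⇒Nonempty S 1≤∣S∣) ends sparse
        (λ w₀∈S → x∉p─q {p = N f} w₀∈S (∈-vertices⁺ c w₀∈c))

    dual-good : ∀ {e e'} → DP e e' → Good
    dual-good {e} {e'} D with ∣ N e ∩ I D ∣ + ∣ N e' ∩ I D ∣ ≤? L
    ... | yes spread = spread-good D spread
    ... | no crowded with crossing-triple D crowded
    ...   | (a , f , x) , t∈ , x∈e , a∈e' with trip-split (DP.itrail D) t∈
    ...     | p , q , eq , tp , a∈f , x∈f , tq =
      -- Dropping the crossing edge `f` leaves the cycle e w ... a e' w' ... x with L - 1 edges, and
      -- `f` still meets it in `a`.
      OffCycle.off-cycle-good (cyc (w∈e ∷ join tp a∈e' (w'∈e' ∷ rev tq)) x∈e uniq' refl) size' f∉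
        a∈f (there (∈-++⁺ˡ (end∈ tp)))
      where
      open DP D
      perm₁ : ed e ∷ p ++ ed e' ∷ reverse q ↭ ed e ∷ ed e' ∷ p ++ q
      perm₁ = ↭-prep _ (↭-trans (shift (ed e') p (reverse q)) (↭-prep _ (++⁺ˡ p (↭-reverse q))))
      perm₂ : ed e ∷ ed e' ∷ inner ↭ ed f ∷ ed e ∷ ed e' ∷ p ++ q
      perm₂ = ↭-trans (↭-prep _ (↭-prep _ (↭-trans (↭-reflexive eq) (shift (ed f) p q))))
        (↭-trans (↭-prep _ (Perm.swap _ _ ↭-refl)) (Perm.swap _ _ ↭-refl))
      f∉ : ed f ∉ˡ ed e ∷ p ++ ed e' ∷ reverse q
      f∉ = ∉-↭ (↭-sym perm₁) (Unique[x∷xs]⇒x∉xs (unique-↭ perm₂ duniq))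
      uniq' : Unique (ed e ∷ p ++ ed e' ∷ reverse q)
      uniq' = unique-↭ (↭-sym perm₁) (unique-tail (unique-↭ perm₂ duniq))
      size' : suc (length (es (ed e ∷ p ++ ed e' ∷ reverse q))) ≡ L
      size' = trans (cong suc (#es-↭ perm₁)) (trans (sym (#es-↭ perm₂)) dsize)

  short-good : ∀ {u v} → LP u v → ¬ ¬ Good
  short-good P ¬good = ¬good (Ends.dual-good (λ Q o → ¬good (outside-good Q o)) (proj₂ (proj₂ (dual P))))

-- Paths of length 1: every component is a single edge.
module SingleEdges {n m : ℕ} (N : Fin m → Subset n) (ρ : ℕ) (2≤ρ : 2 ≤ ρ)
  (unif : ∀ {e v} → v ∈ N e → ∣ N e ∣ ≡ suc ρ)
  (dist : ∀ {e e' v} → v ∈ N e → N e ≡ N e' → e ≡ e')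
  (longest : ∀ {u xs v} → Incidence.Trail N (vt u) xs (vt v) → Unique xs → length (es xs) ≤ 1) where

  open Structure N ρ 2≤ρ unif dist
  open Longest 1 longest

  edge-good : ∀ {e u} → u ∈ N e → Good
  edge-good {e} {u} u∈e = good (N e) (u , u∈e) ends
    (≤-trans (*-monoʳ-≤ (suc ρ) ∣E∣≤1) (≤-reflexive (trans (*-identityʳ (suc ρ)) (trans (sym (unif u∈e)) (sym (+-identityʳ _))))))
    λ all _ → inj₂ (trans (≤-antisym ∣E∣≤1 (x∈p⇒1≤∣p∣ (∈⟪⟫⁺ (meets? (N e)) (u , u∈e , u∈e))))
      (trans (sym (nCn≡1 (suc ρ))) (cong (_C suc ρ) (trans (sym (unif u∈e)) (trans (cong ∣_∣ (⊆-antisym ⊆⊤ (λ {x} _ → all x))) (∣⊤∣≡n n))))))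
    where
    ends : ∀ {v} → v ∈ N e → ∃ λ w → LP v w
    ends {v} v∈e with other-vertex v∈e v
    ... | w , w∈e , w≢v = w , lp {nodes = vt v ∷ ed e ∷ vt w ∷ []} (v∈e ∷ w∈e ∷ [-])
      (((λ ()) ∷ (λ { refl → w≢v refl }) ∷ []) ∷ ((λ ()) ∷ []) ∷ [] ∷ []) refl
    only : ∀ {f v} → v ∈ N e → v ∈ N f → f ≡ e
    only {f} {v} v∈e v∈f with N f ⊆? N e
    ... | yes f⊆e = dist v∈f (p⊆q∧∣q∣≤∣p∣⇒p≡q f⊆e (≤-reflexive (trans (unif v∈e) (sym (unif v∈f)))))
    ... | no f⊈e with ⊈⇒∃ f⊈e | other-vertex v∈e v
    ...   | y , y∈f , y∉e | z , z∈e , z≢v = ⊥-elim (<⇒≱ ≤-refl (longest {z} {vt z ∷ ed e ∷ vt v ∷ ed f ∷ vt y ∷ []} (z∈e ∷ v∈e ∷ v∈f ∷ y∈f ∷ [-])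
      (((λ ()) ∷ (λ { refl → z≢v refl }) ∷ (λ ()) ∷ (λ { refl → y∉e z∈e }) ∷ []) ∷
       ((λ ()) ∷ (λ { refl → y∉e y∈f }) ∷ (λ ()) ∷ []) ∷
       ((λ ()) ∷ (λ { refl → y∉e v∈e }) ∷ []) ∷ ((λ ()) ∷ []) ∷ [] ∷ [])))
    ∣E∣≤1 : ∣ E (N e) ∣ ≤ 1
    ∣E∣≤1 = ∣p∣≤length (E (N e)) (e ∷ []) λ f∈ → let (_ , v∈e , v∈f) = ∈⟪⟫⁻ (meets? (N e)) f∈ in here (only v∈e v∈f)

-- Natural numbers and fractions among the rationals

open import Defs
open import Data.Fin using (zero; suc)
open import Data.Integer as ℤ using (+_)
import Data.Integer.Properties as ℤₚ
open import Data.Rational as ℚ using (ℚ; 0ℚ; 1ℚ) renaming (_≤_ to _≤ℚ_)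
import Data.Rational.Properties as ℚₚ
open import Data.Rational.Unnormalised as ℚᵘ using (mkℚᵘ; *≡*; *≤*; *<*)
import Data.Rational.Unnormalised.Properties as ℚᵘₚ

fraction : ∀ a b → (+ a ℚ./ suc b) ℚ.* ℕ→ℚ (suc b) ≡ ℕ→ℚ a
fraction a b = ℚₚ.toℚᵘ-injective (begin
  ℚ.toℚᵘ ((+ a ℚ./ suc b) ℚ.* ℕ→ℚ (suc b))                    ≈⟨ ℚₚ.toℚᵘ-homo-* (+ a ℚ./ suc b) (ℕ→ℚ (suc b)) ⟩
  ℚ.toℚᵘ (+ a ℚ./ suc b) ℚᵘ.* ℚ.toℚᵘ (ℕ→ℚ (suc b))            ≈⟨ ℚᵘₚ.*-cong (ℚₚ.toℚᵘ-fromℚᵘ (mkℚᵘ (+ a) b)) (ℚₚ.toℚᵘ-fromℚᵘ (mkℚᵘ (+ suc b) 0)) ⟩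
  mkℚᵘ (+ a) b ℚᵘ.* mkℚᵘ (+ suc b) 0                           ≈⟨ *≡* (trans (ℤₚ.*-identityʳ _) (cong (+ a ℤ.*_) (cong +_ (sym (*-identityʳ (suc b)))))) ⟩
  mkℚᵘ (+ a) 0                                                 ≈⟨ ℚₚ.toℚᵘ-fromℚᵘ (mkℚᵘ (+ a) 0) ⟨
  ℚ.toℚᵘ (ℕ→ℚ a)                                               ∎)
  where open ℚᵘₚ.≃-Reasoning

ℕ→ℚ-+ : ∀ a b → ℕ→ℚ (a + b) ≡ ℕ→ℚ a ℚ.+ ℕ→ℚ b
ℕ→ℚ-+ a b = ℚₚ.toℚᵘ-injective (begin
  ℚ.toℚᵘ (ℕ→ℚ (a + b))                     ≈⟨ ℚₚ.toℚᵘ-fromℚᵘ (mkℚᵘ (+ (a + b)) 0) ⟩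
  mkℚᵘ (+ (a + b)) 0                       ≈⟨ *≡* (cong (ℤ._* + 1) (trans (ℤₚ.pos-+ a b) (sym (cong₂ ℤ._+_ (ℤₚ.*-identityʳ (+ a)) (ℤₚ.*-identityʳ (+ b)))))) ⟩
  mkℚᵘ (+ a) 0 ℚᵘ.+ mkℚᵘ (+ b) 0           ≈⟨ ℚᵘₚ.+-cong (ℚₚ.toℚᵘ-fromℚᵘ (mkℚᵘ (+ a) 0)) (ℚₚ.toℚᵘ-fromℚᵘ (mkℚᵘ (+ b) 0)) ⟨
  ℚ.toℚᵘ (ℕ→ℚ a) ℚᵘ.+ ℚ.toℚᵘ (ℕ→ℚ b)       ≈⟨ ℚₚ.toℚᵘ-homo-+ (ℕ→ℚ a) (ℕ→ℚ b) ⟨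
  ℚ.toℚᵘ (ℕ→ℚ a ℚ.+ ℕ→ℚ b)                 ∎)
  where open ℚᵘₚ.≃-Reasoning

ℕ→ℚ-* : ∀ a b → ℕ→ℚ (a * b) ≡ ℕ→ℚ a ℚ.* ℕ→ℚ b
ℕ→ℚ-* a b = ℚₚ.toℚᵘ-injective (begin
  ℚ.toℚᵘ (ℕ→ℚ (a * b))                     ≈⟨ ℚₚ.toℚᵘ-fromℚᵘ (mkℚᵘ (+ (a * b)) 0) ⟩
  mkℚᵘ (+ (a * b)) 0                       ≈⟨ *≡* (cong (ℤ._* + 1) (ℤₚ.pos-* a b)) ⟩
  mkℚᵘ (+ a) 0 ℚᵘ.* mkℚᵘ (+ b) 0           ≈⟨ ℚᵘₚ.*-cong (ℚₚ.toℚᵘ-fromℚᵘ (mkℚᵘ (+ a) 0)) (ℚₚ.toℚᵘ-fromℚᵘ (mkℚᵘ (+ b) 0)) ⟨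
  ℚ.toℚᵘ (ℕ→ℚ a) ℚᵘ.* ℚ.toℚᵘ (ℕ→ℚ b)       ≈⟨ ℚₚ.toℚᵘ-homo-* (ℕ→ℚ a) (ℕ→ℚ b) ⟨
  ℚ.toℚᵘ (ℕ→ℚ a ℚ.* ℕ→ℚ b)                 ∎)
  where open ℚᵘₚ.≃-Reasoning

ℕ→ℚ-mono-≤ : ∀ {a b} → a ≤ b → ℕ→ℚ a ℚ.≤ ℕ→ℚ b
ℕ→ℚ-mono-≤ {a} {b} a≤b = ℚₚ.toℚᵘ-cancel-≤ (begin
  ℚ.toℚᵘ (ℕ→ℚ a)     ≃⟨ ℚₚ.toℚᵘ-fromℚᵘ (mkℚᵘ (+ a) 0) ⟩
  mkℚᵘ (+ a) 0       ≤⟨ *≤* (ℤₚ.*-monoʳ-≤-nonNeg (+ 1) (ℤ.+≤+ a≤b)) ⟩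
  mkℚᵘ (+ b) 0       ≃⟨ ℚₚ.toℚᵘ-fromℚᵘ (mkℚᵘ (+ b) 0) ⟨
  ℚ.toℚᵘ (ℕ→ℚ b)     ∎)
  where open ℚᵘₚ.≤-Reasoning

ℕ→ℚ-mono-< : ∀ {a b} → a < b → ℕ→ℚ a ℚ.< ℕ→ℚ b
ℕ→ℚ-mono-< {a} {b} a<b = ℚₚ.toℚᵘ-cancel-< (begin-strict
  ℚ.toℚᵘ (ℕ→ℚ a)     ≃⟨ ℚₚ.toℚᵘ-fromℚᵘ (mkℚᵘ (+ a) 0) ⟩
  mkℚᵘ (+ a) 0       <⟨ *<* (ℤₚ.*-monoʳ-<-pos (+ 1) (ℤ.+<+ a<b)) ⟩
  mkℚᵘ (+ b) 0       ≃⟨ ℚₚ.toℚᵘ-fromℚᵘ (mkℚᵘ (+ b) 0) ⟨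
  ℚ.toℚᵘ (ℕ→ℚ b)     ∎)
  where open ℚᵘₚ.≤-Reasoning

ℕ→ℚ-cancel-≤ : ∀ {a b} → ℕ→ℚ a ℚ.≤ ℕ→ℚ b → a ≤ b
ℕ→ℚ-cancel-≤ {a} {b} le = ≮⇒≥ λ b<a → ℚₚ.<-irrefl refl (ℚₚ.<-≤-trans (ℕ→ℚ-mono-< b<a) le)

-- The weight 1/f_r

weight : ℕ → ℕ → ℚ
weight ρ x = recip (f (suc ρ) x)

1≤num : ∀ ρ x → 1 ≤ x → 1 ≤ num ρ x
1≤num ρ x 1≤x with x ≟ 1
... | yes _ = ≤-refl
... | no _ with x ≤? ρ
...   | yes _ = 1≤x
...   | no x≰ρ = 1≤nCk x ρ (<⇒≤ (≰⇒> x≰ρ))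

f-fraction : ∀ ρ x → f (suc ρ) x ℚ.* ℕ→ℚ (den ρ x) ≡ ℕ→ℚ (num ρ x)
f-fraction ρ x with x ≟ 1
... | yes _ = fraction 1 ρ
... | no _ with x ≤? ρ
...   | yes _ = fraction x (suc ρ)
...   | no _ = fraction (x C ρ) ρ

recip-inverse : ∀ q → q ≢ 0ℚ → recip q ℚ.* q ≡ 1ℚ
recip-inverse q q≢0 with q ℚ.≟ 0ℚ
... | yes q≡0 = ⊥-elim (q≢0 q≡0)
... | no q≢0' = ℚₚ.*-inverseˡ q ⦃ ℚ.≢-nonZero q≢0' ⦄

weight-fraction : ∀ ρ x → 1 ≤ x → weight ρ x ℚ.* ℕ→ℚ (num ρ x) ≡ ℕ→ℚ (den ρ x)
weight-fraction ρ x 1≤x = begin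
  weight ρ x ℚ.* ℕ→ℚ (num ρ x)                              ≡⟨ cong (weight ρ x ℚ.*_) (f-fraction ρ x) ⟨
  weight ρ x ℚ.* (f (suc ρ) x ℚ.* ℕ→ℚ (den ρ x))            ≡⟨ ℚₚ.*-assoc (weight ρ x) (f (suc ρ) x) _ ⟨
  weight ρ x ℚ.* f (suc ρ) x ℚ.* ℕ→ℚ (den ρ x)              ≡⟨ cong (ℚ._* ℕ→ℚ (den ρ x)) (recip-inverse (f (suc ρ) x) f≢0) ⟩
  1ℚ ℚ.* ℕ→ℚ (den ρ x)                                      ≡⟨ ℚₚ.*-identityˡ _ ⟩
  ℕ→ℚ (den ρ x)                                             ∎
  where
  open ≡-Reasoning
  f≢0 : f (suc ρ) x ≢ 0ℚ
  f≢0 f≡0 = ℚₚ.<-irrefl (trans (sym (trans (cong (ℚ._* ℕ→ℚ (den ρ x)) f≡0) (ℚₚ.*-zeroˡ (ℕ→ℚ (den ρ x))))) (f-fraction ρ x))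
    (ℕ→ℚ-mono-< {0} (1≤num ρ x 1≤x))

ℕ→ℚ-pos : ∀ {a} → 1 ≤ a → ℚ.Positive (ℕ→ℚ a)
ℕ→ℚ-pos {a} 1≤a = ℚ.positive (ℕ→ℚ-mono-< {0} 1≤a)

module _ (ρ x : ℕ) (1≤x : 1 ≤ x) where

  private
    w = weight ρ x
    instance
      num-pos : ℚ.Positive (ℕ→ℚ (num ρ x))
      num-pos = ℕ→ℚ-pos (1≤num ρ x 1≤x)

    total : ∀ k → ℕ→ℚ k ℚ.* w ℚ.* ℕ→ℚ (num ρ x) ≡ ℕ→ℚ (den ρ x * k)
    total k = begin
      ℕ→ℚ k ℚ.* w ℚ.* ℕ→ℚ (num ρ x)        ≡⟨ ℚₚ.*-assoc (ℕ→ℚ k) w _ ⟩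
      ℕ→ℚ k ℚ.* (w ℚ.* ℕ→ℚ (num ρ x))      ≡⟨ cong (ℕ→ℚ k ℚ.*_) (weight-fraction ρ x 1≤x) ⟩
      ℕ→ℚ k ℚ.* ℕ→ℚ (den ρ x)              ≡⟨ ℕ→ℚ-* k (den ρ x) ⟨
      ℕ→ℚ (k * den ρ x)                    ≡⟨ cong ℕ→ℚ (*-comm k (den ρ x)) ⟩
      ℕ→ℚ (den ρ x * k)                    ∎
      where open ≡-Reasoning

    share : ∀ s → ℕ→ℚ s ℚ.* ℕ→ℚ (num ρ x) ≡ ℕ→ℚ (num ρ x * s)
    share s = trans (sym (ℕ→ℚ-* s (num ρ x))) (cong ℕ→ℚ (*-comm s (num ρ x)))

  weights≤ : ∀ {k s} → den ρ x * k ≤ num ρ x * s → ℕ→ℚ k ℚ.* weight ρ x ℚ.≤ ℕ→ℚ s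
  weights≤ {k} {s} h = ℚₚ.*-cancelʳ-≤-pos (ℕ→ℚ (num ρ x))
    (subst₂ ℚ._≤_ (sym (total k)) (sym (share s)) (ℕ→ℚ-mono-≤ h))

  ≤weights : ∀ {k s} → num ρ x * s ≤ den ρ x * k → ℕ→ℚ s ℚ.≤ ℕ→ℚ k ℚ.* weight ρ x
  ≤weights {k} {s} h = ℚₚ.*-cancelʳ-≤-pos (ℕ→ℚ (num ρ x))
    (subst₂ ℚ._≤_ (sym (share s)) (sym (total k)) (ℕ→ℚ-mono-≤ h))

  ≤weights⁻ : ∀ {k s} → ℕ→ℚ s ℚ.≤ ℕ→ℚ k ℚ.* weight ρ x → num ρ x * s ≤ den ρ x * k
  ≤weights⁻ {k} {s} h = ℕ→ℚ-cancel-≤ (subst₂ ℚ._≤_ (share s) (total k)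
    (ℚₚ.*-monoʳ-≤-nonNeg (ℕ→ℚ (num ρ x)) ⦃ ℚₚ.pos⇒nonNeg (ℕ→ℚ (num ρ x)) ⦄ h))

  0≤weight : 0ℚ ℚ.≤ weight ρ x
  0≤weight = ℚₚ.≤-trans (≤weights {1} {0} (≤-trans (≤-reflexive (*-zeroʳ (num ρ x))) z≤n)) (ℚₚ.≤-reflexive (ℚₚ.*-identityˡ _))

-- Strict monotonicity of f_r, cross-multiplied.
private
  cross : ∀ {d n d' n' D N D' N' : ℕ} → n ≡ N × d ≡ D → n' ≡ N' × d' ≡ D' → D' * N < D * N' → d' * n < d * n'
  cross (refl , refl) (refl , refl) h = h

cross-step : ∀ ρ x → 2 ≤ ρ → 1 ≤ x → den ρ (suc x) * num ρ x < den ρ x * num ρ (suc x)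
cross-step ρ@(suc ρ') x 2≤ρ 1≤x with m≤n⇒m<n∨m≡n 1≤x | x <? ρ | x ≤? ρ
... | inj₂ refl | _ | _ = cross {suc ρ} {1} {den ρ 2} {num ρ 2} {suc ρ} {1} (refl , refl) (num-den-mid ≤-refl 2≤ρ) (begin-strict
  (2 + ρ) * 1      ≡⟨ *-identityʳ (2 + ρ) ⟩
  2 + ρ            <⟨ +-monoʳ-< 2 (n<1+n ρ) ⟩
  2 + (1 + ρ)      ≤⟨ +-monoʳ-≤ 2 (+-monoˡ-≤ ρ (<⇒≤ 2≤ρ)) ⟩
  2 + (ρ + ρ)      ≡⟨ cong (λ k → 2 + (ρ + k)) (+-identityʳ ρ) ⟨
  2 + 2 * ρ        ≡⟨ *-suc 2 ρ ⟨
  2 * (1 + ρ)      ≡⟨ *-comm 2 (1 + ρ) ⟩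
  (1 + ρ) * 2      ∎)
  where open ≤-Reasoning
... | inj₁ 2≤x | yes x<ρ | _ = cross (num-den-mid 2≤x (<⇒≤ x<ρ)) (num-den-mid (m≤n⇒m≤1+n 2≤x) x<ρ) (*-monoʳ-< (2 + ρ) (n<1+n x))
... | inj₁ 2≤x | no x≮ρ | yes x≤ρ with ≤-antisym x≤ρ (≮⇒≥ x≮ρ)
-- The seam between the formulas: f_r rises from (r - 1)/(r + 1) to 1.
...   | refl = cross (num-den-mid 2≤ρ ≤-refl) (num-den-big 2≤ρ ≤-refl) (begin-strict
  (1 + ρ) * ρ                ≡⟨ *-comm (1 + ρ) ρ ⟩
  ρ * (1 + ρ)                <⟨ *-monoˡ-< (1 + ρ) (m<n⇒m<1+n (n<1+n ρ)) ⟩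
  (2 + ρ) * (1 + ρ)          ≡⟨ cong ((2 + ρ) *_) ([1+n]Cn≡1+n ρ) ⟨
  (2 + ρ) * (suc ρ C ρ)      ∎)
  where open ≤-Reasoning
cross-step ρ@(suc ρ') x 2≤ρ 1≤x | inj₁ 2≤x | no _ | no x≰ρ =
  cross (num-den-big 2≤ρ (≰⇒> x≰ρ)) (num-den-big 2≤ρ (m≤n⇒m≤1+n (≰⇒> x≰ρ))) (*-monoʳ-< (1 + ρ)
    (≤-trans (+-monoˡ-≤ _ (1≤nCk x ρ' (<⇒≤ (<⇒≤ (≰⇒> x≰ρ))))) (≤-reflexive (nCk+nC[k+1]≡[n+1]C[k+1] x ρ'))))

weight-step : ∀ ρ x → 2 ≤ ρ → 1 ≤ x → weight ρ (suc x) ℚ.< weight ρ x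
weight-step ρ x 2≤ρ 1≤x = ℚₚ.*-cancelʳ-<-nonNeg (ℕ→ℚ (a * b)) ⦃ ℚ.nonNegative (ℕ→ℚ-mono-≤ {0} {a * b} z≤n) ⦄ (begin-strict
  weight ρ (suc x) ℚ.* ℕ→ℚ (a * b)                       ≡⟨ cong (λ k → weight ρ (suc x) ℚ.* ℕ→ℚ k) (*-comm a b) ⟩
  weight ρ (suc x) ℚ.* ℕ→ℚ (b * a)                       ≡⟨ scaled (suc x) a (s≤s z≤n) ⟩
  ℕ→ℚ (den ρ (suc x) * a)                                <⟨ ℕ→ℚ-mono-< (cross-step ρ x 2≤ρ 1≤x) ⟩
  ℕ→ℚ (den ρ x * b)                                      ≡⟨ scaled x b 1≤x ⟨
  weight ρ x ℚ.* ℕ→ℚ (a * b)                             ∎)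
  where
  open ℚₚ.≤-Reasoning
  a = num ρ x
  b = num ρ (suc x)
  scaled : ∀ y k → 1 ≤ y → weight ρ y ℚ.* ℕ→ℚ (num ρ y * k) ≡ ℕ→ℚ (den ρ y * k)
  scaled y k 1≤y = trans (cong (weight ρ y ℚ.*_) (ℕ→ℚ-* (num ρ y) k))
    (trans (sym (ℚₚ.*-assoc (weight ρ y) (ℕ→ℚ (num ρ y)) (ℕ→ℚ k)))
      (trans (cong (ℚ._* ℕ→ℚ k) (weight-fraction ρ y 1≤y)) (sym (ℕ→ℚ-* (den ρ y) k))))

weight-anti-≤ : ∀ {ρ x y} → 2 ≤ ρ → 1 ≤ x → x ≤ y → weight ρ y ℚ.≤ weight ρ x
weight-anti-≤ {ρ} {x} 2≤ρ 1≤x x≤y = go (≤⇒≤′ x≤y)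
  where
  go : ∀ {y} → x ≤′ y → weight ρ y ℚ.≤ weight ρ x
  go ≤′-refl = ℚₚ.≤-refl
  go {suc y} (≤′-step x≤y) = ℚₚ.≤-trans (ℚₚ.<⇒≤ (weight-step ρ y 2≤ρ (≤-trans 1≤x (≤′⇒≤ x≤y)))) (go x≤y)

weight-anti-< : ∀ {ρ x y} → 2 ≤ ρ → 1 ≤ x → x < y → weight ρ y ℚ.< weight ρ x
weight-anti-< {ρ} {x} 2≤ρ 1≤x x<y = ℚₚ.≤-<-trans (weight-anti-≤ 2≤ρ (s≤s z≤n) x<y) (weight-step ρ x 2≤ρ 1≤x)

Σ-mono-≤ : ∀ m {g h : Fin m → ℚ} → (∀ j → g j ℚ.≤ h j) → Σℚ m g ℚ.≤ Σℚ m h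
Σ-mono-≤ zero _ = ℚₚ.≤-refl
Σ-mono-≤ (suc m) g≤h = ℚₚ.+-mono-≤ (g≤h zero) (Σ-mono-≤ m λ j → g≤h (suc j))

Σ-mono-< : ∀ m {g h : Fin m → ℚ} → (∀ j → g j ℚ.≤ h j) → ∀ i → g i ℚ.< h i → Σℚ m g ℚ.< Σℚ m h
Σ-mono-< (suc m) g≤h zero g<h = ℚₚ.+-mono-<-≤ g<h (Σ-mono-≤ m λ j → g≤h (suc j))
Σ-mono-< (suc m) g≤h (suc i) g<h = ℚₚ.+-mono-≤-< (g≤h zero) (Σ-mono-< m (λ j → g≤h (suc j)) i g<h)

Σ-+ : ∀ m (g h : Fin m → ℚ) → Σℚ m (λ j → g j ℚ.+ h j) ≡ Σℚ m g ℚ.+ Σℚ m h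
Σ-+ zero g h = sym (ℚₚ.+-identityˡ 0ℚ)
Σ-+ (suc m) g h = begin
  (g zero ℚ.+ h zero) ℚ.+ Σℚ m (λ j → g (suc j) ℚ.+ h (suc j))       ≡⟨ cong ((g zero ℚ.+ h zero) ℚ.+_) (Σ-+ m (λ j → g (suc j)) (λ j → h (suc j))) ⟩
  (a ℚ.+ b) ℚ.+ (c ℚ.+ d)                                            ≡⟨ ℚₚ.+-assoc a b (c ℚ.+ d) ⟩
  a ℚ.+ (b ℚ.+ (c ℚ.+ d))                                            ≡⟨ cong (a ℚ.+_) (trans (sym (ℚₚ.+-assoc b c d)) (trans (cong (ℚ._+ d) (ℚₚ.+-comm b c)) (ℚₚ.+-assoc c b d))) ⟩
  a ℚ.+ (c ℚ.+ (b ℚ.+ d))                                            ≡⟨ ℚₚ.+-assoc a c (b ℚ.+ d) ⟨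
  (a ℚ.+ c) ℚ.+ (b ℚ.+ d)                                            ∎
  where
  open ≡-Reasoning
  a = g zero
  b = h zero
  c = Σℚ m (λ j → g (suc j))
  d = Σℚ m (λ j → h (suc j))

Σ-0 : ∀ m {g : Fin m → ℚ} → (∀ j → g j ≡ 0ℚ) → Σℚ m g ≡ 0ℚ
Σ-0 zero _ = refl
Σ-0 (suc m) g≡0 = trans (cong₂ ℚ._+_ (g≡0 zero) (Σ-0 m λ j → g≡0 (suc j))) (ℚₚ.+-identityˡ 0ℚ)

Σ-indicator : ∀ {m} (p : Subset m) w → Σℚ m (λ j → if lookup p j then w else 0ℚ) ≡ ℕ→ℚ ∣ p ∣ ℚ.* w
Σ-indicator [] w = sym (ℚₚ.*-zeroˡ w)
Σ-indicator (outside ∷ p) w = trans (ℚₚ.+-identityˡ _) (Σ-indicator p w)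
Σ-indicator (inside ∷ p) w = begin
  w ℚ.+ Σℚ _ (λ j → if lookup p j then w else 0ℚ)    ≡⟨ cong₂ ℚ._+_ (sym (ℚₚ.*-identityˡ w)) (Σ-indicator p w) ⟩
  ℕ→ℚ 1 ℚ.* w ℚ.+ ℕ→ℚ ∣ p ∣ ℚ.* w                    ≡⟨ ℚₚ.*-distribʳ-+ w (ℕ→ℚ 1) (ℕ→ℚ ∣ p ∣) ⟨
  (ℕ→ℚ 1 ℚ.+ ℕ→ℚ ∣ p ∣) ℚ.* w                        ≡⟨ cong (ℚ._* w) (ℕ→ℚ-+ 1 ∣ p ∣) ⟨
  ℕ→ℚ (suc ∣ p ∣) ℚ.* w                              ∎
  where open ≡-Reasoning

Σ-const : ∀ m w → Σℚ m (λ _ → w) ≡ ℕ→ℚ m ℚ.* w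
Σ-const zero w = sym (ℚₚ.*-zeroˡ w)
Σ-const (suc m) w = begin
  w ℚ.+ Σℚ m (λ _ → w)                               ≡⟨ cong₂ ℚ._+_ (sym (ℚₚ.*-identityˡ w)) (Σ-const m w) ⟩
  ℕ→ℚ 1 ℚ.* w ℚ.+ ℕ→ℚ m ℚ.* w                        ≡⟨ ℚₚ.*-distribʳ-+ w (ℕ→ℚ 1) (ℕ→ℚ m) ⟨
  (ℕ→ℚ 1 ℚ.+ ℕ→ℚ m) ℚ.* w                            ≡⟨ cong (ℚ._* w) (ℕ→ℚ-+ 1 m) ⟨
  ℕ→ℚ (suc m) ℚ.* w                                  ∎
  where open ≡-Reasoning

-- `P` is not assumed decidable, so a greatest element is reached only under double negation: if `k`
-- is not greatest, a larger one exists, and `d` bounds how often this can happen.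
maximum : (P : ℕ → Set) (b : ℕ) → (∀ k → P k → k ≤ b) → ∀ {k} → P k → ¬ ¬ (∃ λ l → P l × (∀ k → P k → k ≤ l))
maximum P b bounded {k} Pk = go b k Pk (m≤n+m b k)
  where
  go : ∀ d k → P k → b ≤ k + d → ¬ ¬ (∃ λ l → P l × (∀ k → P k → k ≤ l))
  go zero k Pk b≤ ¬max = ¬max (k , Pk , λ k' Pk' → ≤-trans (bounded k' Pk') (≤-trans b≤ (≤-reflexive (+-identityʳ k))))
  go (suc d) k Pk b≤ ¬max = ¬max (k , Pk , λ k' Pk' → ≮⇒≥ λ k<k' →
    go d k' Pk' (≤-trans b≤ (≤-trans (≤-reflexive (+-suc k d)) (+-monoˡ-≤ d k<k'))) ¬max)

module _ {n m : ℕ} (N : Fin m → Subset n) where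

  -- The cases are L = 1, L ≤ r and L > r. Whether a cycle exists is not decided: under the denial
  -- of a good set every cycle of the relevant length is refuted, and the cases without cycles
  -- apply.
  good-exists : ∀ ρ (2≤ρ : 2 ≤ ρ) (unif : ∀ {e v} → v ∈ N e → ∣ N e ∣ ≡ suc ρ)
    (dist : ∀ {e e' v} → v ∈ N e → N e ≡ N e' → e ≡ e') L (1≤L : 1 ≤ L)
    (longest : ∀ {u xs v} → Incidence.Trail N (vt u) xs (vt v) → Unique xs → length (es xs) ≤ L) {u v} →
    Structure.Longest.LP N ρ 2≤ρ unif dist L longest u v → ¬ ¬ Structure.Longest.Good N ρ 2≤ρ unif dist L longest
  good-exists ρ 2≤ρ unif dist L 1≤L longest P ¬good with m≤n⇒m<n∨m≡n 1≤L
  good-exists ρ 2≤ρ unif dist _ 1≤L longest (Structure.Longest.lp t _ sz) ¬good | inj₂ refl with t | sz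
  ... | Incidence.[-] | ()
  ... | Incidence._∷_ {y = ed e} u∈e _ | _ = ¬good (SingleEdges.edge-good N ρ 2≤ρ unif dist longest u∈e)
  good-exists ρ 2≤ρ unif dist L 1≤L longest P ¬good | inj₁ 2≤L = main
    where
    open Structure N ρ 2≤ρ unif dist
    acyclic : ¬ Cyc (suc L)
    acyclic c = ¬good (Cycles.cycle-good N ρ 2≤ρ unif dist L 1≤L longest c)
    main : Absurd
    main with L ≤? suc ρ
    ... | yes L≤1+ρ = DualPaths.short-good N ρ 2≤ρ unif dist L 2≤L L≤1+ρ longest acyclic
          (λ c → ¬good (ShortPaths.LCycle.L-cycle-good N ρ 2≤ρ unif dist L 2≤L L≤1+ρ longest acyclic c)) P ¬good
    ... | no L≰1+ρ = long-case ρ 2≤ρ unif dist (≰⇒> L≰1+ρ) acyclic longest P ¬good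
      where
      -- Stated again for a variable `ρ`, so that matching can replace it by 2 in all the data that
      -- depend on it.
      long-case : ∀ ρ (2≤ρ : 2 ≤ ρ) (unif : ∀ {e v} → v ∈ N e → ∣ N e ∣ ≡ suc ρ)
        (dist : ∀ {e e' v} → v ∈ N e → N e ≡ N e' → e ≡ e') → suc ρ < L → ¬ Structure.Cyc N ρ 2≤ρ unif dist (suc L) →
        (longest : ∀ {u xs v} → Incidence.Trail N (vt u) xs (vt v) → Unique xs → length (es xs) ≤ L) → ∀ {u v} →
        Structure.Longest.LP N ρ 2≤ρ unif dist L longest u v → ¬ ¬ Structure.Longest.Good N ρ 2≤ρ unif dist L longest
      long-case ρ 2≤ρ unif dist ρ<L acyclic longest P ¬good with m≤n⇒m<n∨m≡n 2≤ρ
      ... | inj₁ 3≤ρ = ¬good (LongPaths.long-good N ρ 2≤ρ unif dist L 1≤L longest acyclic P ρ<L 3≤ρ)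
      ... | inj₂ refl = TripleSystems.triple-good N 2≤ρ unif dist L 1≤L longest acyclic ρ<L P ¬good

-- Trails as Berge paths

module _ {n : ℕ} (H : Hypergraph n) where

  open Incidence (edge H)

  vertex-of : ∀ {u xs v} → Trail (vt u) xs (vt v) → Fin (suc (length (es xs))) → Fin n
  vertex-of {u} _ zero = u
  vertex-of (_∷_ {y = ed e} _ (_∷_ {y = vt w} _ t)) (suc i) = vertex-of t i

  edge-of : ∀ {u xs v} → Trail (vt u) xs (vt v) → Fin (length (es xs)) → Fin (m H)
  edge-of (_∷_ {y = ed e} _ (_∷_ {y = vt w} _ t)) zero = e
  edge-of (_∷_ {y = ed e} _ (_∷_ {y = vt w} _ t)) (suc i) = edge-of t i

  vertex-of∈ : ∀ {u xs v} (t : Trail (vt u) xs (vt v)) i → vt (vertex-of t i) ∈ˡ xs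
  vertex-of∈ t zero = start∈ t
  vertex-of∈ (_∷_ {y = ed e} _ (_∷_ {y = vt w} _ t)) (suc i) = there (there (vertex-of∈ t i))

  edge-of∈ : ∀ {u xs v} (t : Trail (vt u) xs (vt v)) i → ed (edge-of t i) ∈ˡ xs
  edge-of∈ (_∷_ {y = ed e} _ (_∷_ {y = vt w} _ t)) zero = there (here refl)
  edge-of∈ (_∷_ {y = ed e} _ (_∷_ {y = vt w} _ t)) (suc i) = there (there (edge-of∈ t i))

  edge-of-onto : ∀ {u xs v e} (t : Trail (vt u) xs (vt v)) → ed e ∈ˡ xs → ∃ λ i → edge-of t i ≡ e
  edge-of-onto [-] (here ())
  edge-of-onto (_∷_ {y = ed e} _ (_∷_ {y = vt w} _ t)) (there (here refl)) = zero , refl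
  edge-of-onto (_∷_ {y = ed e} _ (_∷_ {y = vt w} _ t)) (there (there e∈)) = let (i , eq) = edge-of-onto t e∈ in suc i , eq

  vertex-of-injective : ∀ {u xs v} (t : Trail (vt u) xs (vt v)) → Unique xs → Injective _≡_ _≡_ (vertex-of t)
  vertex-of-injective t uq {zero} {zero} _ = refl
  vertex-of-injective (_∷_ {y = ed e} _ (_∷_ {y = vt w} _ t)) uq {zero} {suc j} eq =
    ⊥-elim (Unique[x∷xs]⇒x∉xs uq (there (subst (λ v → vt v ∈ˡ _) (sym eq) (vertex-of∈ t j))))
  vertex-of-injective (_∷_ {y = ed e} _ (_∷_ {y = vt w} _ t)) uq {suc i} {zero} eq =
    ⊥-elim (Unique[x∷xs]⇒x∉xs uq (there (subst (λ v → vt v ∈ˡ _) eq (vertex-of∈ t i))))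
  vertex-of-injective (_∷_ {y = ed e} _ (_∷_ {y = vt w} _ t)) uq {suc i} {suc j} eq =
    cong suc (vertex-of-injective t (unique-tail (unique-tail uq)) eq)

  edge-of-injective : ∀ {u xs v} (t : Trail (vt u) xs (vt v)) → Unique xs → Injective _≡_ _≡_ (edge-of t)
  edge-of-injective (_∷_ {y = ed e} _ (_∷_ {y = vt w} _ t)) uq {zero} {zero} _ = refl
  edge-of-injective (_∷_ {y = ed e} _ (_∷_ {y = vt w} _ t)) uq {zero} {suc j} eq =
    ⊥-elim (Unique[x∷xs]⇒x∉xs (unique-tail uq) (subst (λ e → ed e ∈ˡ _) (sym eq) (edge-of∈ t j)))
  edge-of-injective (_∷_ {y = ed e} _ (_∷_ {y = vt w} _ t)) uq {suc i} {zero} eq =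
    ⊥-elim (Unique[x∷xs]⇒x∉xs (unique-tail uq) (subst (λ e → ed e ∈ˡ _) eq (edge-of∈ t i)))
  edge-of-injective (_∷_ {y = ed e} _ (_∷_ {y = vt w} _ t)) uq {suc i} {suc j} eq =
    cong suc (edge-of-injective t (unique-tail (unique-tail uq)) eq)

  left-incident : ∀ {u xs v} (t : Trail (vt u) xs (vt v)) i → vertex-of t (inject₁ i) ∈ edge H (edge-of t i)
  left-incident (_∷_ {y = ed e} u∈e (_∷_ {y = vt w} _ t)) zero = u∈e
  left-incident (_∷_ {y = ed e} _ (_∷_ {y = vt w} _ t)) (suc i) = left-incident t i

  right-incident : ∀ {u xs v} (t : Trail (vt u) xs (vt v)) i → vertex-of t (suc i) ∈ edge H (edge-of t i)
  right-incident (_∷_ {y = ed e} _ (_∷_ {y = vt w} w∈e t)) zero = w∈e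
  right-incident (_∷_ {y = ed e} _ (_∷_ {y = vt w} _ t)) (suc i) = right-incident t i

  bergePath : ∀ {u xs v} → Trail (vt u) xs (vt v) → Unique xs → BergePath H (length (es xs))
  bergePath t uq = record
    { vtx = vertex-of t ; vtx-inj = vertex-of-injective t uq
    ; edg = edge-of t ; edg-inj = edge-of-injective t uq
    ; left∈ = left-incident t ; right∈ = right-incident t }

leave-set : ∀ {n} (A : Subset n) k (g : Fin (suc k) → Fin n) → g zero ∈ A → g (fromℕ k) ∉ A →
  ∃ λ i → g (inject₁ i) ∈ A × g (suc i) ∉ A
leave-set A zero g g₀∈ gₖ∉ = ⊥-elim (gₖ∉ g₀∈)
leave-set A (suc k) g g₀∈ gₖ∉ with g (suc zero) ∈? A
... | no g₁∉ = zero , g₀∈ , g₁∉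
... | yes g₁∈ = let (i , h) = leave-set A k (g ∘ suc) g₁∈ gₖ∉ in suc i , h

crossing-edge : ∀ {n} (H : Hypergraph n) → Connected H → ∀ (A : Subset n) {a b} → a ∈ A → b ∉ A →
  ∃ λ h → ∃₂ λ x y → x ∈ A × y ∉ A × x ∈ edge H h × y ∈ edge H h
crossing-edge H connected A {a} {b} a∈ b∉ with connected a b (λ { refl → b∉ a∈ })
... | k , P , refl , refl = let (i , x∈ , y∉) = leave-set A k (vtx P) a∈ b∉ in
  edg P i , _ , _ , x∈ , y∉ , left∈ P i , right∈ P i

-- Deleting S and induction on the vertex set

module Localized {n ρ : ℕ} (2≤ρ : 2 ≤ ρ) (H : Hypergraph n) (uniform : Uniform (suc ρ) H) (connected : Connected H)
  (p : Fin (m H) → ℕ) (upper : ∀ j k (P : BergePath H k) → Defines P j → k ≤ p j) where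

  w : Fin (m H) → ℚ
  w j = weight ρ (p j)

  -- Edges not inside `A` are emptied instead of removed, so the indices and the function `p` stay
  -- those of the whole hypergraph. This is why uniformity and distinctness are required above only
  -- of edges that have a vertex.
  N : Subset n → Fin (m H) → Subset n
  N A e = if does (edge H e ⊆? A) then edge H e else ⊥

  ∈N⁻ : ∀ A {e v} → v ∈ N A e → edge H e ⊆ A × v ∈ edge H e
  ∈N⁻ A {e} v∈ with edge H e ⊆? A
  ... | yes e⊆A = e⊆A , v∈
  ... | no _ = ⊥-elim (∉⊥ v∈)

  N≡ : ∀ A {e} → edge H e ⊆ A → N A e ≡ edge H e
  N≡ A {e} e⊆A with edge H e ⊆? A
  ... | yes _ = refl
  ... | no e⊈A = ⊥-elim (e⊈A e⊆A)

  N-unif : ∀ A {e v} → v ∈ N A e → ∣ N A e ∣ ≡ suc ρ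
  N-unif A {e} v∈ = trans (cong ∣_∣ (N≡ A (proj₁ (∈N⁻ A v∈)))) (uniform e)

  N-dist : ∀ A {e e' v} → v ∈ N A e → N A e ≡ N A e' → e ≡ e'
  N-dist A {e} {e'} {v} v∈ eq = distinct H (trans (sym (N≡ A (proj₁ (∈N⁻ A v∈)))) (trans eq (N≡ A (proj₁ (∈N⁻ A (subst (v ∈_) eq v∈))))))

  open Incidence (edge H) using () renaming (Trail to Trailᴴ)

  inH : ∀ A {x xs y} → Incidence.Trail (N A) x xs y → Trailᴴ x xs y
  inH A Incidence.[-] = Incidence.[-]
  inH A {vt v} (Incidence._∷_ {y = ed e} v∈ t) = Incidence._∷_ (proj₂ (∈N⁻ A v∈)) (inH A t)
  inH A {ed e} (Incidence._∷_ {y = vt v} v∈ t) = Incidence._∷_ (proj₂ (∈N⁻ A v∈)) (inH A t)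

  length≤p : ∀ {u xs v j} → Trailᴴ (vt u) xs (vt v) → Unique xs → ed j ∈ˡ xs → length (es xs) ≤ p j
  length≤p {j = j} t uq j∈ = upper j _ (bergePath H t uq) (edge-of-onto H t j∈)

  some-vertex : ∀ e → ∃ λ v → v ∈ edge H e
  some-vertex e = 1≤∣p∣⇒Nonempty (edge H e) (subst (1 ≤_) (sym (uniform e)) (s≤s z≤n))

  1≤p : ∀ j → 1 ≤ p j
  1≤p j with some-vertex j
  ... | v , v∈ with another (edge H j) (subst (2 ≤_) (sym (uniform j)) (m≤n⇒m≤1+n 2≤ρ)) v
  ...   | u , u∈ , u≢v = length≤p {v} {vt v ∷ ed j ∷ vt u ∷ []} (Incidence._∷_ v∈ (Incidence._∷_ u∈ Incidence.[-]))
    (((λ ()) ∷ (λ { refl → u≢v refl }) ∷ []) ∷ ((λ ()) ∷ []) ∷ [] ∷ []) (there (here refl))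

  -- A good set for the edges inside `A`, restated with the `p` of the whole hypergraph. `start` is
  -- kept because the strict inequality lengthens these paths by an edge that leaves `A`.
  record Piece (A : Subset n) : Set where
    field
      {L}      : ℕ
      1≤L      : 1 ≤ L
      S        : Subset n
      E        : Subset (m H)
      nonempty : Nonempty S
      S⊆A      : S ⊆ A
      ∈E⁺      : ∀ {e v} → edge H e ⊆ A → v ∈ S → v ∈ edge H e → e ∈ E
      E⇒L≤p    : ∀ {e} → e ∈ E → L ≤ p e
      start    : ∀ {v} → v ∈ S → ∃₂ λ xs u → Incidence.Trail (N A) (vt v) xs (vt u) × Unique xs × length (es xs) ≡ L
      few      : den ρ L * ∣ E ∣ ≤ num ρ L * ∣ S ∣
      full     : (∀ v → v ∈ S) → num ρ L * ∣ S ∣ ≤ den ρ L * ∣ E ∣ → (n ≡ suc (suc ρ) × 2 ≤ ∣ E ∣ × ∣ E ∣ ≤ ρ) ⊎ ∣ E ∣ ≡ n C suc ρ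

  piece-exists : ∀ A → ∃ (λ e → edge H e ⊆ A) → ¬ ¬ Piece A
  piece-exists A (e₀ , e₀⊆A) ¬piece = maximum Path (m H) bounded single λ { (L , (_ , _ , _ , t , uq , sz) , max) →
    found L (max 1 single) (λ {u} {xs} {v} t uq → max (length (es xs)) (u , xs , v , t , uq , refl)) t uq sz }
    where
    Path : ℕ → Set
    Path k = ∃ λ u → ∃₂ λ xs v → Incidence.Trail (N A) (vt u) xs (vt v) × Unique xs × length (es xs) ≡ k
    bounded : ∀ k → Path k → k ≤ m H
    bounded k (_ , xs , _ , _ , uq , refl) = subst (length (es xs) ≤_) (∣⊤∣≡n (m H)) (length≤∣p∣ ⊤ (es-unique uq) (λ _ → ∈⊤))
    single : Path 1
    single with some-vertex e₀
    ... | v , v∈ with another (edge H e₀) (subst (2 ≤_) (sym (uniform e₀)) (m≤n⇒m≤1+n 2≤ρ)) v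
    ...   | u , u∈ , u≢v = v , vt v ∷ ed e₀ ∷ vt u ∷ [] , u ,
      Incidence._∷_ (subst (v ∈_) (sym (N≡ A e₀⊆A)) v∈) (Incidence._∷_ (subst (u ∈_) (sym (N≡ A e₀⊆A)) u∈) Incidence.[-]) ,
      ((λ ()) ∷ (λ { refl → u≢v refl }) ∷ []) ∷ ((λ ()) ∷ []) ∷ [] ∷ [] , refl
    open Structure (N A) ρ 2≤ρ (N-unif A) (N-dist A)
    found : ∀ L → 1 ≤ L → (longest : ∀ {u xs v} → Trail (vt u) xs (vt v) → Unique xs → length (es xs) ≤ L) →
      ∀ {u xs v} → Trail (vt u) xs (vt v) → Unique xs → length (es xs) ≡ L → Absurd
    found L 1≤L longest t uq sz = good-exists (N A) ρ 2≤ρ (N-unif A) (N-dist A) L 1≤L longest (Longest.lp t uq sz) λ G → ¬piece (record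
      { 1≤L = 1≤L ; S = Good.S G ; E = E (Good.S G) ; nonempty = Good.nonempty G
      ; S⊆A = λ v∈ → in-A (proj₂ (Good.ends G v∈))
      ; ∈E⁺ = λ e⊆A v∈S v∈e → ∈⟪⟫⁺ (meets? (Good.S G)) (_ , v∈S , subst (_ ∈_) (sym (N≡ A e⊆A)) v∈e)
      ; E⇒L≤p = λ e∈ → let (_ , _ , Q , e∈Q) = good-through G (∈⟪⟫⁻ (meets? (Good.S G)) e∈)
                       in ≤-trans (≤-reflexive (sym (LP.size Q))) (length≤p (inH A (LP.trail Q)) (LP.uniq Q) e∈Q)
      ; start = λ v∈ → let (u , P) = Good.ends G v∈ in LP.nodes P , u , LP.trail P , LP.uniq P , LP.size P
      ; few = Good.few G ; full = Good.full G })
      where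
      open Longest L longest
      in-A : ∀ {u v} → LP u v → u ∈ A
      in-A (lp [-] _ refl) = ⊥-elim (<⇒≱ 1≤L z≤n)
      in-A (lp (_∷_ {y = ed e} u∈ _) _ _) = let (e⊆A , u∈e) = ∈N⁻ A u∈ in e⊆A u∈e

  term : Subset n → Fin (m H) → ℚ
  term A j = if does (edge H j ⊆? A) then w j else 0ℚ

  total : Subset n → ℚ
  total A = Σℚ (m H) (term A)

  module _ {A : Subset n} (piece : Piece A) where
    open Piece piece

    c : ℚ
    c = weight ρ L

    0≤c : 0ℚ ℚ.≤ c
    0≤c = 0≤weight ρ L 1≤L

    indicator : Fin (m H) → ℚ
    indicator j = if lookup E j then c else 0ℚ

    0≤indicator : ∀ j → 0ℚ ℚ.≤ indicator j
    0≤indicator j with lookup E j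
    ... | true = 0≤c
    ... | false = ℚₚ.≤-refl

    indicator-E : ∀ {j} → j ∈ E → indicator j ≡ c
    indicator-E {j} j∈ rewrite []=⇒lookup j∈ = refl

    removed : ∀ {j} → edge H j ⊆ A → ¬ (edge H j ⊆ A ─ S) → j ∈ E
    removed e⊆A e⊈ = let (v , v∈e , v∉) = ⊈⇒∃ e⊈ in
      ∈E⁺ e⊆A (decidable-stable (v ∈? S) (λ v∉S → v∉ (x∈p∧x∉q⇒x∈p─q (e⊆A v∈e) v∉S))) v∈e

    -- An edge inside `A` that does not survive the deletion meets S, hence belongs to `E`, and p ≥
    -- L bounds its weight by 1/f_r(L).
    term-step : ∀ j → term A j ℚ.≤ term (A ─ S) j ℚ.+ indicator j
    term-step j with edge H j ⊆? A | edge H j ⊆? (A ─ S)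
    ... | yes _ | yes _ = ℚₚ.≤-trans (ℚₚ.≤-reflexive (sym (ℚₚ.+-identityʳ (w j)))) (ℚₚ.+-monoʳ-≤ (w j) (0≤indicator j))
    ... | yes e⊆A | no e⊈ = ℚₚ.≤-trans (weight-anti-≤ 2≤ρ 1≤L (E⇒L≤p (removed e⊆A e⊈)))
      (ℚₚ.≤-reflexive (sym (trans (ℚₚ.+-identityˡ _) (indicator-E (removed e⊆A e⊈)))))
    ... | no e⊈A | yes e⊆ = ⊥-elim (e⊈A (⊆-trans e⊆ (p─q⊆p A S)))
    ... | no _ | no _ = ℚₚ.≤-trans (0≤indicator j) (ℚₚ.≤-reflexive (sym (ℚₚ.+-identityˡ _)))

    term-step-< : ∀ {j v} → edge H j ⊆ A → v ∈ S → v ∈ edge H j → L < p j → term A j ℚ.< term (A ─ S) j ℚ.+ indicator j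
    term-step-< {j} {v} e⊆A v∈S v∈e L<p with edge H j ⊆? A | edge H j ⊆? (A ─ S)
    ... | no e⊈A | _ = ⊥-elim (e⊈A e⊆A)
    ... | yes _ | yes e⊆ = ⊥-elim (x∉p─q {p = A} (e⊆ v∈e) v∈S)
    ... | yes _ | no _ = ℚₚ.<-≤-trans (weight-anti-< 2≤ρ 1≤L L<p)
      (ℚₚ.≤-reflexive (sym (trans (ℚₚ.+-identityˡ _) (indicator-E (∈E⁺ e⊆A v∈S v∈e)))))

    split-total : Σℚ (m H) (λ j → term (A ─ S) j ℚ.+ indicator j) ≡ total (A ─ S) ℚ.+ ℕ→ℚ ∣ E ∣ ℚ.* c
    split-total = trans (Σ-+ (m H) (term (A ─ S)) indicator) (cong (total (A ─ S) ℚ.+_) (Σ-indicator E c))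

    removed-weight : ℕ→ℚ ∣ E ∣ ℚ.* c ℚ.≤ ℕ→ℚ ∣ S ∣
    removed-weight = weights≤ ρ L 1≤L few

    total-step : total A ℚ.≤ total (A ─ S) ℚ.+ ℕ→ℚ ∣ E ∣ ℚ.* c
    total-step = ℚₚ.≤-trans (Σ-mono-≤ (m H) term-step) (ℚₚ.≤-reflexive split-total)

    ∣A∣ : ℕ→ℚ ∣ A ─ S ∣ ℚ.+ ℕ→ℚ ∣ S ∣ ℚ.≤ ℕ→ℚ ∣ A ∣
    ∣A∣ = ℚₚ.≤-trans (ℚₚ.≤-reflexive (sym (ℕ→ℚ-+ ∣ A ─ S ∣ ∣ S ∣))) (ℕ→ℚ-mono-≤ (begin
      ∣ A ─ S ∣ + ∣ S ∣          ≤⟨ +-monoʳ-≤ ∣ A ─ S ∣ (p⊆q⇒∣p∣≤∣q∣ λ v∈ → x∈p∩q⁺ (S⊆A v∈ , v∈)) ⟩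
      ∣ A ─ S ∣ + ∣ A ∩ S ∣      ≡⟨ ∣p∣≡∣p─q∣+∣p∩q∣ A S ⟨
      ∣ A ∣                      ∎))
      where open ≤-Reasoning

    smaller : ∣ A ─ S ∣ < ∣ A ∣
    smaller = p∩q≢∅⇒∣p─q∣<∣p∣ A S (let (v , v∈) = nonempty in v , x∈p∩q⁺ (S⊆A v∈ , v∈))

  edgeless : ∀ {A} → ¬ ∃ (λ e → edge H e ⊆ A) → total A ≡ 0ℚ
  edgeless {A} none = Σ-0 (m H) λ j → zero-term j
    where
    zero-term : ∀ j → term A j ≡ 0ℚ
    zero-term j with edge H j ⊆? A
    ... | yes e⊆A = ⊥-elim (none (j , e⊆A))
    ... | no _ = refl

  has-edge? : ∀ A → Dec (∃ λ e → edge H e ⊆ A)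
  has-edge? A = any? λ e → edge H e ⊆? A

  total≤ : ∀ k A → ∣ A ∣ ≤ k → total A ℚ.≤ ℕ→ℚ ∣ A ∣
  total≤ k A ∣A∣≤k with has-edge? A
  ... | no none = ℚₚ.≤-trans (ℚₚ.≤-reflexive (edgeless none)) (ℕ→ℚ-mono-≤ {0} {∣ A ∣} z≤n)
  total≤ zero A ∣A∣≤0 | yes (e , e⊆A) = ⊥-elim (<⇒≱ (x∈p⇒1≤∣p∣ (e⊆A (proj₂ (some-vertex e)))) ∣A∣≤0)
  total≤ (suc k) A ∣A∣≤k | yes active = decidable-stable (total A ℚₚ.≤? ℕ→ℚ ∣ A ∣) λ ≰ → piece-exists A active λ P → ≰ (begin
    total A                                                  ≤⟨ total-step P ⟩
    total (A ─ Piece.S P) ℚ.+ ℕ→ℚ ∣ Piece.E P ∣ ℚ.* c P      ≤⟨ ℚₚ.+-mono-≤ (total≤ k (A ─ Piece.S P) (s≤s⁻¹ (≤-trans (smaller P) ∣A∣≤k))) (removed-weight P) ⟩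
    ℕ→ℚ ∣ A ─ Piece.S P ∣ ℚ.+ ℕ→ℚ ∣ Piece.S P ∣              ≤⟨ ∣A∣ P ⟩
    ℕ→ℚ ∣ A ∣                                                ∎)
    where open ℚₚ.≤-Reasoning

  -- An edge that leaves A extends the longest paths inside A.
  total<-piece : ∀ {A a b} (P : Piece A) → A ⊆ Piece.S P → a ∈ A → b ∉ A →
    total A ℚ.< total (A ─ Piece.S P) ℚ.+ ℕ→ℚ ∣ Piece.E P ∣ ℚ.* c P
  total<-piece {A} P A⊆S a∈ b∉ with crossing-edge H connected A a∈ b∉
  ... | h , x , y , x∈A , y∉A , x∈h , y∈h with Piece.start P (A⊆S x∈A)
  ...   | _ , _ , Incidence.[-] , _ , sz = ⊥-elim (<⇒≱ (Piece.1≤L P) (≤-trans (≤-reflexive (sym sz)) z≤n))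
  -- The path y h x j ... has length L + 1 in the whole hypergraph, so its edge `j` at S has p > L
  -- and weighs strictly less than 1/f_r(L).
  ...   | xs , u , t@(Incidence._∷_ {y = ed j} x∈j t') , uq , sz =
    ℚₚ.<-≤-trans (Σ-mono-< (m H) (term-step P) j
      (term-step-< P (proj₁ (∈N⁻ A x∈j)) (A⊆S x∈A) (proj₂ (∈N⁻ A x∈j)) (subst (λ k → suc k ≤ p j) sz
        (length≤p (Incidence._∷_ y∈h (Incidence._∷_ x∈h (inH A t)))
          (unique-∷ y∉ (unique-∷ h∉ uq)) (there (there (there (Incidence.start∈ (N A) t'))))))))
      (ℚₚ.≤-reflexive (split-total P))
    where
    open Incidence (N A) using (trip-split; edge∈trip; third∈trip)
    h∉ : ed h ∉ˡ xs
    h∉ h∈ with edge∈trip t h∈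
    ... | _ , _ , t∈ with trip-split t t∈
    ...   | _ , _ , _ , _ , a∈h , _ = y∉A (proj₁ (∈N⁻ A a∈h) y∈h)
    y∉ : vt y ∉ˡ ed h ∷ xs
    y∉ (there y∈) with third∈trip t y∈ (λ { refl → y∉A x∈A })
    ... | _ , _ , t∈ with trip-split t t∈
    ...   | _ , _ , _ , _ , _ , y∈e , _ = y∉A (proj₁ (∈N⁻ A y∈e) (proj₂ (∈N⁻ A y∈e)))

  total< : ∀ k A → ∣ A ∣ ≤ k → ∀ {a b} → a ∈ A → b ∉ A → total A ℚ.< ℕ→ℚ ∣ A ∣
  total< k A ∣A∣≤k a∈ b∉ with has-edge? A
  ... | no none = ℚₚ.≤-<-trans (ℚₚ.≤-reflexive (edgeless none)) (ℕ→ℚ-mono-< {0} {∣ A ∣} (x∈p⇒1≤∣p∣ a∈))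
  total< zero A ∣A∣≤0 a∈ b∉ | yes _ = ⊥-elim (<⇒≱ (x∈p⇒1≤∣p∣ a∈) ∣A∣≤0)
  total< (suc k) A ∣A∣≤k a∈ b∉ | yes active = decidable-stable (total A ℚₚ.<? ℕ→ℚ ∣ A ∣) λ ≮ → piece-exists A active λ P → ≮ (below P)
    where
    open ℚₚ.≤-Reasoning
    below : Piece A → total A ℚ.< ℕ→ℚ ∣ A ∣
    below P with nonempty? (A ─ Piece.S P)
    ... | yes (_ , a'∈) = begin-strict
      total A                                                  ≤⟨ total-step P ⟩
      total (A ─ Piece.S P) ℚ.+ ℕ→ℚ ∣ Piece.E P ∣ ℚ.* c P      <⟨ ℚₚ.+-mono-<-≤ (total< k (A ─ Piece.S P) (s≤s⁻¹ (≤-trans (smaller P) ∣A∣≤k)) a'∈ (b∉ ∘ p─q⊆p A _)) (removed-weight P) ⟩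
      ℕ→ℚ ∣ A ─ Piece.S P ∣ ℚ.+ ℕ→ℚ ∣ Piece.S P ∣              ≤⟨ ∣A∣ P ⟩
      ℕ→ℚ ∣ A ∣                                                ∎
    -- Nothing is left for the induction, so the strictness has to come from the piece itself.
    ... | no empty = begin-strict
      total A                                                  <⟨ total<-piece P (λ {v} v∈A → decidable-stable (v ∈? Piece.S P) (λ v∉ → empty (v , x∈p∧x∉q⇒x∈p─q v∈A v∉))) a∈ b∉ ⟩
      total (A ─ Piece.S P) ℚ.+ ℕ→ℚ ∣ Piece.E P ∣ ℚ.* c P      ≤⟨ ℚₚ.+-mono-≤ (total≤ k (A ─ Piece.S P) (s≤s⁻¹ (≤-trans (smaller P) ∣A∣≤k))) (removed-weight P) ⟩
      ℕ→ℚ ∣ A ─ Piece.S P ∣ ℚ.+ ℕ→ℚ ∣ Piece.S P ∣              ≤⟨ ∣A∣ P ⟩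
      ℕ→ℚ ∣ A ∣                                                ∎

-- The case of equality

module Equality {n ρ : ℕ} (2≤ρ : 2 ≤ ρ) (H : Hypergraph n) (uniform : Uniform (suc ρ) H) (connected : Connected H)
  (p : Fin (m H) → ℕ) (isp : ∀ j → IsPH H j (p j)) where

  open Localized 2≤ρ H uniform connected p (λ j → proj₂ (isp j))

  sum : ℚ
  sum = Σℚ (m H) w

  sum≡total : sum ≡ total ⊤
  sum≡total = ℚₚ.≤-antisym (Σ-mono-≤ (m H) λ j → ℚₚ.≤-reflexive (term-⊤ j)) (Σ-mono-≤ (m H) λ j → ℚₚ.≤-reflexive (sym (term-⊤ j)))
    where
    term-⊤ : ∀ j → w j ≡ term ⊤ j
    term-⊤ j with edge H j ⊆? ⊤
    ... | yes _ = refl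
    ... | no e⊈⊤ = ⊥-elim (e⊈⊤ ⊆⊤)

  sum≤n : sum ℚ.≤ ℕ→ℚ n
  sum≤n = subst₂ ℚ._≤_ (sym sum≡total) (cong ℕ→ℚ (∣⊤∣≡n n)) (total≤ n ⊤ (≤-reflexive (∣⊤∣≡n n)))

  Extremal : ℕ → Set
  Extremal k = (n ≡ suc (suc ρ) × 2 ≤ k × k ≤ ρ) ⊎ k ≡ n C suc ρ

  extremal? : ∀ k → Dec (Extremal k)
  extremal? k = ((n ≟ suc (suc ρ)) ×-dec ((2 ≤? k) ×-dec (k ≤? ρ))) ⊎-dec (k ≟ n C suc ρ)

  equality⇒extremal : 1 ≤ n → sum ≡ ℕ→ℚ n → Extremal (m H)
  equality⇒extremal 1≤n eq with has-edge? ⊤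
  ... | no none = ⊥-elim (ℚₚ.<-irrefl (trans (sym (trans sum≡total (edgeless none))) eq) (ℕ→ℚ-mono-< {0} {n} 1≤n))
  ... | yes active = decidable-stable (extremal? (m H)) λ ¬ext → piece-exists ⊤ active λ P → ¬ext (extremal P)
    where
    n≤total : ℕ→ℚ n ℚ.≤ total ⊤
    n≤total = ℚₚ.≤-reflexive (trans (sym eq) sum≡total)
    module _ (P : Piece ⊤) where
      open Piece P
      open ℚₚ.≤-Reasoning
      rest = ⊤ ─ S
      -- A nonempty remainder would be a proper part of the vertex set, as S is nonempty, and the
      -- strict bound there contradicts equality.
      empty : Empty rest
      empty (a , a∈) = ℚₚ.<-irrefl refl (begin-strict
        total ⊤                                ≤⟨ total-step P ⟩
        total rest ℚ.+ ℕ→ℚ ∣ E ∣ ℚ.* c P       <⟨ ℚₚ.+-mono-<-≤ (total< n rest (∣p∣≤n rest) a∈ (λ b∈ → x∉p─q {p = ⊤} b∈ (proj₂ nonempty))) (removed-weight P) ⟩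
        ℕ→ℚ ∣ rest ∣ ℚ.+ ℕ→ℚ ∣ S ∣             ≤⟨ ∣A∣ P ⟩
        ℕ→ℚ ∣ ⊤ {n} ∣                          ≡⟨ cong ℕ→ℚ (∣⊤∣≡n n) ⟩
        ℕ→ℚ n                                  ≤⟨ n≤total ⟩
        total ⊤                                ∎)
      all∈S : ∀ v → v ∈ S
      all∈S v = decidable-stable (v ∈? S) λ v∉ → empty (v , x∈p∧x∉q⇒x∈p─q ∈⊤ v∉)
      ∣rest∣≡0 : ∣ rest ∣ ≡ 0
      ∣rest∣≡0 = trans (cong ∣_∣ (Empty-unique empty)) (∣⊥∣≡0 n)
      n≤share : ℕ→ℚ n ℚ.≤ ℕ→ℚ ∣ E ∣ ℚ.* c P
      n≤share = begin
        ℕ→ℚ n                                  ≤⟨ n≤total ⟩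
        total ⊤                                ≤⟨ total-step P ⟩
        total rest ℚ.+ ℕ→ℚ ∣ E ∣ ℚ.* c P       ≤⟨ ℚₚ.+-monoˡ-≤ (ℕ→ℚ ∣ E ∣ ℚ.* c P) (ℚₚ.≤-trans (total≤ n rest (∣p∣≤n rest)) (ℚₚ.≤-reflexive (cong ℕ→ℚ ∣rest∣≡0))) ⟩
        0ℚ ℚ.+ ℕ→ℚ ∣ E ∣ ℚ.* c P               ≡⟨ ℚₚ.+-identityˡ _ ⟩
        ℕ→ℚ ∣ E ∣ ℚ.* c P                      ∎
      all∈E : ∀ e → e ∈ E
      all∈E e = let (v , v∈e) = some-vertex e in ∈E⁺ ⊆⊤ (all∈S v) v∈e
      ∣E∣≡m : ∣ E ∣ ≡ m H
      ∣E∣≡m = trans (cong ∣_∣ (⊆-antisym {i = E} ⊆⊤ (λ {e} _ → all∈E e))) (∣⊤∣≡n (m H))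
      extremal : Extremal (m H)
      extremal = subst Extremal ∣E∣≡m (full all∈S (≤-trans (*-monoʳ-≤ (num ρ L) (∣p∣≤n S)) (≤weights⁻ ρ L 1≤L n≤share)))

  p≤m : ∀ j → p j ≤ m H
  p≤m j = injective⇒≤ (edg-inj (proj₁ (proj₁ (isp j))))

  p<n : ∀ j → p j < n
  p<n j = injective⇒≤ (vtx-inj (proj₁ (proj₁ (isp j))))

  -- Each weight is at least 1/f_r(x), so the sum is at least m/f_r(x) ≥ n; the upper bound is
  -- `sum≤n`.
  equality : ∀ x → 1 ≤ x → (∀ j → p j ≤ x) → num ρ x * n ≤ den ρ x * m H → sum ≡ ℕ→ℚ n
  equality x 1≤x p≤x enough = ℚₚ.≤-antisym sum≤n (begin
    ℕ→ℚ n                                  ≤⟨ ≤weights ρ x 1≤x enough ⟩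
    ℕ→ℚ (m H) ℚ.* weight ρ x               ≡⟨ Σ-const (m H) (weight ρ x) ⟨
    Σℚ (m H) (λ _ → weight ρ x)            ≤⟨ Σ-mono-≤ (m H) (λ j → weight-anti-≤ 2≤ρ (1≤p j) (p≤x j)) ⟩
    sum                                    ∎)
    where open ℚₚ.≤-Reasoning

  -- A single edge misses one of the r + 1 vertices, and connectedness would need a second edge to
  -- reach it.
  not-one : n ≡ suc (suc ρ) → 1 ≤ m H → m H ≢ 1
  not-one n≡ 1≤m m≡1 = contradiction-at (fromℕ< 1≤m)
    where
    only : ∀ {k} → k ≡ 1 → (i j : Fin k) → i ≡ j
    only refl zero zero = refl
    contradiction-at : Fin (m H) → Absurd
    contradiction-at e with some-vertex e | ⊈⇒∃ {p = ⊤} {edge H e} (λ ⊤⊆e → <⇒≱ (≤-reflexive (sym n≡))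
                                  (≤-trans (≤-reflexive (sym (∣⊤∣≡n n))) (≤-trans (p⊆q⇒∣p∣≤∣q∣ ⊤⊆e) (≤-reflexive (uniform e)))))
    ... | v , v∈ | b , _ , b∉ with crossing-edge H connected (edge H e) v∈ b∉
    ...   | h , _ , y , _ , y∉ , _ , y∈h = y∉ (subst (λ e → y ∈ edge H e) (only m≡1 h e) y∈h)

  few-edges : n ≡ suc (suc ρ) → 1 ≤ m H → m H ≤ ρ → sum ≡ ℕ→ℚ n
  few-edges n≡ 1≤m m≤ρ with m≤n⇒m<n∨m≡n 1≤m
  ... | inj₂ 1≡m = ⊥-elim (not-one n≡ 1≤m (sym 1≡m))
  -- A path has at most m distinct edges, and f_r(m) (r + 1) = m.
  ... | inj₁ 2≤m = equality (m H) 1≤m p≤m (≤-reflexive (trans (cong₂ _*_ (proj₁ nd) n≡)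
      (trans (*-comm (m H) (suc (suc ρ))) (cong (_* m H) (sym (proj₂ nd))))))
    where nd = num-den-mid 2≤m m≤ρ

  complete : suc ρ ≤ n → m H ≡ n C suc ρ → sum ≡ ℕ→ℚ n
  complete ρ<n m≡ with m≤n⇒m<n∨m≡n ρ<n
  ... | inj₂ refl = equality 1 ≤-refl (λ j → ≤-trans (p≤m j) (≤-reflexive m≡1)) (≤-reflexive (begin
      1 * suc ρ          ≡⟨ *-comm 1 (suc ρ) ⟩
      suc ρ * 1          ≡⟨ cong (suc ρ *_) m≡1 ⟨
      suc ρ * m H        ∎))
    where
    open ≡-Reasoning
    m≡1 : m H ≡ 1
    m≡1 = trans m≡ (nCn≡1 (suc ρ))
  ... | inj₁ ρ+1<n = at n refl ρ+1<n
    where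
    at : ∀ k → k ≡ n → suc ρ < k → sum ≡ ℕ→ℚ n
    -- A path on n vertices has length at most n - 1, and f_r(n - 1) n = C(n, r).
    at (suc k) k≡ (s≤s ρ<k) = equality k (≤-trans (s≤s z≤n) ρ<k) (λ j → s≤s⁻¹ (≤-trans (p<n j) (≤-reflexive (sym k≡)))) (≤-reflexive (begin
      num ρ k * n                    ≡⟨ cong₂ _*_ (proj₁ nd) (sym k≡) ⟩
      (k C ρ) * suc k                ≡⟨ *-comm (k C ρ) (suc k) ⟩
      suc k * (k C ρ)                ≡⟨ absorb k ρ ⟨
      suc ρ * (suc k C suc ρ)        ≡⟨ cong₂ _*_ (sym (proj₂ nd)) (trans (cong (_C suc ρ) k≡) (sym m≡)) ⟩
      den ρ k * m H                  ∎))
      where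
      open ≡-Reasoning
      nd = num-den-big 2≤ρ ρ<k

theorem2p1 : (n r : ℕ) → 3 ≤ r → r ≤ n →
    (H : Hypergraph n) → Uniform r H → Connected H →
    (p : Fin (m H) → ℕ) → (∀ j → IsPH H j (p j)) →
    (Σℚ (m H) (λ j → recip (f r (p j))) ≤ℚ ℕ→ℚ n) ×
    ((Σℚ (m H) (λ j → recip (f r (p j))) ≡ ℕ→ℚ n) ⇔
    ((n ≡ suc r × ((1 ≤ m H × m H ≤ r ∸ 1) ⊎ m H ≡ r + 1)) ⊎
    (n ≢ suc r × m H ≡ n C r)))
theorem2p1 n (suc ρ) (s≤s 2≤ρ) r≤n H uniform connected p isp = sum≤n , mk⇔ (to ∘ equality⇒extremal (≤-trans (s≤s z≤n) r≤n)) back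
  where
  open Equality 2≤ρ H uniform connected p isp
  2+ρ : n ≡ suc (suc ρ) → n C suc ρ ≡ suc ρ + 1
  2+ρ n≡ = trans (cong (_C suc ρ) n≡) (trans ([1+n]Cn≡1+n (suc ρ)) (+-comm 1 (suc ρ)))
  to : Extremal (m H) → (n ≡ suc (suc ρ) × ((1 ≤ m H × m H ≤ ρ) ⊎ m H ≡ suc ρ + 1)) ⊎ (n ≢ suc (suc ρ) × m H ≡ n C suc ρ)
  to (inj₁ (n≡ , 2≤m , m≤ρ)) = inj₁ (n≡ , inj₁ (<⇒≤ 2≤m , m≤ρ))
  to (inj₂ m≡) with n ≟ suc (suc ρ)
  ... | yes n≡ = inj₁ (n≡ , inj₂ (trans m≡ (2+ρ n≡)))
  ... | no n≢ = inj₂ (n≢ , m≡)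
  back : (n ≡ suc (suc ρ) × ((1 ≤ m H × m H ≤ ρ) ⊎ m H ≡ suc ρ + 1)) ⊎ (n ≢ suc (suc ρ) × m H ≡ n C suc ρ) → sum ≡ ℕ→ℚ n
  back (inj₁ (n≡ , inj₁ (1≤m , m≤ρ))) = few-edges n≡ 1≤m m≤ρ
  back (inj₁ (n≡ , inj₂ m≡)) = complete r≤n (trans m≡ (sym (2+ρ n≡)))
  back (inj₂ (_ , m≡)) = complete r≤n m≡
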